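{- Let $n,q$ be positive integers with $n$ odd and $n\mid q$. Then $\chi^W_{A_{n-1}}(q)/n!$ equals the number of cyclic necklaces (arrangements of beads on a circle up to rotation) with $n$ black beads and $q-n$ white beads.
   Context: $A_{n-1}=\{e_i-e_j:1\le i<j\le n\}\subset\mathbb{R}^n$; its weight lattice is $\Lambda_W=\{a\in\mathbb{R}^n:\sum a_i=0,\ a\in\mathbb{Z}^n+\mathbb{R}(1,\dots,1)\}$, of rank $n-1$. For a finite list $A$ in a lattice $\Lambda$ of rank $N$, with $r(B)=\dim\operatorname{span}_{\mathbb{R}}B$ and $m(B)$ the index of $\mathbb{Z}B$ in $\operatorname{span}_{\mathbb{R}}(B)\cap\Lambda$, $M_A(x,y)=\sum_{B\subseteq A}m(B)(x-1)^{r(A)-r(B)}(y-1)^{|B|-r(B)}$ and $\chi^\Lambda_A(q)=(-1)^{r(A)}q^{N-r(A)}M_A(1-q,0)$; $\chi^W$ denotes this with $\Lambda=\Lambda_W$. -}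

module Defs where

open import Data.Nat as ℕ using (ℕ; zero; suc; _∸_; _<ᵇ_)
open import Data.Integer as ℤ using (ℤ; +_)
open import Data.Rational as ℚ using (ℚ; 0ℚ; 1ℚ)
open import Data.Fin using (Fin; toℕ; zero; suc)
open import Data.Fin.Properties using (_≟_)
open import Data.List using (List; []; _∷_; _++_; map; concatMap; allFin; length; lookup)
open import Data.List.Relation.Unary.All using (All)
open import Data.List.Membership.Propositional using (_∈_)
open import Data.Bool using (Bool; true; false; if_then_else_)
open import Data.Product using (Σ; ∃; ∃-syntax; _×_; _,_)
open import Relation.Nullary.Decidable using (⌊_⌋)
open import Relation.Binary.PropositionalEquality using (_≡_)

∑ : ∀ {k} → (Fin k → ℚ) → ℚ
∑ {zero}  f = 0ℚ
∑ {suc k} f = f zero ℚ.+ ∑ (λ j → f (suc j))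

sumℤ : List ℤ → ℤ
sumℤ []       = + 0
sumℤ (x ∷ xs) = x ℤ.+ sumℤ xs

subs : ∀ {a} {A : Set a} → List A → List (List A)
subs []       = [] ∷ []
subs (x ∷ xs) = subs xs ++ map (x ∷_) (subs xs)

Vecℚ : ℕ → Set
Vecℚ n = Fin n → ℚ

lincomb : ∀ {n} (B : List (Vecℚ n)) → (Fin (length B) → ℚ) → Vecℚ n
lincomb B c i = ∑ (λ j → c j ℚ.* lookup B j i)

_−ᵥ_ : ∀ {n} → Vecℚ n → Vecℚ n → Vecℚ n
(a −ᵥ b) i = a i ℚ.- b i

InSpan : ∀ {n} → List (Vecℚ n) → Vecℚ n → Set
InSpan B a = ∃[ c ] (∀ i → a i ≡ lincomb B c i)

InℤSpan : ∀ {n} → List (Vecℚ n) → Vecℚ n → Set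
InℤSpan B a = Σ (Fin (length B) → ℤ) λ c → (∀ i → a i ≡ lincomb B (λ j → c j ℚ./ 1) i)

LinIndep : ∀ {n} → List (Vecℚ n) → Set
LinIndep B = ∀ c → (∀ i → lincomb B c i ≡ 0ℚ) → ∀ j → c j ≡ 0ℚ

IsRank : ∀ {n} → List (Vecℚ n) → ℕ → Set
IsRank B r = ∃[ S ] (S ∈ subs B × length S ≡ r × LinIndep S × All (InSpan S) B)

HasClassCount : ∀ {X : Set} → (X → Set) → (X → X → Set) → ℕ → Set
HasClassCount {X} P R k =
  Σ (Fin k → X) λ g →
    (∀ i → P (g i)) ×
    (∀ x → P x → ∃[ i ] R x (g i)) ×
    (∀ i j → R (g i) (g j) → i ≡ j)

-- The weight lattice Λ_W of A_{n-1}: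
--   { a : ∑ a_i = 0 , a ∈ ℤ^n + (scalar)·(1,…,1) }

InΛW : ∀ n → Vecℚ n → Set
InΛW n a = (∑ a ≡ 0ℚ) × Σ (Fin n → ℤ) λ z → Σ ℚ λ t → (∀ i → a i ≡ (z i ℚ./ 1) ℚ.+ t)

IsIndexW : ∀ n → List (Vecℚ n) → ℕ → Set
IsIndexW n B m =
  HasClassCount (λ a → InSpan B a × InΛW n a) (λ a b → InℤSpan B (a −ᵥ b)) m

-- The root system A_{n-1} = { e_i − e_j : i < j }

e : ∀ {n} → Fin n → Vecℚ n
e i k = if ⌊ i ≟ k ⌋ then 1ℚ else 0ℚ

root : ∀ {n} → Fin n → Fin n → Vecℚ n
root i j = e i −ᵥ e j

A : ∀ n → List (Vecℚ n)
A n = concatMap (λ i → concatMap (λ j → if toℕ i <ᵇ toℕ j then root i j ∷ [] else [])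
                                   (allFin n))
                (allFin n)

-- Arithmetic Tutte polynomial and arithmetic characteristic polynomial,
-- given the rank function r and multiplicity function m.

M : ∀ {n} (r m : List (Vecℚ n) → ℕ) → List (Vecℚ n) → ℤ → ℤ → ℤ
M r m L x y =
  sumℤ (map (λ B → (+ m B) ℤ.* ((x ℤ.- + 1) ℤ.^ (r L ∸ r B))
                             ℤ.* ((y ℤ.- + 1) ℤ.^ (length B ∸ r B)))
            (subs L))

-- χ^Λ_L(q) = (-1)^{r(L)} q^{N − r(L)} M_L(1 − q, 0), N = rank of Λ
χ : ∀ {n} (r m : List (Vecℚ n) → ℕ) (N : ℕ) → List (Vecℚ n) → ℤ → ℤ
χ r m N L q = (ℤ.- + 1) ℤ.^ r L ℤ.* (q ℤ.^ (N ∸ r L)) ℤ.* M r m L (+ 1 ℤ.- q) (+ 0)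

blacks : List Bool → ℕ
blacks []           = 0
blacks (true ∷ w)  = suc (blacks w)
blacks (false ∷ w) = blacks w

rot : List Bool → List Bool
rot []      = []
rot (x ∷ w) = w ++ x ∷ []

rotN : ℕ → List Bool → List Bool
rotN zero    w = w
rotN (suc s) w = rot (rotN s w)

IsNecklaceCount : (b q k : ℕ) → Set
IsNecklaceCount b q k =
  HasClassCount (λ w → length w ≡ q × blacks w ≡ b)
                (λ w w′ → ∃[ s ] (w′ ≡ rotN s w)) k

Odd : ℕ → Set
Odd n = ∃[ k ] (n ≡ suc (2 ℕ.* k))

-- Write g(B) for the gcd of the component sizes of the graph B.  Then r(B) = n − #components and
-- m(B) = g(B), so q χ(q) = ∑_B (−1)^|B| g(B) q^{#components}, and since n ∣ q the summand of B is
-- (−1)^|B| n · #{x : [n] → [0, q) constant on the components of B, n ∣ ∑ x}.  By inclusion–exclusion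
-- q χ(q) = n · #{x injective : n ∣ ∑ x} = n! · n · #{S ⊆ [0, q) : |S| = n, n ∣ ∑ S}.
-- Ramanujan sums satisfy ∑_{d ∣ n} c_d(s) = n [n ∣ s].  Summing c_d(∑ S) over S, only the S that are
-- unions of aligned intervals of length d survive, because rotating S inside such an interval moves ∑ S
-- through a nontrivial coset; for d odd each of these contributes c_d(0) = φ(d).  Hence
-- n · #{S : n ∣ ∑ S} = ∑_{d ∣ n} φ(d) C(q/d, n/d), which is q times the number of necklaces by Burnside.
module Submission where

open import Defs
open import Data.Nat as ℕ using (ℕ; zero; suc; NonZero; _≥_; _∸_; _!; _<ᵇ_; z≤n; s≤s)
import Data.Nat.DivMod as ℕ
open import Data.Nat.Divisibility
open import Data.Nat.GCD
open import Data.Nat.Induction using (<-rec)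
import Data.Nat.Properties as ℕₚ
import Data.Nat.Tactic.RingSolver as ℕ-Solver
open import Data.Integer as ℤ using (ℤ; +_; -[1+_])
import Data.Integer.DivMod as ℤ
import Data.Integer.Properties as ℤₚ
import Data.Integer.Tactic.RingSolver as ℤ-Solver
open import Data.Rational as ℚ using (ℚ; 0ℚ; 1ℚ; toℚᵘ)
import Data.Rational.Properties as ℚₚ
open import Data.Rational.Unnormalised as ℚᵘ using (mkℚᵘ; *≡*)
import Data.Rational.Unnormalised.Properties as ℚᵘₚ
open import Data.Bool using (Bool; true; false; if_then_else_)
import Data.Bool.Properties as Boolₚ
open import Data.Empty using (⊥)
open import Data.Fin using (Fin; zero; suc; toℕ; fromℕ<)
import Data.Fin.Properties as Finₚ
open import Data.List
  using (List; []; _∷_; _++_; map; concatMap; downFrom; length; lookup; allFin; tabulate; replicate; filter)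
import Data.List.Properties as Listₚ
open import Data.List.Membership.Propositional using (_∈_)
open import Data.List.Membership.Propositional.Properties
  using (∈-++⁺ʳ; ∈-++⁻; ∈-map⁺; ∈-map⁻; ∈-downFrom⁻)
open import Data.List.Relation.Unary.All as All using (All; []; _∷_)
import Data.List.Relation.Unary.All.Properties as Allₚ
open import Data.List.Relation.Unary.Any using (here; there)
open import Data.List.Relation.Unary.Unique.Propositional using (Unique; []; _∷_)
import Data.List.Relation.Unary.Unique.Propositional.Properties as Uniqueₚ
open import Data.Product using (_×_; _,_; proj₁; proj₂; ∃; uncurry)
import Data.Product as Product
open import Data.Sum using (_⊎_; inj₁; inj₂)
import Data.Vec.Functional as Vec
open import Algebra.Properties.AbelianGroup ℤₚ.+-0-abelianGroup using () renaming (∙-cancelʳ to +-cancelʳ)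
open import Algebra.Properties.Semiring.Sum ℕₚ.+-*-semiring
  using (sum; sum-cong-≗; ∑-distrib-+; ∑-comm; *-distribˡ-sum; *-distribʳ-sum; sum-replicate-zero)
open import Function using (_∘_; id; case_of_)
open import Relation.Binary using (IsEquivalence)
open import Relation.Binary.PropositionalEquality
open import Relation.Nullary using (¬_; Dec; yes; no; contradiction; ¬?)

open ≡-Reasoning

private variable
  X Y : Set
  n : ℕ

-- Components of a graph

-- Why m(B) = g(B): an integral vector whose sum over every component of B is zero already lies in
-- ℤB, so only the shift t(1,...,1) that Λ_W permits can create index. Vanishing component sums make
-- t times each component size an integer, hence t ∈ (1/g)ℤ, and t modulo ℤ separates the classes.
-- The number of components is never computed. It is seen only through the number of Q-colourings
-- constant on the components; Q = q gives the powers of q, and Q = 2 gives the inequalities between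
-- ranks without which the truncated exponents would be wrong. No roots of unity occur. c_d is the
-- Möbius inverse of m ↦ m[m ∣ s], an integer, and both facts needed about it, the period d and the
-- vanishing of its average over a nontrivial coset, follow by induction over divisors. The
-- vanishing is used twice: for translating a colouring along a component whose size d does not
-- divide, which turns g(B) into a divisibility condition on ∑ x, and for rotating a block of d
-- beads. The condition n ∣ q lets residues modulo each d ∣ n be read off from colours modulo q.

Edge : ℕ → Set
Edge n = Fin n × Fin n

Constant : (Fin n → X) → List (Edge n) → Set
Constant f = All (λ (i , j) → f i ≡ f j)

-- A union-find: each new edge redirects the whole component of `b` to the representative of `a`.
-- Equality of representatives is then a decidable form of connectivity that mentions no paths.
rep : List (Edge n) → Fin n → Fin n
rep []            i = i
rep ((a , b) ∷ E) i with rep E i Finₚ.≟ rep E b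
... | yes _ = rep E a
... | no  _ = rep E i

rep-cong : ∀ (E : List (Edge n)) e {i j} → rep E i ≡ rep E j → rep (e ∷ E) i ≡ rep (e ∷ E) j
rep-cong E (a , b) {i} {j} eq with rep E i Finₚ.≟ rep E b | rep E j Finₚ.≟ rep E b
... | yes _  | yes _  = refl
... | yes p  | no ¬q  = contradiction (trans (sym eq) p) ¬q
... | no ¬p  | yes q  = contradiction (trans eq q) ¬p
... | no _   | no _   = eq

rep-constant : (E : List (Edge n)) → Constant (rep E) E
rep-constant []            = []
rep-constant ((a , b) ∷ E) = trans at-a (sym at-b) ∷ All.map (rep-cong E (a , b)) (rep-constant E)
  where
  at-a : rep ((a , b) ∷ E) a ≡ rep E a
  at-a with rep E a Finₚ.≟ rep E b
  ... | yes _ = refl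
  ... | no  _ = refl
  at-b : rep ((a , b) ∷ E) b ≡ rep E a
  at-b with rep E b Finₚ.≟ rep E b
  ... | yes _ = refl
  ... | no ¬p = contradiction refl ¬p

-- With `rep-constant`, this makes the kernel of `rep E` the equivalence generated by the edges. The
-- relation is arbitrary because two are needed: the kernel of a function, and congruence of the
-- basis vectors modulo the lattice spanned by the roots.
rep-least : {_~_ : Fin n → Fin n → Set} → IsEquivalence _~_ → ∀ E → All (uncurry _~_) E → ∀ i → i ~ rep E i
rep-least ≈ []            _         i = IsEquivalence.refl ≈
rep-least {_~_ = _~_} ≈ ((a , b) ∷ E) (a~b ∷ h) i with rep E i Finₚ.≟ rep E b
... | no  _ = rep-least ≈ E h i
-- The chain is i ~ rep E b ~ b ~ a ~ rep E a.
... | yes p = IsEquivalence.trans ≈ (subst (i ~_) p (rep-least ≈ E h i))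
    (IsEquivalence.trans ≈ (IsEquivalence.sym ≈ (rep-least ≈ E h b))
    (IsEquivalence.trans ≈ (IsEquivalence.sym ≈ a~b) (rep-least ≈ E h a)))

kernel : (f : Fin n → X) → IsEquivalence (λ i j → f i ≡ f j)
kernel f = record { refl = refl ; sym = sym ; trans = trans }

constant-rep : (f : Fin n → X) → ∀ E → Constant f E → ∀ i → f i ≡ f (rep E i)
constant-rep f = rep-least (kernel f)

-- Component sizes and their gcd

⟦_⟧ₙ : {P : Set} → Dec P → ℕ
⟦ yes _ ⟧ₙ = 1
⟦ no  _ ⟧ₙ = 0

sum-δ : (j : Fin n) (y : Fin n → ℕ) → sum (λ k → ⟦ j Finₚ.≟ k ⟧ₙ ℕ.* y k) ≡ y j
sum-δ {suc n} zero    y = trans (cong₂ ℕ._+_ (ℕₚ.*-identityˡ (y zero)) (sum-replicate-zero n)) (ℕₚ.+-identityʳ (y zero))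
sum-δ {suc n} (suc j) y = trans (sum-cong-≗ (λ k → cong (ℕ._* y (suc k)) (peel k))) (sum-δ j (y ∘ suc))
  where
  peel : ∀ k → ⟦ suc j Finₚ.≟ suc k ⟧ₙ ≡ ⟦ j Finₚ.≟ k ⟧ₙ
  peel k with j Finₚ.≟ k
  ... | yes _ = refl
  ... | no  _ = refl

size : List (Edge n) → Fin n → ℕ
size E k = sum (λ l → ⟦ rep E l Finₚ.≟ k ⟧ₙ)

sum-constant : ∀ (E : List (Edge n)) y → Constant y E → sum y ≡ sum (λ k → size E k ℕ.* y k)
sum-constant E y h = begin
  sum y
    ≡⟨ sum-cong-≗ (λ l → trans (constant-rep y E h l) (sym (sum-δ (rep E l) y))) ⟩
  sum (λ l → sum (λ k → ⟦ rep E l Finₚ.≟ k ⟧ₙ ℕ.* y k))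
    ≡⟨ ∑-comm (λ l k → ⟦ rep E l Finₚ.≟ k ⟧ₙ ℕ.* y k) ⟩
  sum (λ k → sum (λ l → ⟦ rep E l Finₚ.≟ k ⟧ₙ ℕ.* y k))
    ≡⟨ sum-cong-≗ (λ k → *-distribʳ-sum (y k) (λ l → ⟦ rep E l Finₚ.≟ k ⟧ₙ)) ⟨
  sum (λ k → size E k ℕ.* y k) ∎

gcds : (Fin n → ℕ) → ℕ
gcds {zero}  f = 0
gcds {suc n} f = gcd (f zero) (gcds (f ∘ suc))

gcds-∣ : (f : Fin n → ℕ) → ∀ i → gcds f ∣ f i
gcds-∣ f zero    = gcd[m,n]∣m (f zero) _
gcds-∣ f (suc i) = ∣-trans (gcd[m,n]∣n (f zero) _) (gcds-∣ (f ∘ suc) i)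

gcds-greatest : (f : Fin n → ℕ) → ∀ {d} → (∀ i → d ∣ f i) → d ∣ gcds f
gcds-greatest {zero}  f h = _ ∣0
gcds-greatest {suc n} f h = gcd-greatest (h zero) (gcds-greatest (f ∘ suc) (h ∘ suc))

sum-∣ : ∀ {d} (f : Fin n → ℕ) → (∀ i → d ∣ f i) → d ∣ sum f
sum-∣ {zero}  f h = _ ∣0
sum-∣ {suc n} f h = ∣m∣n⇒∣m+n (h zero) (sum-∣ (f ∘ suc) (h ∘ suc))

-- A vertex that represents no component has size 0, which is neutral for the gcd, so running over
-- all vertices gives exactly g(B), the gcd of the component sizes.
multiplicity : List (Edge n) → ℕ
multiplicity E = gcds (size E)

multiplicity-∣ : ∀ (E : List (Edge n)) y → Constant y E → multiplicity E ∣ sum y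
multiplicity-∣ E y h = subst (multiplicity E ∣_) (sym (sum-constant E y h))
  (sum-∣ _ (λ k → ∣m⇒∣m*n (y k) (gcds-∣ (size E) k)))

sum-one : ∀ n → sum {n} (λ _ → 1) ≡ n
sum-one zero    = refl
sum-one (suc n) = cong suc (sum-one n)

multiplicity-∣-n : ∀ (E : List (Edge n)) → multiplicity E ∣ n
multiplicity-∣-n {n} E = subst (multiplicity E ∣_) (sum-one n)
  (multiplicity-∣ E (λ _ → 1) (All.universal (λ _ → refl) E))

-- Rational and integral spans of roots

module _ where

  open import Data.Rational using (_+_; _*_; _-_; -_; 1/_)
  open import Data.Rational.Solver using (module +-*-Solver)
  open +-*-Solver using (solve; _:+_; _:*_; _:-_; :-_; _:=_; con)

  ι : ℤ → ℚ
  ι z = z ℚ./ 1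

  -- Rationals are kept in lowest terms, so the homomorphism laws of `ι` are checked on unnormalised
  -- fractions with denominator 1 and carried back.
  toℚᵘ-ι : ∀ z → toℚᵘ (ι z) ℚᵘ.≃ mkℚᵘ z 0
  toℚᵘ-ι z = ℚₚ.toℚᵘ-fromℚᵘ (mkℚᵘ z 0)

  ι-+ : ∀ a b → ι (a ℤ.+ b) ≡ ι a + ι b
  ι-+ a b = ℚₚ.toℚᵘ-injective (ℚᵘₚ.≃-trans (toℚᵘ-ι (a ℤ.+ b)) (ℚᵘₚ.≃-trans (*≡* (lemma a b))
    (ℚᵘₚ.≃-sym (ℚᵘₚ.≃-trans (ℚₚ.toℚᵘ-homo-+ (ι a) (ι b)) (ℚᵘₚ.+-cong (toℚᵘ-ι a) (toℚᵘ-ι b))))))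
    where
    lemma : ∀ a b → (a ℤ.+ b) ℤ.* + 1 ≡ (a ℤ.* + 1 ℤ.+ b ℤ.* + 1) ℤ.* + 1
    lemma = ℤ-Solver.solve-∀

  ι-* : ∀ a b → ι (a ℤ.* b) ≡ ι a * ι b
  ι-* a b = ℚₚ.toℚᵘ-injective (ℚᵘₚ.≃-trans (toℚᵘ-ι (a ℤ.* b)) (ℚᵘₚ.≃-trans (*≡* refl)
    (ℚᵘₚ.≃-sym (ℚᵘₚ.≃-trans (ℚₚ.toℚᵘ-homo-* (ι a) (ι b)) (ℚᵘₚ.*-cong (toℚᵘ-ι a) (toℚᵘ-ι b))))))

  ι-injective : ∀ {a b} → ι a ≡ ι b → a ≡ b
  ι-injective {a} {b} eq with ℚₚ.fromℚᵘ-injective {mkℚᵘ a 0} {mkℚᵘ b 0} eq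
  ... | *≡* h = trans (sym (ℤₚ.*-identityʳ a)) (trans h (ℤₚ.*-identityʳ b))

  ι-neg : ∀ a → ι (ℤ.- a) ≡ - ι a
  ι-neg a = begin
    ι (ℤ.- a)           ≡⟨ cong ι (ℤₚ.-1*i≡-i a) ⟨
    ι (ℤ.-1ℤ ℤ.* a)     ≡⟨ ι-* ℤ.-1ℤ a ⟩
    - 1ℚ * ι a          ≡⟨ ℚₚ.neg-distribˡ-* 1ℚ (ι a) ⟨
    - (1ℚ * ι a)        ≡⟨ cong -_ (ℚₚ.*-identityˡ (ι a)) ⟩
    - ι a               ∎

  ι-- : ∀ a b → ι (a ℤ.- b) ≡ ι a - ι b
  ι-- a b = trans (ι-+ a (ℤ.- b)) (cong (λ r → ι a + r) (ι-neg b))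

  ∑ℚ-cong : {f g : Fin n → ℚ} → (∀ i → f i ≡ g i) → ∑ f ≡ ∑ g
  ∑ℚ-cong {zero}  h = refl
  ∑ℚ-cong {suc n} h = cong₂ _+_ (h zero) (∑ℚ-cong (h ∘ suc))

  ∑ℚ-0 : ∀ n → ∑ {n} (λ _ → 0ℚ) ≡ 0ℚ
  ∑ℚ-0 zero    = refl
  ∑ℚ-0 (suc n) = trans (ℚₚ.+-identityˡ _) (∑ℚ-0 n)

  ∑ℚ-+ : (f g : Fin n → ℚ) → ∑ (λ i → f i + g i) ≡ ∑ f + ∑ g
  ∑ℚ-+ {zero}  f g = refl
  ∑ℚ-+ {suc n} f g = trans (cong (λ r → f zero + g zero + r) (∑ℚ-+ (f ∘ suc) (g ∘ suc)))
    (solve 4 (λ a b c d → (a :+ b) :+ (c :+ d) := (a :+ c) :+ (b :+ d)) refl (f zero) (g zero) (∑ (f ∘ suc)) (∑ (g ∘ suc)))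

  ∑ℚ-* : ∀ c (f : Fin n → ℚ) → ∑ (λ i → c * f i) ≡ c * ∑ f
  ∑ℚ-* {zero}  c f = sym (ℚₚ.*-zeroʳ c)
  ∑ℚ-* {suc n} c f = trans (cong (λ r → c * f zero + r) (∑ℚ-* c (f ∘ suc))) (sym (ℚₚ.*-distribˡ-+ c (f zero) _))

  ∑ℚ-- : (f g : Fin n → ℚ) → ∑ (λ i → f i - g i) ≡ ∑ f - ∑ g
  ∑ℚ-- {zero}  f g = refl
  ∑ℚ-- {suc n} f g = trans (cong (λ r → f zero - g zero + r) (∑ℚ-- (f ∘ suc) (g ∘ suc)))
    (solve 4 (λ a b c d → (a :- b) :+ (c :- d) := (a :+ c) :- (b :+ d)) refl (f zero) (g zero) (∑ (f ∘ suc)) (∑ (g ∘ suc)))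

  ∑ℚ-single : ∀ (i : Fin n) f → (∀ k → k ≢ i → f k ≡ 0ℚ) → ∑ f ≡ f i
  ∑ℚ-single {suc n} zero    f h = trans
    (cong (λ r → f zero + r) (trans (∑ℚ-cong (λ k → h (suc k) λ ())) (∑ℚ-0 n))) (ℚₚ.+-identityʳ (f zero))
  ∑ℚ-single {suc n} (suc i) f h = trans (cong₂ _+_ (h zero λ ()) (∑ℚ-single i (f ∘ suc) (λ k k≢i → h (suc k) λ { refl → k≢i refl })))
    (ℚₚ.+-identityˡ (f (suc i)))

  e-≡ : ∀ (i : Fin n) → e i i ≡ 1ℚ
  e-≡ i with i Finₚ.≟ i
  ... | yes _ = refl
  ... | no ¬p = contradiction refl ¬p

  e-≢ : ∀ {i k : Fin n} → i ≢ k → e i k ≡ 0ℚ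
  e-≢ {i = i} {k} i≢k with i Finₚ.≟ k
  ... | yes p = contradiction p i≢k
  ... | no _  = refl

  e-ι : ∀ (i k : Fin n) → e i k ≡ ι (+ ⟦ i Finₚ.≟ k ⟧ₙ)
  e-ι i k with i Finₚ.≟ k
  ... | yes _ = refl
  ... | no _  = refl

  ∑-e : ∀ (y : Fin n → ℚ) i → ∑ (λ k → y k * e i k) ≡ y i
  ∑-e y i = trans (∑ℚ-single i _ (λ k k≢i → trans (cong (y k *_) (e-≢ (k≢i ∘ sym))) (ℚₚ.*-zeroʳ (y k))))
    (trans (cong (y i *_) (e-≡ i)) (ℚₚ.*-identityʳ (y i)))

  ∑-root : ∀ (y : Fin n → ℚ) i j → ∑ (λ k → y k * root i j k) ≡ y i - y j
  ∑-root y i j = trans (∑ℚ-cong (λ k → solve 3 (λ a b c → a :* (b :- c) := a :* b :- a :* c) refl (y k) (e i k) (e j k)))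
    (trans (∑ℚ-- (λ k → y k * e i k) (λ k → y k * e j k)) (cong₂ _-_ (∑-e y i) (∑-e y j)))

  roots : List (Edge n) → List (Vecℚ n)
  roots = map (uncurry root)

  lincomb-+ : ∀ (B : List (Vecℚ n)) c d i → lincomb B (λ j → c j + d j) i ≡ lincomb B c i + lincomb B d i
  lincomb-+ B c d i = trans (∑ℚ-cong (λ j → ℚₚ.*-distribʳ-+ (lookup B j i) (c j) (d j)))
    (∑ℚ-+ (λ j → c j * lookup B j i) (λ j → d j * lookup B j i))

  lincomb-* : ∀ (B : List (Vecℚ n)) s c i → lincomb B (λ j → s * c j) i ≡ s * lincomb B c i
  lincomb-* B s c i = trans (∑ℚ-cong (λ j → ℚₚ.*-assoc s (c j) (lookup B j i))) (∑ℚ-* s (λ j → c j * lookup B j i))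

  lincomb-cong : ∀ (B : List (Vecℚ n)) {c d} → (∀ j → c j ≡ d j) → ∀ i → lincomb B c i ≡ lincomb B d i
  lincomb-cong B h i = ∑ℚ-cong (λ j → cong (_* lookup B j i) (h j))

  lincomb-0 : ∀ (B : List (Vecℚ n)) i → lincomb B (λ _ → 0ℚ) i ≡ 0ℚ
  lincomb-0 B i = trans (∑ℚ-cong (λ j → ℚₚ.*-zeroˡ (lookup B j i))) (∑ℚ-0 (length B))

  -- The root of an edge (i, j) pairs with `y` to y i - y j, which is zero. Indicators of components
  -- and the constant 1 thereby become linear functionals that vanish on the span.
  pairing-constant : ∀ (y : Fin n → ℚ) E → Constant y E → ∀ c → ∑ (λ i → y i * lincomb (roots E) c i) ≡ 0ℚ
  pairing-constant {n} y []            _       c = trans (∑ℚ-cong (λ i → ℚₚ.*-zeroʳ (y i))) (∑ℚ-0 n)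
  pairing-constant {n} y ((a , b) ∷ E) (p ∷ h) c = begin
    ∑ (λ i → y i * (c zero * root a b i + rest i))
      ≡⟨ ∑ℚ-cong (λ i → solve 4 (λ y c r s → y :* (c :* r :+ s) := c :* (y :* r) :+ y :* s) refl (y i) (c zero) (root a b i) (rest i)) ⟩
    ∑ (λ i → c zero * (y i * root a b i) + y i * rest i)
      ≡⟨ ∑ℚ-+ (λ i → c zero * (y i * root a b i)) (λ i → y i * rest i) ⟩
    ∑ (λ i → c zero * (y i * root a b i)) + ∑ (λ i → y i * rest i)
      ≡⟨ cong₂ _+_ (trans (∑ℚ-* (c zero) (λ i → y i * root a b i)) (cong (c zero *_) (∑-root y a b))) (pairing-constant y E h (c ∘ suc)) ⟩
    c zero * (y a - y b) + 0ℚ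
      ≡⟨ cong (λ r → c zero * (r - y b) + 0ℚ) p ⟩
    c zero * (y b - y b) + 0ℚ
      ≡⟨ solve 2 (λ c y → c :* (y :- y) :+ con 0ℚ := con 0ℚ) refl (c zero) (y b) ⟩
    0ℚ ∎
    where rest = lincomb (roots E) (c ∘ suc)

  span-pairing : ∀ (y : Fin n → ℚ) E → Constant y E → ∀ {a} → InSpan (roots E) a → ∑ (λ i → y i * a i) ≡ 0ℚ
  span-pairing y E h (c , a≡) = trans (∑ℚ-cong (λ i → cong (y i *_) (a≡ i))) (pairing-constant y E h c)

  ℤspan-resp : ∀ (B : List (Vecℚ n)) {u v} → (∀ i → u i ≡ v i) → InℤSpan B u → InℤSpan B v
  ℤspan-resp B h (c , u≡) = c , λ i → trans (sym (h i)) (u≡ i)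

  ℤspan-0 : ∀ (B : List (Vecℚ n)) → InℤSpan B (λ _ → 0ℚ)
  ℤspan-0 B = (λ _ → + 0) , λ i → sym (lincomb-0 B i)

  ℤspan-+ : ∀ (B : List (Vecℚ n)) {u v} → InℤSpan B u → InℤSpan B v → InℤSpan B (λ i → u i + v i)
  ℤspan-+ B (c , u≡) (d , v≡) = (λ j → c j ℤ.+ d j) , λ i →
    trans (cong₂ _+_ (u≡ i) (v≡ i)) (sym (trans (lincomb-cong B (λ j → ι-+ (c j) (d j)) i) (lincomb-+ B (ι ∘ c) (ι ∘ d) i)))

  ℤspan-* : ∀ (B : List (Vecℚ n)) {u} z → InℤSpan B u → InℤSpan B (λ i → ι z * u i)
  ℤspan-* B z (c , u≡) = (λ j → z ℤ.* c j) , λ i →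
    trans (cong (ι z *_) (u≡ i)) (sym (trans (lincomb-cong B (λ j → ι-* z (c j)) i) (lincomb-* B (ι z) (ι ∘ c) i)))

  ℤspan-neg : ∀ (B : List (Vecℚ n)) {u} → InℤSpan B u → InℤSpan B (λ i → - u i)
  ℤspan-neg B {u} h = ℤspan-resp B (λ i → trans (sym (ℚₚ.neg-distribˡ-* 1ℚ (u i))) (cong -_ (ℚₚ.*-identityˡ (u i)))) (ℤspan-* B ℤ.-1ℤ h)

  ℤspan-∑ : ∀ (B : List (Vecℚ n)) {m} (v : Fin m → Vecℚ n) → (∀ l → InℤSpan B (v l)) → InℤSpan B (λ i → ∑ (λ l → v l i))
  ℤspan-∑ B {zero}  v h = ℤspan-0 B
  ℤspan-∑ B {suc m} v h = ℤspan-+ B (h zero) (ℤspan-∑ B (v ∘ suc) (h ∘ suc))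

  ℤspan-there : ∀ (B : List (Vecℚ n)) {u} v → InℤSpan B u → InℤSpan (v ∷ B) u
  ℤspan-there B v (c , u≡) = (λ { zero → + 0 ; (suc j) → c j }) , λ i →
    trans (u≡ i) (sym (trans (cong (λ r → r + lincomb B (ι ∘ c) i) (ℚₚ.*-zeroˡ (v i))) (ℚₚ.+-identityˡ _)))

  ℤspan-here : ∀ (v : Vecℚ n) B → InℤSpan (v ∷ B) v
  ℤspan-here v B = (λ { zero → + 1 ; (suc j) → + 0 }) , λ i →
    sym (trans (cong₂ _+_ (ℚₚ.*-identityˡ (v i)) (lincomb-0 B i)) (ℚₚ.+-identityʳ (v i)))

  ℤspan⇒span : ∀ (B : List (Vecℚ n)) {u} → InℤSpan B u → InSpan B u
  ℤspan⇒span B (c , u≡) = ι ∘ c , u≡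

  span-* : ∀ (B : List (Vecℚ n)) {u} s → InSpan B u → InSpan B (λ i → s * u i)
  span-* B s (c , u≡) = (λ j → s * c j) , λ i → trans (cong (s *_) (u≡ i)) (sym (lincomb-* B s c i))

  ℤspan-edges : ∀ (E : List (Edge n)) → All (λ (i , j) → InℤSpan (roots E) (root i j)) E
  ℤspan-edges []            = []
  ℤspan-edges ((a , b) ∷ E) = ℤspan-here (root a b) (roots E) ∷
    All.map (λ {(i , j)} → ℤspan-there (roots E) {root i j} (root a b)) (ℤspan-edges E)

  -- This makes `rep-least` applicable: e_i - e_{rep i} is an integral combination of the edges,
  -- without a path from i to its representative being chosen.
  ℤspan-isEquivalence : ∀ (B : List (Vecℚ n)) → IsEquivalence (λ i j → InℤSpan B (root i j))
  ℤspan-isEquivalence B = record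
    { refl  = λ {i} → ℤspan-resp B (λ k → sym (ℚₚ.+-inverseʳ (e i k))) (ℤspan-0 B)
    ; sym   = λ {i} {j} h → ℤspan-resp B (λ k → solve 2 (λ a b → :- (a :- b) := b :- a) refl (e i k) (e j k)) (ℤspan-neg B h)
    ; trans = λ {i} {j} {l} p q → ℤspan-resp B
        (λ k → solve 3 (λ a b c → (a :- b) :+ (b :- c) := a :- c) refl (e i k) (e j k) (e l k)) (ℤspan-+ B p q)
    }

  ℤspan-rep : ∀ (E : List (Edge n)) i → InℤSpan (roots E) (root i (rep E i))
  ℤspan-rep E = rep-least (ℤspan-isEquivalence (roots E)) E (ℤspan-edges E)

  ComponentSumsVanish : List (Edge n) → Vecℚ n → Set
  ComponentSumsVanish E a = ∀ k → ∑ (λ i → e (rep E i) k * a i) ≡ 0ℚ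

  span⇒vanish : ∀ (E : List (Edge n)) {a} → InSpan (roots E) a → ComponentSumsVanish E a
  span⇒vanish E a∈ k = span-pairing (λ i → e (rep E i) k) E (All.map (cong (λ r → e r k)) (rep-constant E)) a∈

  vanish-- : ∀ (E : List (Edge n)) {a b} → ComponentSumsVanish E a → ComponentSumsVanish E b → ComponentSumsVanish E (a −ᵥ b)
  vanish-- E {a} {b} ha hb k = trans
    (∑ℚ-cong (λ i → solve 3 (λ e a b → e :* (a :- b) := e :* a :- e :* b) refl (e (rep E i) k) (a i) (b i)))
    (trans (∑ℚ-- (λ i → e (rep E i) k * a i) (λ i → e (rep E i) k * b i)) (cong₂ _-_ (ha k) (hb k)))

  -- Since a = ∑ w_i e_i, and ∑ w_i e_{rep i} has the component sums of a as its coefficients and so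
  -- is zero, a = ∑ w_i (e_i - e_{rep i}). In other words, the lattice of the edges is saturated in
  -- ℤ^n.
  vanish⇒ℤspan : ∀ (E : List (Edge n)) {a} (w : Fin n → ℤ) → (∀ i → a i ≡ ι (w i)) → ComponentSumsVanish E a → InℤSpan (roots E) a
  vanish⇒ℤspan E {a} w a≡ h = ℤspan-resp (roots E) expand
    (ℤspan-∑ (roots E) (λ i k → ι (w i) * root i (rep E i) k) (λ i → ℤspan-* (roots E) (w i) (ℤspan-rep E i)))
    where
    e-sym : ∀ i k → e i k ≡ e k i
    e-sym i k with i Finₚ.≟ k | k Finₚ.≟ i
    ... | yes _ | yes _ = refl
    ... | yes p | no ¬q = contradiction (sym p) ¬q
    ... | no ¬p | yes q = contradiction (sym q) ¬p
    ... | no _  | no _  = refl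
    expand : ∀ k → ∑ (λ i → ι (w i) * root i (rep E i) k) ≡ a k
    expand k = begin
      ∑ (λ i → ι (w i) * root i (rep E i) k)
        ≡⟨ ∑ℚ-cong (λ i → trans (cong (_* root i (rep E i) k) (sym (a≡ i)))
             (trans (solve 3 (λ a x y → a :* (x :- y) := a :* x :- y :* a) refl (a i) (e i k) (e (rep E i) k))
                    (cong (λ r → a i * r - e (rep E i) k * a i) (e-sym i k)))) ⟩
      ∑ (λ i → a i * e k i - e (rep E i) k * a i)
        ≡⟨ ∑ℚ-- (λ i → a i * e k i) (λ i → e (rep E i) k * a i) ⟩
      ∑ (λ i → a i * e k i) - ∑ (λ i → e (rep E i) k * a i)
        ≡⟨ cong₂ _-_ (∑-e a k) (h k) ⟩
      a k - 0ℚ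
        ≡⟨ ℚₚ.+-identityʳ (a k) ⟩
      a k ∎

  ℤspan-integral : ∀ (E : List (Edge n)) {a} → InℤSpan (roots E) a → ∃ λ w → ∀ i → a i ≡ ι (w i)
  ℤspan-integral E (c , a≡) = proj₁ (go E c) , λ i → trans (a≡ i) (proj₂ (go E c) i)
    where
    go : ∀ E c → ∃ λ (w : Fin _ → ℤ) → ∀ i → lincomb (roots E) (ι ∘ c) i ≡ ι (w i)
    go []            c = (λ _ → + 0) , λ i → refl
    go ((a , b) ∷ E) c = w′ , w′≡
      where
      w = proj₁ (go E (c ∘ suc))
      r w′ : Fin _ → ℤ
      r i = + ⟦ a Finₚ.≟ i ⟧ₙ ℤ.- + ⟦ b Finₚ.≟ i ⟧ₙ
      w′ i = c zero ℤ.* r i ℤ.+ w i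
      w′≡ : ∀ i → lincomb (roots ((a , b) ∷ E)) (ι ∘ c) i ≡ ι (w′ i)
      w′≡ i = begin
        ι (c zero) * (e a i - e b i) + lincomb (roots E) (ι ∘ c ∘ suc) i
          ≡⟨ cong₂ (λ u v → ι (c zero) * u + v) (cong₂ _-_ (e-ι a i) (e-ι b i)) (proj₂ (go E (c ∘ suc)) i) ⟩
        ι (c zero) * (ι (+ ⟦ a Finₚ.≟ i ⟧ₙ) - ι (+ ⟦ b Finₚ.≟ i ⟧ₙ)) + ι (w i)
          ≡⟨ cong (λ u → ι (c zero) * u + ι (w i)) (ι-- (+ ⟦ a Finₚ.≟ i ⟧ₙ) (+ ⟦ b Finₚ.≟ i ⟧ₙ)) ⟨
        ι (c zero) * ι (r i) + ι (w i)
          ≡⟨ cong (_+ ι (w i)) (ι-* (c zero) (r i)) ⟨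
        ι (c zero ℤ.* r i) + ι (w i)
          ≡⟨ ι-+ (c zero ℤ.* r i) (w i) ⟨
        ι (w′ i) ∎

  LinIndep-tail : ∀ (v : Vecℚ n) B → LinIndep (v ∷ B) → LinIndep B
  LinIndep-tail v B indep c h j = indep (λ { zero → 0ℚ ; (suc j) → c j })
    (λ i → trans (cong (λ r → r + lincomb B c i) (ℚₚ.*-zeroˡ (v i))) (trans (ℚₚ.+-identityˡ (lincomb B c i)) (h i))) (suc j)

  LinIndep-head : ∀ (v : Vecℚ n) B → LinIndep (v ∷ B) → ¬ InSpan B v
  LinIndep-head v B indep (c , v≡) = contradiction
    (indep (λ { zero → - 1ℚ ; (suc j) → c j }) (λ i → trans (cong (λ r → - 1ℚ * v i + r) (sym (v≡ i)))
      (trans (cong (_+ v i) (trans (sym (ℚₚ.neg-distribˡ-* 1ℚ (v i))) (cong -_ (ℚₚ.*-identityˡ (v i))))) (ℚₚ.+-inverseˡ (v i)))) zero)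
    λ ()

  same-component⇒span : ∀ (E : List (Edge n)) i j → rep E i ≡ rep E j → InSpan (roots E) (root i j)
  same-component⇒span E i j eq = ℤspan⇒span (roots E) (IsEquivalence.trans ≈ {i} {rep E i} {j} (ℤspan-rep E i)
    (subst (λ r → InℤSpan (roots E) (root r j)) (sym eq) (IsEquivalence.sym ≈ {j} {rep E j} (ℤspan-rep E j))))
    where ≈ = ℤspan-isEquivalence (roots E)

  -- If the components differed, the indicator of the component of j would pair with `root i j` to
  -- -1, although it vanishes on the span.
  span⇒same-component : ∀ (E : List (Edge n)) i j → InSpan (roots E) (root i j) → rep E i ≡ rep E j
  span⇒same-component E i j r∈ with rep E i Finₚ.≟ rep E j
  ... | yes p = p
  ... | no ¬p = contradiction (begin
      - 1ℚ
        ≡⟨⟩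
      0ℚ - 1ℚ
        ≡⟨ cong₂ _-_ (e-≢ ¬p) (e-≡ (rep E j)) ⟨
      e (rep E i) (rep E j) - e (rep E j) (rep E j)
        ≡⟨ ∑-root (λ l → e (rep E l) (rep E j)) i j ⟨
      ∑ (λ l → e (rep E l) (rep E j) * root i j l)
        ≡⟨ span⇒vanish E r∈ (rep E j) ⟩
      0ℚ ∎) λ ()

  -- Sending each representative of one system to a related one of the other is injective, because
  -- two with the same image are related to each other. Applied both ways it makes an index unique.
  class-count-≤ : ∀ {P : X → Set} (R : X → X → Set) →
                  (∀ {x y} → R x y → R y x) → (∀ {x y z} → R x y → R y z → R x z) →
                  ∀ {k l} → HasClassCount P R k → HasClassCount P R l → k ℕ.≤ l
  class-count-≤ R sym-R trans-R (g , g∈ , _ , g-distinct) (g′ , _ , g′-cover , _) =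
    Finₚ.injective⇒≤ {f = λ i → proj₁ (g′-cover (g i) (g∈ i))} λ {i} {j} eq →
      g-distinct i j (trans-R (proj₂ (g′-cover (g i) (g∈ i)))
        (sym-R (subst (λ l → R (g j) (g′ l)) (sym eq) (proj₂ (g′-cover (g j) (g∈ j))))))

  -- Bézout writes the gcd as an integer combination of a and b, and multiplying by t keeps it
  -- integral. Over the natural numbers the identity has two forms, which `combine` treats alike.
  integral-gcd : ∀ (t : ℚ) a b → (∃ λ u → ι (+ a) * t ≡ ι u) → (∃ λ u → ι (+ b) * t ≡ ι u) →
                 ∃ λ u → ι (+ gcd a b) * t ≡ ι u
  integral-gcd t a b (u , at≡) (v , bt≡) = case Bézout.identity (gcd-GCD a b) of λ where
      (Bézout.+- x y eq) → + x ℤ.* u ℤ.- + y ℤ.* v , combine (gcd a b) x y eq at≡ bt≡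
      (Bézout.-+ x y eq) → + y ℤ.* v ℤ.- + x ℤ.* u , combine (gcd a b) y x eq bt≡ at≡
    where
    ι-linear : ∀ x a → ι (+ (x ℕ.* a)) ≡ ι (+ x) * ι (+ a)
    ι-linear x a = trans (cong ι (ℤₚ.pos-* x a)) (ι-* (+ x) (+ a))
    combine : ∀ d {a b u v} x y → d ℕ.+ y ℕ.* b ≡ x ℕ.* a → ι (+ a) * t ≡ ι u → ι (+ b) * t ≡ ι v →
              ι (+ d) * t ≡ ι (+ x ℤ.* u ℤ.- + y ℤ.* v)
    combine d {a} {b} {u} {v} x y eq at≡ bt≡ = begin
      ι (+ d) * t
        ≡⟨ solve 4 (λ d y b t → d :* t := (d :+ y :* b) :* t :- y :* (b :* t)) refl (ι (+ d)) (ι (+ y)) (ι (+ b)) t ⟩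
      (ι (+ d) + ι (+ y) * ι (+ b)) * t - ι (+ y) * (ι (+ b) * t)
        ≡⟨ cong (λ r → r * t - ι (+ y) * (ι (+ b) * t)) (begin
             ι (+ d) + ι (+ y) * ι (+ b)   ≡⟨ cong (λ r → ι (+ d) + r) (ι-linear y b) ⟨
             ι (+ d) + ι (+ (y ℕ.* b))     ≡⟨ ι-+ (+ d) (+ (y ℕ.* b)) ⟨
             ι (+ (d ℕ.+ y ℕ.* b))         ≡⟨ cong (ι ∘ +_) eq ⟩
             ι (+ (x ℕ.* a))               ≡⟨ ι-linear x a ⟩
             ι (+ x) * ι (+ a)             ∎) ⟩
      ι (+ x) * ι (+ a) * t - ι (+ y) * (ι (+ b) * t)
        ≡⟨ cong₂ (λ p q → p - ι (+ y) * q) (trans (ℚₚ.*-assoc (ι (+ x)) (ι (+ a)) t) (cong (ι (+ x) *_) at≡)) bt≡ ⟩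
      ι (+ x) * ι u - ι (+ y) * ι v
        ≡⟨ cong₂ _-_ (ι-* (+ x) u) (ι-* (+ y) v) ⟨
      ι (+ x ℤ.* u) - ι (+ y ℤ.* v)
        ≡⟨ ι-- (+ x ℤ.* u) (+ y ℤ.* v) ⟨
      ι (+ x ℤ.* u ℤ.- + y ℤ.* v) ∎

  integral-gcds : ∀ (t : ℚ) (f : Fin n → ℕ) → (∀ k → ∃ λ u → ι (+ f k) * t ≡ ι u) → ∃ λ u → ι (+ gcds f) * t ≡ ι u
  integral-gcds {zero}  t f h = + 0 , ℚₚ.*-zeroˡ t
  integral-gcds {suc n} t f h = integral-gcd t (f zero) (gcds (f ∘ suc)) (h zero) (integral-gcds t (f ∘ suc) (h ∘ suc))

  ∑-ι : ∀ (f : Fin n → ℕ) → ∑ (λ i → ι (+ f i)) ≡ ι (+ sum f)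
  ∑-ι {zero}  f = refl
  ∑-ι {suc n} f = trans (cong (λ r → ι (+ f zero) + r) (∑-ι (f ∘ suc))) (sym (ι-+ (+ f zero) (+ sum (f ∘ suc))))

  ∑-ιℤ : ∀ (f : Fin n → ℤ) → ∃ λ u → ∑ (λ i → ι (f i)) ≡ ι u
  ∑-ιℤ {zero}  f = + 0 , refl
  ∑-ιℤ {suc n} f with ∑-ιℤ (f ∘ suc)
  ... | u , eq = f zero ℤ.+ u , trans (cong (λ r → ι (f zero) + r) eq) (sym (ι-+ (f zero) u))

  ∑-e-rep : ∀ (E : List (Edge n)) k → ∑ (λ i → e (rep E i) k) ≡ ι (+ size E k)
  ∑-e-rep E k = trans (∑ℚ-cong (λ i → e-ι (rep E i) k)) (∑-ι (λ i → ⟦ rep E i Finₚ.≟ k ⟧ₙ))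

  congruent-< : ∀ {g i j} w → i ℕ.< g → j ℕ.< g → + i ≡ + j ℤ.+ + g ℤ.* w → i ≡ j
  congruent-< {g} {i} {j} (+ zero)    i<g j<g eq =
    ℤₚ.+-injective (trans eq (trans (cong (λ r → + j ℤ.+ r) (ℤₚ.*-zeroʳ (+ g))) (ℤₚ.+-identityʳ (+ j))))
  congruent-< {g} {i} {j} (+ (suc w)) i<g j<g eq = contradiction
    (ℕₚ.≤-trans (ℕₚ.m≤m*n g (suc w)) (ℕₚ.≤-trans (ℕₚ.m≤n+m (g ℕ.* suc w) j)
      (ℕₚ.≤-reflexive (sym (ℤₚ.+-injective (trans eq (cong (λ r → + j ℤ.+ r) (sym (ℤₚ.pos-* g (suc w))))))))))
    (ℕₚ.<⇒≱ i<g)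
  congruent-< {g} {i} {j} -[1+ w ]    i<g j<g eq = sym (congruent-< (+ suc w) j<g i<g (begin
    + j                                          ≡⟨ shuffle (+ j) (+ g) (+ suc w) ⟩
    (+ j ℤ.+ + g ℤ.* -[1+ w ]) ℤ.+ + g ℤ.* + suc w ≡⟨ cong (ℤ._+ + g ℤ.* + suc w) eq ⟨
    + i ℤ.+ + g ℤ.* + suc w                      ∎))
    where
    shuffle : ∀ j g w → j ≡ (j ℤ.+ g ℤ.* (ℤ.- w)) ℤ.+ g ℤ.* w
    shuffle = ℤ-Solver.solve-∀

  -- Λ_W ∩ span E modulo ℤE is cyclic of order g, the gcd of the component sizes, and is generated by
  -- (1/g) ∑ᵢ (eᵢ − e_{rep i}).
  module _ (n : ℕ) .{{_ : NonZero n}} (E : List (Edge n)) where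

    private
      g = multiplicity E

      instance
        g≢0 : NonZero g
        g≢0 = ℕ.≢-nonZero λ g≡0 → ℕ.≢-nonZero⁻¹ n (0∣⇒≡0 (subst (_∣ n) g≡0 (multiplicity-∣-n E)))

        ιg≢0 : ℚ.NonZero (ι (+ g))
        ιg≢0 = ℚ.≢-nonZero λ ιg≡0 → ℕ.≢-nonZero⁻¹ g (ℤₚ.+-injective (ι-injective {+ g} {+ 0} ιg≡0))

      g⁻¹ : ℚ
      g⁻¹ = 1/ ι (+ g)

      g*g⁻¹ : ι (+ g) * g⁻¹ ≡ 1ℚ
      g*g⁻¹ = ℚₚ.*-inverseʳ (ι (+ g))

      quotients : Fin n → ℕ
      quotients k = quotient (gcds-∣ (size E) k)

      generator : Vecℚ n
      generator k = ∑ (λ i → root i (rep E i) k)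

      class : ℕ → Vecℚ n
      class j k = ι (+ j) * g⁻¹ * generator k

      -- The coordinate is 1 - size E k, and g divides the size. After division by g all coordinates
      -- are therefore congruent to 1/g modulo ℤ, which is the condition for lying in Λ_W.
      generator-≡ : ∀ k → generator k ≡ 1ℚ - ι (+ quotients k) * ι (+ g)
      generator-≡ k = trans (∑ℚ-- (λ i → e i k) (λ i → e (rep E i) k)) (cong₂ _-_
        (trans (∑ℚ-single k (λ i → e i k) (λ i i≢k → e-≢ i≢k)) (e-≡ k))
        (trans (∑-e-rep E k) (trans (cong (ι ∘ +_) (_∣_.equality (gcds-∣ (size E) k)))
          (trans (cong ι (ℤₚ.pos-* (quotients k) g)) (ι-* (+ quotients k) (+ g))))))

      class-≡ : ∀ j k → class j k ≡ ι (+ j) * g⁻¹ - ι (+ j ℤ.* + quotients k)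
      class-≡ j k = begin
        ι (+ j) * g⁻¹ * generator k
          ≡⟨ cong (ι (+ j) * g⁻¹ *_) (generator-≡ k) ⟩
        ι (+ j) * g⁻¹ * (1ℚ - ι (+ quotients k) * ι (+ g))
          ≡⟨ solve 4 (λ j h s g → j :* h :* (con 1ℚ :- s :* g) := j :* h :- j :* s :* (g :* h)) refl
               (ι (+ j)) g⁻¹ (ι (+ quotients k)) (ι (+ g)) ⟩
        ι (+ j) * g⁻¹ - ι (+ j) * ι (+ quotients k) * (ι (+ g) * g⁻¹)
          ≡⟨ cong (λ r → ι (+ j) * g⁻¹ - r) (trans (cong (ι (+ j) * ι (+ quotients k) *_) g*g⁻¹)
               (trans (ℚₚ.*-identityʳ _) (sym (ι-* (+ j) (+ quotients k))))) ⟩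
        ι (+ j) * g⁻¹ - ι (+ j ℤ.* + quotients k) ∎

      class-span : ∀ j → InSpan (roots E) (class j)
      class-span j = span-* (roots E) (ι (+ j) * g⁻¹)
        (ℤspan⇒span (roots E) (ℤspan-∑ (roots E) (λ i → root i (rep E i)) (ℤspan-rep E)))

      class-Λ : ∀ j → InΛW n (class j)
      class-Λ j = trans (∑ℚ-cong (λ i → sym (ℚₚ.*-identityˡ (class j i))))
          (span-pairing (λ _ → 1ℚ) E (All.universal (λ _ → refl) E) (class-span j)) ,
        (λ k → ℤ.- (+ j ℤ.* + quotients k)) , ι (+ j) * g⁻¹ , λ k → trans (class-≡ j k)
          (trans (ℚₚ.+-comm (ι (+ j) * g⁻¹) (- ι (+ j ℤ.* + quotients k))) (cong (_+ ι (+ j) * g⁻¹) (sym (ι-neg (+ j ℤ.* + quotients k)))))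

      class-cover : ∀ a → InSpan (roots E) a → InΛW n a → ∃ λ (j : Fin g) → InℤSpan (roots E) (a −ᵥ class (toℕ j))
      class-cover a a∈ (_ , z , t , a≡) = fromℕ< r<g , subst (λ j → InℤSpan (roots E) (a −ᵥ class j)) (sym (Finₚ.toℕ-fromℕ< r<g))
        (vanish⇒ℤspan E w difference (vanish-- E (span⇒vanish E a∈) (span⇒vanish E (class-span r))))
        where
        -- Summing a_i = z_i + t over the component represented by k gives 0 = ∑ z_i + size · t.
        size*t : ∀ k → ∃ λ u → ι (+ size E k) * t ≡ ι u
        size*t k with ∑-ιℤ (λ i → + ⟦ rep E i Finₚ.≟ k ⟧ₙ ℤ.* z i)
        ... | u , u≡ = ℤ.- u , (begin
          ι (+ size E k) * t
            ≡⟨ solve 2 (λ s u → s := (u :+ s) :- u) refl (ι (+ size E k) * t) (ι u) ⟩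
          (ι u + ι (+ size E k) * t) - ι u
            ≡⟨ cong (_- ι u) (begin
                 ι u + ι (+ size E k) * t
                   ≡⟨ cong₂ _+_ u≡ (trans (cong (t *_) (∑-e-rep E k)) (ℚₚ.*-comm t (ι (+ size E k)))) ⟨
                 ∑ (λ i → ι (+ ⟦ rep E i Finₚ.≟ k ⟧ₙ ℤ.* z i)) + t * ∑ (λ i → e (rep E i) k)
                   ≡⟨ cong₂ _+_ (∑ℚ-cong (λ i → trans (ι-* (+ ⟦ rep E i Finₚ.≟ k ⟧ₙ) (z i)) (cong (_* ι (z i)) (sym (e-ι (rep E i) k)))))
                                (sym (∑ℚ-* t (λ i → e (rep E i) k))) ⟩
                 ∑ (λ i → e (rep E i) k * ι (z i)) + ∑ (λ i → t * e (rep E i) k)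
                   ≡⟨ ∑ℚ-+ (λ i → e (rep E i) k * ι (z i)) (λ i → t * e (rep E i) k) ⟨
                 ∑ (λ i → e (rep E i) k * ι (z i) + t * e (rep E i) k)
                   ≡⟨ ∑ℚ-cong (λ i → trans (solve 3 (λ e z t → e :* z :+ t :* e := e :* (z :+ t)) refl (e (rep E i) k) (ι (z i)) t)
                                           (cong (e (rep E i) k *_) (sym (a≡ i)))) ⟩
                 ∑ (λ i → e (rep E i) k * a i)
                   ≡⟨ span⇒vanish E a∈ k ⟩
                 0ℚ ∎) ⟩
          0ℚ - ι u
            ≡⟨ trans (ℚₚ.+-identityˡ (- ι u)) (sym (ι-neg u)) ⟩
          ι (ℤ.- u) ∎)
        -- `u` is g t. Its remainder `r` modulo g selects the class, and its quotient `v` is the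
        -- integral part of t, which goes into the integral difference `w`.
        u : ℤ
        u = proj₁ (integral-gcds t (size E) size*t)
        r : ℕ
        r = u ℤ.%ℕ g
        r<g : r ℕ.< g
        r<g = ℤ.n%ℕd<d u g
        v : ℤ
        v = u ℤ./ℕ g
        t≡ : t ≡ ι (+ r) * g⁻¹ + ι v
        t≡ = begin
          t
            ≡⟨ ℚₚ.*-identityʳ t ⟨
          t * 1ℚ
            ≡⟨ cong (t *_) g*g⁻¹ ⟨
          t * (ι (+ g) * g⁻¹)
            ≡⟨ solve 3 (λ t g h → t :* (g :* h) := (g :* t) :* h) refl t (ι (+ g)) g⁻¹ ⟩
          (ι (+ g) * t) * g⁻¹
            ≡⟨ cong (_* g⁻¹) (trans (proj₂ (integral-gcds t (size E) size*t)) (trans (cong ι (ℤ.a≡a%ℕn+[a/ℕn]*n u g))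
                 (trans (ι-+ (+ r) (v ℤ.* + g)) (cong (λ p → ι (+ r) + p) (ι-* v (+ g)))))) ⟩
          (ι (+ r) + ι v * ι (+ g)) * g⁻¹
            ≡⟨ solve 4 (λ r v g h → (r :+ v :* g) :* h := r :* h :+ v :* (g :* h)) refl (ι (+ r)) (ι v) (ι (+ g)) g⁻¹ ⟩
          ι (+ r) * g⁻¹ + ι v * (ι (+ g) * g⁻¹)
            ≡⟨ cong (λ p → ι (+ r) * g⁻¹ + p) (trans (cong (ι v *_) g*g⁻¹) (ℚₚ.*-identityʳ (ι v))) ⟩
          ι (+ r) * g⁻¹ + ι v ∎
        w : Fin n → ℤ
        w k = z k ℤ.+ v ℤ.+ + r ℤ.* + quotients k
        difference : ∀ k → a k - class r k ≡ ι (w k)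
        difference k = begin
          a k - class r k
            ≡⟨ cong₂ _-_ (trans (a≡ k) (cong (λ p → ι (z k) + p) t≡)) (class-≡ r k) ⟩
          (ι (z k) + (ι (+ r) * g⁻¹ + ι v)) - (ι (+ r) * g⁻¹ - ι (+ r ℤ.* + quotients k))
            ≡⟨ solve 4 (λ z r v s → (z :+ (r :+ v)) :- (r :- s) := z :+ v :+ s) refl
                 (ι (z k)) (ι (+ r) * g⁻¹) (ι v) (ι (+ r ℤ.* + quotients k)) ⟩
          ι (z k) + ι v + ι (+ r ℤ.* + quotients k)
            ≡⟨ trans (ι-+ (z k ℤ.+ v) (+ r ℤ.* + quotients k)) (cong (_+ ι (+ r ℤ.* + quotients k)) (ι-+ (z k) v)) ⟨
          ι (w k) ∎

      class-distinct : ∀ (i j : Fin g) → InℤSpan (roots E) (class (toℕ i) −ᵥ class (toℕ j)) → i ≡ j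
      class-distinct i j h = Finₚ.toℕ-injective (congruent-< w′ (Finₚ.toℕ<n i) (Finₚ.toℕ<n j) (ι-injective (begin
        ι (+ p)
          ≡⟨ ℚₚ.*-identityʳ (ι (+ p)) ⟨
        ι (+ p) * 1ℚ
          ≡⟨ cong (ι (+ p) *_) g*g⁻¹ ⟨
        ι (+ p) * (ι (+ g) * g⁻¹)
          ≡⟨ solve 6 (λ p q s s′ g h → p :* (g :* h) := q :* (g :* h) :+ g :* ((p :* h :- s) :- (q :* h :- s′) :+ (s :- s′))) refl
               (ι (+ p)) (ι (+ q)) (ι (+ p ℤ.* + s)) (ι (+ q ℤ.* + s)) (ι (+ g)) g⁻¹ ⟩
        ι (+ q) * (ι (+ g) * g⁻¹) + ι (+ g) * ((ι (+ p) * g⁻¹ - ι (+ p ℤ.* + s)) - (ι (+ q) * g⁻¹ - ι (+ q ℤ.* + s))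
          + (ι (+ p ℤ.* + s) - ι (+ q ℤ.* + s)))
          ≡⟨ cong₂ (λ a b → a + ι (+ g) * (b + (ι (+ p ℤ.* + s) - ι (+ q ℤ.* + s))))
               (trans (cong (ι (+ q) *_) g*g⁻¹) (ℚₚ.*-identityʳ (ι (+ q))))
               (trans (sym (cong₂ _-_ (class-≡ p k) (class-≡ q k))) (proj₂ (ℤspan-integral E h) k)) ⟩
        ι (+ q) + ι (+ g) * (ι (w k) + (ι (+ p ℤ.* + s) - ι (+ q ℤ.* + s)))
          ≡⟨ cong (λ r → ι (+ q) + ι (+ g) * r) (trans (ι-+ (w k) (+ p ℤ.* + s ℤ.- + q ℤ.* + s))
               (cong (λ r → ι (w k) + r) (ι-- (+ p ℤ.* + s) (+ q ℤ.* + s)))) ⟨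
        ι (+ q) + ι (+ g) * ι w′
          ≡⟨ trans (ι-+ (+ q) (+ g ℤ.* w′)) (cong (λ r → ι (+ q) + r) (ι-* (+ g) w′)) ⟨
        ι (+ q ℤ.+ + g ℤ.* w′) ∎)))
        where
        -- One coordinate suffices: there the difference of the two classes is (p - q)/g up to an
        -- integer, and it has to be an integer. Coordinate 0 exists because n is nonzero.
        k : Fin n
        k = fromℕ< (ℕ.>-nonZero⁻¹ n)
        p = toℕ i
        q = toℕ j
        s = quotients k
        w = proj₁ (ℤspan-integral E h)
        w′ = w k ℤ.+ (+ p ℤ.* + s ℤ.- + q ℤ.* + s)

    index-multiplicity : IsIndexW n (roots E) (multiplicity E)
    index-multiplicity = (λ j → class (toℕ j)) , (λ j → class-span (toℕ j) , class-Λ (toℕ j)) ,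
      (λ a (a∈ , a∈Λ) → class-cover a a∈ a∈Λ) , class-distinct

    index-unique : ∀ {m} → IsIndexW n (roots E) m → m ≡ multiplicity E
    index-unique h = ℕₚ.≤-antisym (class-count-≤ R (λ {a} {b} → R-sym {a} {b}) (λ {a} {b} {c} → R-trans {a} {b} {c}) h index-multiplicity)
                                  (class-count-≤ R (λ {a} {b} → R-sym {a} {b}) (λ {a} {b} {c} → R-trans {a} {b} {c}) index-multiplicity h)
      where
      R : Vecℚ n → Vecℚ n → Set
      R a b = InℤSpan (roots E) (a −ᵥ b)
      R-sym : ∀ {a b} → R a b → R b a
      R-sym {a} {b} h = ℤspan-resp (roots E) (λ i → solve 2 (λ a b → :- (a :- b) := b :- a) refl (a i) (b i)) (ℤspan-neg (roots E) h)
      R-trans : ∀ {a b c} → R a b → R b c → R a c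
      R-trans {a} {b} {c} p q = ℤspan-resp (roots E)
        (λ i → solve 3 (λ a b c → (a :- b) :+ (b :- c) := a :- c) refl (a i) (b i) (c i)) (ℤspan-+ (roots E) p q)

open import Data.Integer using (_+_; _*_; _-_; -_; _^_; 0ℤ; 1ℤ; ∣_∣)
open import Data.Integer.Tactic.RingSolver using (solve-∀)

-- Finite sums of integers

+ʳ : ∀ a {b c} → b ≡ c → a + b ≡ a + c
+ʳ a = cong (λ r → a + r)

*ʳ : ∀ a {b c} → b ≡ c → a * b ≡ a * c
*ʳ a = cong (λ r → a * r)

⟦_⟧ : {P : Set} → Dec P → ℤ
⟦ yes _ ⟧ = 1ℤ
⟦ no  _ ⟧ = 0ℤ

⟦⟧-yes : {P : Set} (p? : Dec P) → P → ⟦ p? ⟧ ≡ 1ℤ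
⟦⟧-yes (yes _) p = refl
⟦⟧-yes (no ¬p) p = contradiction p ¬p

⟦⟧-no : {P : Set} (p? : Dec P) → ¬ P → ⟦ p? ⟧ ≡ 0ℤ
⟦⟧-no (yes p) ¬p = contradiction p ¬p
⟦⟧-no (no _)  ¬p = refl

⟦⟧-⇔ : {P Q : Set} (p? : Dec P) (q? : Dec Q) → (P → Q) → (Q → P) → ⟦ p? ⟧ ≡ ⟦ q? ⟧
⟦⟧-⇔ (yes p) q? f g = sym (⟦⟧-yes q? (f p))
⟦⟧-⇔ (no ¬p) q? f g = sym (⟦⟧-no q? (¬p ∘ g))

⟦⟧-× : {P Q R : Set} (p? : Dec P) (q? : Dec Q) (r? : Dec R) →
       (R → P × Q) → (P → Q → R) → ⟦ r? ⟧ ≡ ⟦ p? ⟧ * ⟦ q? ⟧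
⟦⟧-× (yes p) (yes q) r? f g = ⟦⟧-yes r? (g p q)
⟦⟧-× (yes p) (no ¬q) r? f g = ⟦⟧-no r? (¬q ∘ proj₂ ∘ f)
⟦⟧-× (no ¬p) (yes q) r? f g = ⟦⟧-no r? (¬p ∘ proj₁ ∘ f)
⟦⟧-× (no ¬p) (no ¬q) r? f g = ⟦⟧-no r? (¬p ∘ proj₁ ∘ f)

⟦⟧-*-cong : {P : Set} (p? : Dec P) {a b : ℤ} → (P → a ≡ b) → ⟦ p? ⟧ * a ≡ ⟦ p? ⟧ * b
⟦⟧-*-cong (yes p) f = cong (1ℤ *_) (f p)
⟦⟧-*-cong (no _)  f = refl

infix 5 ∑ₗ
∑ₗ : List X → (X → ℤ) → ℤ
∑ₗ xs f = sumℤ (map f xs)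

syntax ∑ₗ xs (λ x → t) = ∑[ x ∈ xs ] t

∑-cong-∈ : (xs : List X) {f g : X → ℤ} → (∀ {x} → x ∈ xs → f x ≡ g x) → ∑ₗ xs f ≡ ∑ₗ xs g
∑-cong-∈ []       h = refl
∑-cong-∈ (x ∷ xs) h = cong₂ _+_ (h (here refl)) (∑-cong-∈ xs (h ∘ there))

∑-cong : (xs : List X) {f g : X → ℤ} → (∀ x → f x ≡ g x) → ∑ₗ xs f ≡ ∑ₗ xs g
∑-cong xs h = ∑-cong-∈ xs (λ {x} _ → h x)

∑-zero : (xs : List X) → ∑ₗ xs (λ _ → 0ℤ) ≡ 0ℤ
∑-zero []       = refl
∑-zero (x ∷ xs) = trans (ℤₚ.+-identityˡ _) (∑-zero xs)

∑-+ : (xs : List X) (f g : X → ℤ) → ∑ₗ xs (λ x → f x + g x) ≡ ∑ₗ xs f + ∑ₗ xs g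
∑-+ []       f g = refl
∑-+ (x ∷ xs) f g = trans (+ʳ (f x + g x) (∑-+ xs f g)) (interchange (f x) (g x) _ _)
  where
  interchange : ∀ a b c d → (a + b) + (c + d) ≡ (a + c) + (b + d)
  interchange = solve-∀

∑-*ˡ : (xs : List X) (c : ℤ) (f : X → ℤ) → ∑ₗ xs (λ x → c * f x) ≡ c * ∑ₗ xs f
∑-*ˡ []       c f = sym (ℤₚ.*-zeroʳ c)
∑-*ˡ (x ∷ xs) c f = trans (+ʳ (c * f x) (∑-*ˡ xs c f)) (sym (ℤₚ.*-distribˡ-+ c (f x) _))

∑-*ʳ : (xs : List X) (c : ℤ) (f : X → ℤ) → ∑ₗ xs (λ x → f x * c) ≡ ∑ₗ xs f * c
∑-*ʳ xs c f = begin
  ∑ₗ xs (λ x → f x * c) ≡⟨ ∑-cong xs (λ x → ℤₚ.*-comm (f x) c) ⟩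
  ∑ₗ xs (λ x → c * f x) ≡⟨ ∑-*ˡ xs c f ⟩
  c * ∑ₗ xs f           ≡⟨ ℤₚ.*-comm c _ ⟩
  ∑ₗ xs f * c           ∎

∑-neg : (xs : List X) (f : X → ℤ) → ∑ₗ xs (λ x → - f x) ≡ - ∑ₗ xs f
∑-neg []       f = refl
∑-neg (x ∷ xs) f = trans (+ʳ (- f x) (∑-neg xs f)) (sym (ℤₚ.neg-distrib-+ (f x) _))

∑-- : (xs : List X) (f g : X → ℤ) → ∑ₗ xs (λ x → f x - g x) ≡ ∑ₗ xs f - ∑ₗ xs g
∑-- xs f g = trans (∑-+ xs f (λ x → - g x)) (+ʳ (∑ₗ xs f) (∑-neg xs g))

∑-const : (xs : List X) (c : ℤ) → ∑ₗ xs (λ _ → c) ≡ + length xs * c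
∑-const []       c = sym (ℤₚ.*-zeroˡ c)
∑-const (x ∷ xs) c = begin
  c + ∑ₗ xs (λ _ → c)    ≡⟨ +ʳ c (∑-const xs c) ⟩
  c + + length xs * c    ≡⟨ ℤₚ.suc-* (+ length xs) c ⟨
  + length (x ∷ xs) * c  ∎

∑-swap : (xs : List X) (ys : List Y) (f : X → Y → ℤ) →
         ∑[ x ∈ xs ] (∑[ y ∈ ys ] f x y) ≡ ∑[ y ∈ ys ] (∑[ x ∈ xs ] f x y)
∑-swap []       ys f = sym (∑-zero ys)
∑-swap (x ∷ xs) ys f = begin
  ∑ₗ ys (f x) + (∑[ x ∈ xs ] (∑[ y ∈ ys ] f x y))  ≡⟨ +ʳ (∑ₗ ys (f x)) (∑-swap xs ys f) ⟩
  ∑ₗ ys (f x) + (∑[ y ∈ ys ] (∑[ x ∈ xs ] f x y))  ≡⟨ ∑-+ ys (f x) _ ⟨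
  ∑[ y ∈ ys ] (f x y + (∑[ x ∈ xs ] f x y))        ∎

∑-++ : (xs ys : List X) (f : X → ℤ) → ∑ₗ (xs ++ ys) f ≡ ∑ₗ xs f + ∑ₗ ys f
∑-++ []       ys f = sym (ℤₚ.+-identityˡ _)
∑-++ (x ∷ xs) ys f = trans (+ʳ (f x) (∑-++ xs ys f)) (sym (ℤₚ.+-assoc (f x) _ _))

∑-map : (g : X → Y) (xs : List X) (f : Y → ℤ) → ∑ₗ (map g xs) f ≡ ∑ₗ xs (f ∘ g)
∑-map g xs f = cong sumℤ (sym (Listₚ.map-∘ xs))

∑-concatMap : (g : X → List Y) (xs : List X) (f : Y → ℤ) →
              ∑ₗ (concatMap g xs) f ≡ ∑[ x ∈ xs ] (∑ₗ (g x) f)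
∑-concatMap g []       f = refl
∑-concatMap g (x ∷ xs) f = trans (∑-++ (g x) _ f) (+ʳ (∑ₗ (g x) f) (∑-concatMap g xs f))

-- Ramanujan sums

∑-telescope : ∀ q (f : ℕ → ℤ) → (∑[ a ∈ downFrom q ] f (suc a)) + f 0 ≡ f q + ∑ₗ (downFrom q) f
∑-telescope zero    f = ℤₚ.+-comm 0ℤ (f 0)
∑-telescope (suc q) f = trans (ℤₚ.+-assoc (f (suc q)) _ (f 0)) (+ʳ (f (suc q)) (∑-telescope q f))

∑-suc : ∀ q (f : ℕ → ℤ) → (∀ a → f (a ℕ.+ q) ≡ f a) →
        ∑[ a ∈ downFrom q ] f (suc a) ≡ ∑ₗ (downFrom q) f
∑-suc q f per = +-cancelʳ (f 0) _ _ (begin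
  (∑[ a ∈ downFrom q ] f (suc a)) + f 0 ≡⟨ ∑-telescope q f ⟩
  f q + ∑ₗ (downFrom q) f               ≡⟨ cong (λ r → r + ∑ₗ (downFrom q) f) (per 0) ⟩
  f 0 + ∑ₗ (downFrom q) f               ≡⟨ ℤₚ.+-comm (f 0) _ ⟩
  ∑ₗ (downFrom q) f + f 0               ∎)

∑-shift : ∀ q (f : ℕ → ℤ) → (∀ a → f (a ℕ.+ q) ≡ f a) → ∀ τ →
          ∑[ a ∈ downFrom q ] f (a ℕ.+ τ) ≡ ∑ₗ (downFrom q) f
∑-shift q f per zero    = ∑-cong (downFrom q) (λ a → cong f (ℕₚ.+-identityʳ a))
∑-shift q f per (suc τ) = begin
  ∑[ a ∈ downFrom q ] f (a ℕ.+ suc τ) ≡⟨ ∑-cong (downFrom q) (λ a → cong f (ℕₚ.+-suc a τ)) ⟩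
  ∑[ a ∈ downFrom q ] f (suc a ℕ.+ τ) ≡⟨ ∑-suc q (λ a → f (a ℕ.+ τ)) (λ a → trans (cong f (swapʳ a q τ)) (per (a ℕ.+ τ))) ⟩
  ∑[ a ∈ downFrom q ] f (a ℕ.+ τ)     ≡⟨ ∑-shift q f per τ ⟩
  ∑ₗ (downFrom q) f                   ∎
  where
  swapʳ : ∀ a b c → a ℕ.+ b ℕ.+ c ≡ a ℕ.+ c ℕ.+ b
  swapʳ = ℕ-Solver.solve-∀

-- The Möbius inverse of f, that is the h with ∑_{d ∣ n} h d = f n.  Storing its values below n in
-- möbiusTable f n makes the recursion structural.

möbiusStep : (ℕ → ℤ) → ℕ → (ℕ → ℤ) → ℤ
möbiusStep f n h = f n - (∑[ d ∈ downFrom n ] ⟦ d ∣? n ⟧ * h d)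

möbiusTable : (ℕ → ℤ) → ℕ → ℕ → ℤ
möbiusTable f zero    d = 0ℤ
möbiusTable f (suc n) d with d ℕ.≟ n
... | yes _ = möbiusStep f n (möbiusTable f n)
... | no  _ = möbiusTable f n d

möbius : (ℕ → ℤ) → ℕ → ℤ
möbius f n = möbiusStep f n (möbiusTable f n)

möbiusTable-< : ∀ f {n d} → d ℕ.< n → möbiusTable f n d ≡ möbius f d
möbiusTable-< f {suc n} {d} d<1+n with d ℕ.≟ n
... | yes refl = refl
... | no  d≢n  = möbiusTable-< f (ℕₚ.≤∧≢⇒< (ℕₚ.≤-pred d<1+n) d≢n)

möbius-unfold : ∀ f n → möbius f n ≡ f n - (∑[ d ∈ downFrom n ] ⟦ d ∣? n ⟧ * möbius f d)
möbius-unfold f n = cong (λ r → f n - r) (∑-cong-∈ (downFrom n)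
  (λ {d} d∈ → *ʳ ⟦ d ∣? n ⟧ (möbiusTable-< f (∈-downFrom⁻ d∈))))

-- No divisor of n exceeds n. One range can thus serve the divisor sums of many numbers at once,
-- which allows them to be interchanged; the index 0 in that range divides no nonzero number.
∑∣-bound : ∀ n .{{_ : NonZero n}} k (h : ℕ → ℤ) →
           ∑[ d ∈ downFrom (suc (k ℕ.+ n)) ] ⟦ d ∣? n ⟧ * h d ≡ ∑[ d ∈ downFrom (suc n) ] ⟦ d ∣? n ⟧ * h d
∑∣-bound n zero    h = refl
∑∣-bound n (suc k) h = begin
  ⟦ suc (k ℕ.+ n) ∣? n ⟧ * h (suc (k ℕ.+ n)) + rest
    ≡⟨ cong (λ r → r * h (suc (k ℕ.+ n)) + rest) (⟦⟧-no (suc (k ℕ.+ n) ∣? n) (>⇒∤ (s≤s (ℕₚ.m≤n+m n k)))) ⟩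
  0ℤ * h (suc (k ℕ.+ n)) + rest
    ≡⟨ cong (λ r → r + rest) (ℤₚ.*-zeroˡ (h (suc (k ℕ.+ n)))) ⟩
  0ℤ + rest
    ≡⟨ ℤₚ.+-identityˡ rest ⟩
  rest
    ≡⟨ ∑∣-bound n k h ⟩
  ∑[ d ∈ downFrom (suc n) ] ⟦ d ∣? n ⟧ * h d ∎
  where rest = ∑[ d ∈ downFrom (suc (k ℕ.+ n)) ] ⟦ d ∣? n ⟧ * h d

möbius-inversion : ∀ f n .{{_ : NonZero n}} {Q} → n ℕ.≤ Q →
                   ∑[ d ∈ downFrom (suc Q) ] ⟦ d ∣? n ⟧ * möbius f d ≡ f n
möbius-inversion f n {Q} n≤Q = begin
  ∑[ d ∈ downFrom (suc Q) ] ⟦ d ∣? n ⟧ * möbius f d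
    ≡⟨ cong (λ k → ∑[ d ∈ downFrom (suc k) ] ⟦ d ∣? n ⟧ * möbius f d) (ℕₚ.m∸n+n≡m n≤Q) ⟨
  ∑[ d ∈ downFrom (suc (Q ℕ.∸ n ℕ.+ n)) ] ⟦ d ∣? n ⟧ * möbius f d
    ≡⟨ ∑∣-bound n (Q ℕ.∸ n) (möbius f) ⟩
  ⟦ n ∣? n ⟧ * möbius f n + rest
    ≡⟨ cong (λ r → r * möbius f n + rest) (⟦⟧-yes (n ∣? n) ∣-refl) ⟩
  1ℤ * möbius f n + rest
    ≡⟨ cong (λ r → 1ℤ * r + rest) (möbius-unfold f n) ⟩
  1ℤ * (f n - rest) + rest
    ≡⟨ lemma (f n) rest ⟩
  f n ∎
  where
  rest = ∑[ d ∈ downFrom n ] ⟦ d ∣? n ⟧ * möbius f d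
  lemma : ∀ a b → 1ℤ * (a - b) + b ≡ a
  lemma = solve-∀

-- Ramanujan's sum c_d(s), the sum of ζ^s over the primitive d-th roots of unity ζ.

ramanujan : ℕ → ℕ → ℤ
ramanujan d s = möbius (λ m → + m * ⟦ m ∣? s ⟧) d

∑-ramanujan : ∀ n .{{_ : NonZero n}} {Q} → n ℕ.≤ Q → ∀ s →
              ∑[ d ∈ downFrom (suc Q) ] ⟦ d ∣? n ⟧ * ramanujan d s ≡ + n * ⟦ n ∣? s ⟧
∑-ramanujan n n≤Q s = möbius-inversion (λ m → + m * ⟦ m ∣? s ⟧) n n≤Q

-- In the Möbius recursion for d, each proper divisor e has d among its multiples, so a shift by j d
-- is also a multiple of e, and the period is inherited from the smaller sums.
ramanujan-periodic : ∀ d s j → ramanujan d (s ℕ.+ j ℕ.* d) ≡ ramanujan d s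
ramanujan-periodic = <-rec _ λ d rec s j → begin
  ramanujan d (s ℕ.+ j ℕ.* d)
    ≡⟨ möbius-unfold (λ m → + m * ⟦ m ∣? (s ℕ.+ j ℕ.* d) ⟧) d ⟩
  + d * ⟦ d ∣? (s ℕ.+ j ℕ.* d) ⟧ - (∑[ e ∈ downFrom d ] ⟦ e ∣? d ⟧ * ramanujan e (s ℕ.+ j ℕ.* d))
    ≡⟨ cong₂ (λ a b → + d * a - b)
         (⟦⟧-⇔ (d ∣? (s ℕ.+ j ℕ.* d)) (d ∣? s) (λ h → ∣m+n∣n⇒∣m h (n∣m*n j)) (λ h → ∣m∣n⇒∣m+n h (n∣m*n j)))
         (∑-cong-∈ (downFrom d) (λ {e} e∈ → ⟦⟧-*-cong (e ∣? d) λ { (divides k refl) →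
           trans (cong (λ r → ramanujan e (s ℕ.+ r)) (sym (ℕₚ.*-assoc j k e)))
                 (rec (∈-downFrom⁻ e∈) s (j ℕ.* k)) })) ⟩
  + d * ⟦ d ∣? s ⟧ - (∑[ e ∈ downFrom d ] ⟦ e ∣? d ⟧ * ramanujan e s)
    ≡⟨ möbius-unfold (λ m → + m * ⟦ m ∣? s ⟧) d ⟨
  ramanujan d s ∎
  where
  ∣m+n∣n⇒∣m : ∀ {d m n} → d ∣ m ℕ.+ n → d ∣ n → d ∣ m
  ∣m+n∣n⇒∣m {d} {m} {n} h h′ = ∣m+n∣m⇒∣n (subst (d ∣_) (ℕₚ.+-comm m n) h) h′

multiple-period : ∀ (f : ℕ → ℤ) r → (∀ s → f (s ℕ.+ r) ≡ f s) → ∀ k s → f (s ℕ.+ k ℕ.* r) ≡ f s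
multiple-period f r h zero    s = cong f (ℕₚ.+-identityʳ s)
multiple-period f r h (suc k) s =
  trans (cong f (sym (ℕₚ.+-assoc s r _))) (trans (multiple-period f r h k (s ℕ.+ r)) (h s))

-- Bézout in the form gcd + y q = x p: adding y q first and then reading the result as x p moves by
-- the gcd without subtraction.
gcd-period : ∀ (f : ℕ → ℤ) p q → (∀ s → f (s ℕ.+ p) ≡ f s) → (∀ s → f (s ℕ.+ q) ≡ f s) →
             ∀ s → f (s ℕ.+ gcd p q) ≡ f s
gcd-period f p q hp hq s with Bézout.identity (gcd-GCD p q)
... | Bézout.+- x y eq = begin
  f (s ℕ.+ gcd p q)                   ≡⟨ multiple-period f q hq y _ ⟨
  f (s ℕ.+ gcd p q ℕ.+ y ℕ.* q)       ≡⟨ cong f (trans (ℕₚ.+-assoc s _ _) (cong (s ℕ.+_) eq)) ⟩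
  f (s ℕ.+ x ℕ.* p)                   ≡⟨ multiple-period f p hp x s ⟩
  f s                                 ∎
... | Bézout.-+ x y eq = begin
  f (s ℕ.+ gcd p q)                   ≡⟨ multiple-period f p hp x _ ⟨
  f (s ℕ.+ gcd p q ℕ.+ x ℕ.* p)       ≡⟨ cong f (trans (ℕₚ.+-assoc s _ _) (cong (s ℕ.+_) eq)) ⟩
  f (s ℕ.+ y ℕ.* q)                   ≡⟨ multiple-period f q hq y s ⟩
  f s                                 ∎

-- Hits of an arithmetic progression in the multiples of e

∣-+-⇔ : ∀ {d} a {b} → d ∣ b → ⟦ d ∣? (a ℕ.+ b) ⟧ ≡ ⟦ d ∣? a ⟧
∣-+-⇔ {d} a {b} h = ⟦⟧-⇔ (d ∣? (a ℕ.+ b)) (d ∣? a)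
  (λ k → ∣m+n∣m⇒∣n (subst (d ∣_) (ℕₚ.+-comm a b) k) h) (λ k → ∣m∣n⇒∣m+n k h)

∑-residue : ∀ e .{{_ : NonZero e}} a → ∑[ s ∈ downFrom e ] ⟦ e ∣? (s ℕ.+ a) ⟧ ≡ 1ℤ
∑-residue e@(suc e-1) a = begin
  ∑[ s ∈ downFrom e ] ⟦ e ∣? (s ℕ.+ a) ⟧ ≡⟨ ∑-shift e (λ s → ⟦ e ∣? s ⟧) (λ s → ∣-+-⇔ s ∣-refl) a ⟩
  ∑[ s ∈ downFrom e ] ⟦ e ∣? s ⟧         ≡⟨ go e-1 ℕₚ.≤-refl ⟩
  1ℤ                                     ∎
  where
  go : ∀ m → m ℕ.< e → ∑[ s ∈ downFrom (suc m) ] ⟦ e ∣? s ⟧ ≡ 1ℤ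
  go zero    m<e = cong (λ r → r + 0ℤ) (⟦⟧-yes (e ∣? 0) (e ∣0))
  go (suc m) m<e = trans (cong₂ _+_ (⟦⟧-no (e ∣? suc m) (>⇒∤ m<e)) (go m (ℕₚ.<-trans (ℕₚ.n<1+n m) m<e))) refl

-- Double counting of the pairs j < e, s < N with e ∣ s + j: each j gives a translate of the same
-- full period, and each s admits exactly one j.
∑-multiples : ∀ e .{{_ : NonZero e}} N → e ∣ N → + e * (∑[ s ∈ downFrom N ] ⟦ e ∣? s ⟧) ≡ + N
∑-multiples e N e∣N = begin
  + e * (∑[ s ∈ downFrom N ] ⟦ e ∣? s ⟧)
    ≡⟨ cong (λ r → + r * (∑[ s ∈ downFrom N ] ⟦ e ∣? s ⟧)) (Listₚ.length-downFrom e) ⟨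
  + length (downFrom e) * (∑[ s ∈ downFrom N ] ⟦ e ∣? s ⟧)
    ≡⟨ ∑-const (downFrom e) _ ⟨
  ∑[ j ∈ downFrom e ] (∑[ s ∈ downFrom N ] ⟦ e ∣? s ⟧)
    ≡⟨ ∑-cong (downFrom e) (λ j → ∑-shift N (λ s → ⟦ e ∣? s ⟧) (λ s → ∣-+-⇔ s e∣N) j) ⟨
  ∑[ j ∈ downFrom e ] (∑[ s ∈ downFrom N ] ⟦ e ∣? (s ℕ.+ j) ⟧)
    ≡⟨ ∑-swap (downFrom e) (downFrom N) _ ⟩
  ∑[ s ∈ downFrom N ] (∑[ j ∈ downFrom e ] ⟦ e ∣? (s ℕ.+ j) ⟧)
    ≡⟨ ∑-cong (downFrom N) (λ s → trans (∑-cong (downFrom e) (λ j → cong (λ r → ⟦ e ∣? r ⟧) (ℕₚ.+-comm s j))) (∑-residue e s)) ⟩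
  ∑[ s ∈ downFrom N ] 1ℤ
    ≡⟨ ∑-const (downFrom N) 1ℤ ⟩
  + length (downFrom N) * 1ℤ
    ≡⟨ ℤₚ.*-identityʳ (+ length (downFrom N)) ⟩
  + length (downFrom N)
    ≡⟨ cong +_ (Listₚ.length-downFrom N) ⟩
  + N ∎

module _ (e : ℕ) .{{_ : NonZero e}} (N i : ℕ) (e∣N : e ∣ N) where

  -- How often N steps of length i from s meet a multiple of e. As e divides N, both e and i are
  -- periods in s, and so is their gcd.
  hits : ℕ → ℤ
  hits s = ∑[ τ ∈ downFrom N ] ⟦ e ∣? (s ℕ.+ τ ℕ.* i) ⟧

  hits-e : ∀ s → hits (s ℕ.+ e) ≡ hits s
  hits-e s = ∑-cong (downFrom N) (λ τ → trans (cong (λ r → ⟦ e ∣? r ⟧) (swapʳ s e (τ ℕ.* i))) (∣-+-⇔ (s ℕ.+ τ ℕ.* i) ∣-refl))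
    where
    swapʳ : ∀ a b c → a ℕ.+ b ℕ.+ c ≡ a ℕ.+ c ℕ.+ b
    swapʳ = ℕ-Solver.solve-∀

  hits-i : ∀ s → hits (s ℕ.+ i) ≡ hits s
  hits-i s = begin
    hits (s ℕ.+ i)
      ≡⟨ ∑-cong (downFrom N) (λ τ → cong (λ r → ⟦ e ∣? r ⟧) (ℕₚ.+-assoc s i (τ ℕ.* i))) ⟩
    ∑[ τ ∈ downFrom N ] ⟦ e ∣? (s ℕ.+ suc τ ℕ.* i) ⟧
      ≡⟨ ∑-suc N (λ τ → ⟦ e ∣? (s ℕ.+ τ ℕ.* i) ⟧) (λ τ →
           trans (cong (λ r → ⟦ e ∣? r ⟧) (expand s τ N i))
                 (∣-+-⇔ (s ℕ.+ τ ℕ.* i) (∣m⇒∣m*n i e∣N))) ⟩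
    hits s ∎
    where
    expand : ∀ s τ N i → s ℕ.+ (τ ℕ.+ N) ℕ.* i ≡ s ℕ.+ τ ℕ.* i ℕ.+ N ℕ.* i
    expand = ℕ-Solver.solve-∀

  hits-multiple : ∀ k → hits (k ℕ.* gcd e i) ≡ hits 0
  hits-multiple zero    = refl
  hits-multiple (suc k) = trans (cong hits (ℕₚ.+-comm (gcd e i) (k ℕ.* gcd e i)))
    (trans (gcd-period hits e i hits-e hits-i (k ℕ.* gcd e i)) (hits-multiple k))

  hits-gcd : ∀ s → hits s ≡ ⟦ gcd e i ∣? s ⟧ * hits 0
  hits-gcd s with gcd e i ∣? s
  ... | yes (divides k refl) = trans (hits-multiple k) (sym (ℤₚ.*-identityˡ (hits 0)))
  ... | no  g∤s = begin
    hits s              ≡⟨ ∑-cong (downFrom N) (λ τ → ⟦⟧-no (e ∣? (s ℕ.+ τ ℕ.* i)) (λ h →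
                             g∤s (∣m+n∣m⇒∣n (subst (gcd e i ∣_) (ℕₚ.+-comm s (τ ℕ.* i)) (∣-trans (gcd[m,n]∣m e i) h))
                                            (∣n⇒∣m*n τ (gcd[m,n]∣n e i))))) ⟩
    ∑ₗ (downFrom N) (λ _ → 0ℤ) ≡⟨ ∑-zero (downFrom N) ⟩
    0ℤ                  ≡⟨ ℤₚ.*-zeroˡ (hits 0) ⟨
    0ℤ * hits 0         ∎

  ∑-hits : ∑ₗ (downFrom e) hits ≡ + N
  ∑-hits = begin
    ∑[ s ∈ downFrom e ] (∑[ τ ∈ downFrom N ] ⟦ e ∣? (s ℕ.+ τ ℕ.* i) ⟧)
      ≡⟨ ∑-swap (downFrom e) (downFrom N) _ ⟩
    ∑[ τ ∈ downFrom N ] (∑[ s ∈ downFrom e ] ⟦ e ∣? (s ℕ.+ τ ℕ.* i) ⟧)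
      ≡⟨ ∑-cong (downFrom N) (λ τ → ∑-residue e (τ ℕ.* i)) ⟩
    ∑[ τ ∈ downFrom N ] 1ℤ
      ≡⟨ trans (∑-const (downFrom N) 1ℤ) (ℤₚ.*-identityʳ (+ length (downFrom N))) ⟩
    + length (downFrom N)
      ≡⟨ cong +_ (Listₚ.length-downFrom N) ⟩
    + N ∎

  -- `hits` has one value on the multiples of the gcd and is 0 elsewhere. The total over s < e is N,
  -- and `K`, the number of multiples of the gcd below e, equals e / gcd; this determines the value.
  e*hits : ∀ s → + e * hits s ≡ + N * (+ gcd e i * ⟦ gcd e i ∣? s ⟧)
  e*hits s = begin
    + e * hits s
      ≡⟨ cong₂ _*_ (sym (∑-multiples (gcd e i) e (gcd[m,n]∣m e i))) (hits-gcd s) ⟩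
    + gcd e i * K * (⟦ gcd e i ∣? s ⟧ * hits 0)
      ≡⟨ rearrange (+ gcd e i) K ⟦ gcd e i ∣? s ⟧ (hits 0) ⟩
    K * hits 0 * (+ gcd e i * ⟦ gcd e i ∣? s ⟧)
      ≡⟨ cong (λ r → r * (+ gcd e i * ⟦ gcd e i ∣? s ⟧)) K*hits ⟩
    + N * (+ gcd e i * ⟦ gcd e i ∣? s ⟧) ∎
    where
    instance
      g≢0 : NonZero (gcd e i)
      g≢0 = ℕ.≢-nonZero (λ g≡0 → ℕ.≢-nonZero⁻¹ e (gcd[m,n]≡0⇒m≡0 g≡0))
    K = ∑[ s ∈ downFrom e ] ⟦ gcd e i ∣? s ⟧
    K*hits : K * hits 0 ≡ + N
    K*hits = begin
      K * hits 0 ≡⟨ ∑-*ʳ (downFrom e) (hits 0) (λ s → ⟦ gcd e i ∣? s ⟧) ⟨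
      ∑[ s ∈ downFrom e ] ⟦ gcd e i ∣? s ⟧ * hits 0 ≡⟨ ∑-cong (downFrom e) hits-gcd ⟨
      ∑ₗ (downFrom e) hits ≡⟨ ∑-hits ⟩
      + N ∎
    rearrange : ∀ a b c d → a * b * (c * d) ≡ b * d * (a * c)
    rearrange = solve-∀

-- Orthogonality without characters, by induction on d. With g = gcd d i, the leading term of the
-- Möbius recursion sums to N g [g ∣ s] by `e*hits`. Among the proper divisors e of d, those not
-- dividing i contribute 0 by induction, and the others, which are the divisors of g, contribute N
-- c_e(s). Their total is again N g [g ∣ s].
∑-ramanujan-shift : ∀ d .{{_ : NonZero d}} N i s → d ∣ N → ¬ d ∣ i →
                    ∑[ τ ∈ downFrom N ] ramanujan d (s ℕ.+ τ ℕ.* i) ≡ 0ℤ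
∑-ramanujan-shift d {{d≢0}} N i s = <-rec (λ d → NonZero d → d ∣ N → ¬ d ∣ i →
    ∑[ τ ∈ downFrom N ] ramanujan d (s ℕ.+ τ ℕ.* i) ≡ 0ℤ) step d (ℕ.>-nonZero (ℕ.>-nonZero⁻¹ d))
  where
  step : ∀ d → (∀ {e} → e ℕ.< d → NonZero e → e ∣ N → ¬ e ∣ i →
                 ∑[ τ ∈ downFrom N ] ramanujan e (s ℕ.+ τ ℕ.* i) ≡ 0ℤ) →
         NonZero d → d ∣ N → ¬ d ∣ i → ∑[ τ ∈ downFrom N ] ramanujan d (s ℕ.+ τ ℕ.* i) ≡ 0ℤ
  step d@(suc d-1) rec d≢0 d∣N d∤i = begin
    ∑[ τ ∈ downFrom N ] ramanujan d (t τ)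
      ≡⟨ ∑-cong (downFrom N) (λ τ → möbius-unfold (λ m → + m * ⟦ m ∣? t τ ⟧) d) ⟩
    ∑[ τ ∈ downFrom N ] (+ d * ⟦ d ∣? t τ ⟧ - (∑[ e ∈ downFrom d ] ⟦ e ∣? d ⟧ * ramanujan e (t τ)))
      ≡⟨ ∑-- (downFrom N) (λ τ → + d * ⟦ d ∣? t τ ⟧) _ ⟩
    (∑[ τ ∈ downFrom N ] + d * ⟦ d ∣? t τ ⟧) -
      (∑[ τ ∈ downFrom N ] (∑[ e ∈ downFrom d ] ⟦ e ∣? d ⟧ * ramanujan e (t τ)))
      ≡⟨ cong₂ _-_ (trans (∑-*ˡ (downFrom N) (+ d) (λ τ → ⟦ d ∣? t τ ⟧)) (e*hits d N i d∣N s)) lower ⟩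
    + N * (+ g * ⟦ g ∣? s ⟧) - + N * (+ g * ⟦ g ∣? s ⟧)
      ≡⟨ ℤₚ.+-inverseʳ (+ N * (+ g * ⟦ g ∣? s ⟧)) ⟩
    0ℤ ∎
    where
    t : ℕ → ℕ
    t τ = s ℕ.+ τ ℕ.* i
    g = gcd d i
    instance
      g≢0 : NonZero g
      g≢0 = ℕ.≢-nonZero (λ g≡0 → ℕ.≢-nonZero⁻¹ d (gcd[m,n]≡0⇒m≡0 {d} {i} g≡0))
    -- Here d ∤ i enters: g is a proper divisor of d, so all divisors of g occur among the proper
    -- divisors of d.
    g≤d-1 : g ℕ.≤ d-1
    g≤d-1 = ℕₚ.≤-pred (ℕₚ.≤∧≢⇒< (∣⇒≤ (gcd[m,n]∣m d i)) (λ g≡d → d∤i (subst (_∣ i) g≡d (gcd[m,n]∣n d i))))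
    proper : ∀ e → e ℕ.< d →
             ⟦ e ∣? d ⟧ * (∑[ τ ∈ downFrom N ] ramanujan e (t τ)) ≡ + N * (⟦ e ∣? g ⟧ * ramanujan e s)
    proper e e<d = by-cases (e ∣? d) (e ∣? i)
      where
      e∤g : ¬ e ∣ g → 0ℤ ≡ + N * (⟦ e ∣? g ⟧ * ramanujan e s)
      e∤g h = sym (trans (*ʳ (+ N) (trans (cong (λ r → r * ramanujan e s) (⟦⟧-no (e ∣? g) h))
                (ℤₚ.*-zeroˡ (ramanujan e s)))) (ℤₚ.*-zeroʳ (+ N)))
      by-cases : (p? : Dec (e ∣ d)) → Dec (e ∣ i) →
                 ⟦ p? ⟧ * (∑[ τ ∈ downFrom N ] ramanujan e (t τ)) ≡ + N * (⟦ e ∣? g ⟧ * ramanujan e s)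
      by-cases (no e∤d) _ = trans (ℤₚ.*-zeroˡ (∑[ τ ∈ downFrom N ] ramanujan e (t τ))) (e∤g (λ h → e∤d (∣-trans h (gcd[m,n]∣m d i))))
      by-cases (yes e∣d) (no e∤i) =
        trans (*ʳ 1ℤ (rec e<d (ℕ.≢-nonZero λ { refl → ℕ.≢-nonZero⁻¹ d (0∣⇒≡0 e∣d) }) (∣-trans e∣d d∣N) e∤i))
              (e∤g (λ h → e∤i (∣-trans h (gcd[m,n]∣n d i))))
      by-cases (yes e∣d) (yes (divides k refl)) = begin
        1ℤ * (∑[ τ ∈ downFrom N ] ramanujan e (t τ))
          ≡⟨ ℤₚ.*-identityˡ _ ⟩
        ∑[ τ ∈ downFrom N ] ramanujan e (t τ)
          ≡⟨ ∑-cong (downFrom N) (λ τ → trans (cong (λ r → ramanujan e (s ℕ.+ r)) (sym (ℕₚ.*-assoc τ k e)))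
                                              (ramanujan-periodic e s (τ ℕ.* k))) ⟩
        ∑[ τ ∈ downFrom N ] ramanujan e s
          ≡⟨ ∑-const (downFrom N) _ ⟩
        + length (downFrom N) * ramanujan e s
          ≡⟨ cong₂ (λ a b → + a * b) (Listₚ.length-downFrom N) (sym (ℤₚ.*-identityˡ (ramanujan e s))) ⟩
        + N * (1ℤ * ramanujan e s)
          ≡⟨ cong (λ r → + N * (r * ramanujan e s)) (⟦⟧-yes (e ∣? g) (gcd-greatest e∣d (divides k refl))) ⟨
        + N * (⟦ e ∣? g ⟧ * ramanujan e s) ∎
    lower : ∑[ τ ∈ downFrom N ] (∑[ e ∈ downFrom d ] ⟦ e ∣? d ⟧ * ramanujan e (t τ)) ≡ + N * (+ g * ⟦ g ∣? s ⟧)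
    lower = begin
      ∑[ τ ∈ downFrom N ] (∑[ e ∈ downFrom d ] ⟦ e ∣? d ⟧ * ramanujan e (t τ))
        ≡⟨ ∑-swap (downFrom N) (downFrom d) _ ⟩
      ∑[ e ∈ downFrom d ] (∑[ τ ∈ downFrom N ] ⟦ e ∣? d ⟧ * ramanujan e (t τ))
        ≡⟨ ∑-cong-∈ (downFrom d) (λ {e} e∈ → trans (∑-*ˡ (downFrom N) ⟦ e ∣? d ⟧ (λ τ → ramanujan e (t τ)))
                                                   (proper e (∈-downFrom⁻ e∈))) ⟩
      ∑[ e ∈ downFrom d ] + N * (⟦ e ∣? g ⟧ * ramanujan e s)
        ≡⟨ ∑-*ˡ (downFrom d) (+ N) (λ e → ⟦ e ∣? g ⟧ * ramanujan e s) ⟩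
      + N * (∑[ e ∈ downFrom d ] ⟦ e ∣? g ⟧ * ramanujan e s)
        ≡⟨ *ʳ (+ N) (∑-ramanujan g g≤d-1 s) ⟩
      + N * (+ g * ⟦ g ∣? s ⟧) ∎

-- Grouping s < q by the additive order d = q / gcd s q; there are c_d(0) = φ(d) elements of order d.
∑-gcd : ∀ q .{{_ : NonZero q}} (Φ Ψ : ℕ → ℤ) → (∀ d m → d ℕ.* m ≡ q → Ψ d ≡ Φ m) →
        ∑[ s ∈ downFrom q ] Φ (gcd s q) ≡ ∑[ d ∈ downFrom (suc q) ] ⟦ d ∣? q ⟧ * (ramanujan d 0 * Ψ d)
∑-gcd q Φ Ψ Ψ≡Φ = begin
  ∑[ s ∈ downFrom q ] Φ (gcd s q)
    -- Expanding Φ through its Möbius inverse ψ brings both sides to the sum of c_d(0) ψ(e) over the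
    -- pairs with d e ∣ q.
    ≡⟨ ∑-cong (downFrom q) (λ s → sym (möbius-inversion Φ (gcd s q) {{gcd≢0 s}} (∣⇒≤ (gcd[m,n]∣n s q)))) ⟩
  ∑[ s ∈ downFrom q ] (∑[ e ∈ D ] ⟦ e ∣? gcd s q ⟧ * ψ e)
    ≡⟨ ∑-swap (downFrom q) D _ ⟩
  ∑[ e ∈ D ] (∑[ s ∈ downFrom q ] ⟦ e ∣? gcd s q ⟧ * ψ e)
    ≡⟨ ∑-cong D count ⟩
  ∑[ e ∈ D ] (∑[ d ∈ D ] ⟦ d ℕ.* e ∣? q ⟧ * (ramanujan d 0 * ψ e))
    ≡⟨ ∑-swap D D (λ e d → ⟦ d ℕ.* e ∣? q ⟧ * (ramanujan d 0 * ψ e)) ⟩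
  ∑[ d ∈ D ] (∑[ e ∈ D ] ⟦ d ℕ.* e ∣? q ⟧ * (ramanujan d 0 * ψ e))
    ≡⟨ ∑-cong D expand ⟨
  ∑[ d ∈ D ] ⟦ d ∣? q ⟧ * (ramanujan d 0 * Ψ d) ∎
  where
  D = downFrom (suc q)
  ψ = möbius Φ
  gcd≢0 : ∀ s → NonZero (gcd s q)
  gcd≢0 s = ℕ.≢-nonZero (λ g≡0 → ℕ.≢-nonZero⁻¹ q (gcd[m,n]≡0⇒n≡0 s g≡0))
  xyz : ∀ x y z → x * (y * z) ≡ y * (x * z)
  xyz = solve-∀

  factor≢0 : ∀ {a b} → a ℕ.* b ≡ q → NonZero a × NonZero b
  factor≢0 {a} {b} refl = ℕₚ.m*n≢0⇒m≢0 a , ℕₚ.m*n≢0⇒n≢0 a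

  expand : ∀ d → ⟦ d ∣? q ⟧ * (ramanujan d 0 * Ψ d) ≡ ∑[ e ∈ D ] ⟦ d ℕ.* e ∣? q ⟧ * (ramanujan d 0 * ψ e)
  expand d with d ∣? q
  ... | no d∤q = sym (trans (∑-cong D (λ e → trans (cong (λ r → r * (ramanujan d 0 * ψ e))
                   (⟦⟧-no (d ℕ.* e ∣? q) (λ h → d∤q (m*n∣⇒m∣ d e h)))) (ℤₚ.*-zeroˡ (ramanujan d 0 * ψ e))))
                   (trans (∑-zero D) (sym (ℤₚ.*-zeroˡ (ramanujan d 0 * Ψ d)))))
  ... | yes (divides m q≡m*d) = begin
    1ℤ * (ramanujan d 0 * Ψ d)
      ≡⟨ ℤₚ.*-identityˡ _ ⟩
    ramanujan d 0 * Ψ d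
      ≡⟨ *ʳ (ramanujan d 0) (Ψ≡Φ d m d*m≡q) ⟩
    ramanujan d 0 * Φ m
      ≡⟨ *ʳ (ramanujan d 0) (möbius-inversion Φ m (∣⇒≤ (divides d (sym d*m≡q)))) ⟨
    ramanujan d 0 * (∑[ e ∈ D ] ⟦ e ∣? m ⟧ * ψ e)
      ≡⟨ ∑-*ˡ D (ramanujan d 0) (λ e → ⟦ e ∣? m ⟧ * ψ e) ⟨
    ∑[ e ∈ D ] ramanujan d 0 * (⟦ e ∣? m ⟧ * ψ e)
      ≡⟨ ∑-cong D (λ e → trans (xyz (ramanujan d 0) ⟦ e ∣? m ⟧ (ψ e)) (cong (λ r → r * (ramanujan d 0 * ψ e))
           (⟦⟧-⇔ (e ∣? m) (d ℕ.* e ∣? q) (λ h → subst (d ℕ.* e ∣_) d*m≡q (*-monoʳ-∣ d h))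
                                          (λ h → *-cancelˡ-∣ d (subst (d ℕ.* e ∣_) (sym d*m≡q) h))))) ⟩
    ∑[ e ∈ D ] ⟦ d ℕ.* e ∣? q ⟧ * (ramanujan d 0 * ψ e) ∎
    where
    d*m≡q : d ℕ.* m ≡ q
    d*m≡q = trans (ℕₚ.*-comm d m) (sym q≡m*d)
    instance
      d≢0 : NonZero d
      d≢0 = proj₁ (factor≢0 d*m≡q)
      m≢0 : NonZero m
      m≢0 = proj₂ (factor≢0 {d} d*m≡q)

  count : ∀ e → ∑[ s ∈ downFrom q ] ⟦ e ∣? gcd s q ⟧ * ψ e ≡ ∑[ d ∈ D ] ⟦ d ℕ.* e ∣? q ⟧ * (ramanujan d 0 * ψ e)
  count e with e ∣? q
  ... | no e∤q = trans
    (trans (∑-cong (downFrom q) (λ s → trans (cong (λ r → r * ψ e)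
      (⟦⟧-no (e ∣? gcd s q) (λ h → e∤q (∣-trans h (gcd[m,n]∣n s q))))) (ℤₚ.*-zeroˡ (ψ e)))) (∑-zero (downFrom q)))
    (sym (trans (∑-cong D (λ d → trans (cong (λ r → r * (ramanujan d 0 * ψ e))
      (⟦⟧-no (d ℕ.* e ∣? q) (λ h → e∤q (m*n∣⇒n∣ d e h)))) (ℤₚ.*-zeroˡ (ramanujan d 0 * ψ e)))) (∑-zero D)))
  ... | yes (divides m q≡m*e) = begin
    ∑[ s ∈ downFrom q ] ⟦ e ∣? gcd s q ⟧ * ψ e
      ≡⟨ ∑-*ʳ (downFrom q) (ψ e) (λ s → ⟦ e ∣? gcd s q ⟧) ⟩
    (∑[ s ∈ downFrom q ] ⟦ e ∣? gcd s q ⟧) * ψ e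
      ≡⟨ cong (λ r → r * ψ e) (∑-cong (downFrom q) (λ s → ⟦⟧-⇔ (e ∣? gcd s q) (e ∣? s)
           (λ h → ∣-trans h (gcd[m,n]∣m s q)) (λ h → gcd-greatest h e∣q))) ⟩
    (∑[ s ∈ downFrom q ] ⟦ e ∣? s ⟧) * ψ e
      ≡⟨ cong (λ r → r * ψ e) (ℤₚ.*-cancelˡ-≡ (+ e) _ (+ m) (begin
           + e * (∑[ s ∈ downFrom q ] ⟦ e ∣? s ⟧) ≡⟨ ∑-multiples e q e∣q ⟩
           + q                                    ≡⟨ cong +_ q≡m*e ⟩
           + (m ℕ.* e)                            ≡⟨ cong +_ (ℕₚ.*-comm m e) ⟩
           + (e ℕ.* m)                            ≡⟨ ℤₚ.pos-* e m ⟩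
           + e * + m                              ∎)) ⟩
    + m * ψ e
      ≡⟨ cong (λ r → r * ψ e) (ℤₚ.*-identityʳ (+ m)) ⟨
    + m * 1ℤ * ψ e
      ≡⟨ cong (λ r → + m * r * ψ e) (⟦⟧-yes (m ∣? 0) (m ∣0)) ⟨
    + m * ⟦ m ∣? 0 ⟧ * ψ e
      -- The number m of multiples of e below q = m e is itself the divisor sum of c_d(0) over d ∣
      -- m.
      ≡⟨ cong (λ r → r * ψ e) (∑-ramanujan m (∣⇒≤ (divides e (trans q≡m*e (ℕₚ.*-comm m e)))) 0) ⟨
    (∑[ d ∈ D ] ⟦ d ∣? m ⟧ * ramanujan d 0) * ψ e
      ≡⟨ ∑-*ʳ D (ψ e) (λ d → ⟦ d ∣? m ⟧ * ramanujan d 0) ⟨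
    ∑[ d ∈ D ] ⟦ d ∣? m ⟧ * ramanujan d 0 * ψ e
      ≡⟨ ∑-cong D (λ d → trans (ℤₚ.*-assoc ⟦ d ∣? m ⟧ (ramanujan d 0) (ψ e)) (cong (λ r → r * (ramanujan d 0 * ψ e))
           (⟦⟧-⇔ (d ∣? m) (d ℕ.* e ∣? q) (λ h → subst (d ℕ.* e ∣_) (sym q≡m*e) (*-monoˡ-∣ e h))
                                          (λ h → *-cancelʳ-∣ e (subst (d ℕ.* e ∣_) q≡m*e h))))) ⟩
    ∑[ d ∈ D ] ⟦ d ℕ.* e ∣? q ⟧ * (ramanujan d 0 * ψ e) ∎
    where
    e∣q : e ∣ q
    e∣q = divides m q≡m*e
    instance
      m≢0 : NonZero m
      m≢0 = proj₁ (factor≢0 (sym q≡m*e))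
      e≢0 : NonZero e
      e≢0 = proj₂ (factor≢0 {m} (sym q≡m*e))

-- Binary words and their weights

_≟ʷ_ : (u v : List Bool) → Dec (u ≡ v)
_≟ʷ_ = Listₚ.≡-dec Boolₚ._≟_

words : ℕ → List (List Bool)
words zero    = [] ∷ []
words (suc q) = map (true ∷_) (words q) ++ map (false ∷_) (words q)

length-words : ∀ q {w} → w ∈ words q → length w ≡ q
length-words q w∈ = All.lookup (go q) w∈
  where
  go : ∀ q → All (λ w → length w ≡ q) (words q)
  go zero    = refl ∷ []
  go (suc q) = Allₚ.++⁺ (Allₚ.map⁺ (All.map (cong suc) (go q))) (Allₚ.map⁺ (All.map (cong suc) (go q)))

∑-words-suc : ∀ q (F : List Bool → ℤ) →
              ∑ₗ (words (suc q)) F ≡ (∑[ w ∈ words q ] F (true ∷ w)) + (∑[ w ∈ words q ] F (false ∷ w))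
∑-words-suc q F = trans (∑-++ (map (true ∷_) (words q)) _ F)
  (cong₂ _+_ (∑-map (true ∷_) (words q) F) (∑-map (false ∷_) (words q) F))

∑-words-+ : ∀ m k (F : List Bool → ℤ) →
            ∑ₗ (words (m ℕ.+ k)) F ≡ ∑[ u ∈ words m ] (∑[ v ∈ words k ] F (u ++ v))
∑-words-+ zero    k F = sym (ℤₚ.+-identityʳ _)
∑-words-+ (suc m) k F = begin
  ∑ₗ (words (suc m ℕ.+ k)) F
    ≡⟨ ∑-words-suc (m ℕ.+ k) F ⟩
  (∑[ w ∈ words (m ℕ.+ k) ] F (true ∷ w)) + (∑[ w ∈ words (m ℕ.+ k) ] F (false ∷ w))
    ≡⟨ cong₂ _+_ (∑-words-+ m k (F ∘ (true ∷_))) (∑-words-+ m k (F ∘ (false ∷_))) ⟩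
  (∑[ u ∈ words m ] (∑[ v ∈ words k ] F (true ∷ u ++ v))) + (∑[ u ∈ words m ] (∑[ v ∈ words k ] F (false ∷ u ++ v)))
    ≡⟨ ∑-words-suc m (λ u → ∑[ v ∈ words k ] F (u ++ v)) ⟨
  ∑[ u ∈ words (suc m) ] (∑[ v ∈ words k ] F (u ++ v)) ∎

∑-words-δ : ∀ q v (F : List Bool → ℤ) → length v ≡ q → ∑[ w ∈ words q ] ⟦ w ≟ʷ v ⟧ * F w ≡ F v
∑-words-δ zero    []      F refl = trans (ℤₚ.+-identityʳ _) (ℤₚ.*-identityˡ (F []))
∑-words-δ (suc q) (x ∷ v) F eq = trans (∑-words-suc q (λ w → ⟦ w ≟ʷ (x ∷ v) ⟧ * F w)) (by-head x)
  where
  |v|≡q = ℕₚ.suc-injective eq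
  same : ∀ x → ∑[ w ∈ words q ] ⟦ (x ∷ w) ≟ʷ (x ∷ v) ⟧ * F (x ∷ w) ≡ F (x ∷ v)
  same x = trans (∑-cong (words q) (λ w → cong (λ r → r * F (x ∷ w))
    (⟦⟧-⇔ ((x ∷ w) ≟ʷ (x ∷ v)) (w ≟ʷ v) Listₚ.∷-injectiveʳ (cong (x ∷_))))) (∑-words-δ q v (F ∘ (x ∷_)) |v|≡q)
  other : ∀ x y → x ≢ y → ∑[ w ∈ words q ] ⟦ (y ∷ w) ≟ʷ (x ∷ v) ⟧ * F (y ∷ w) ≡ 0ℤ
  other x y x≢y = trans (∑-cong (words q) (λ w → trans (cong (λ r → r * F (y ∷ w))
    (⟦⟧-no ((y ∷ w) ≟ʷ (x ∷ v)) (λ h → x≢y (sym (Listₚ.∷-injectiveˡ h))))) (ℤₚ.*-zeroˡ (F (y ∷ w))))) (∑-zero (words q))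
  by-head : ∀ x → (∑[ w ∈ words q ] ⟦ (true ∷ w) ≟ʷ (x ∷ v) ⟧ * F (true ∷ w))
                + (∑[ w ∈ words q ] ⟦ (false ∷ w) ≟ʷ (x ∷ v) ⟧ * F (false ∷ w)) ≡ F (x ∷ v)
  by-head true  = trans (cong₂ _+_ (same true) (other true false λ ())) (ℤₚ.+-identityʳ (F (true ∷ v)))
  by-head false = trans (cong₂ _+_ (other false true λ ()) (same false)) (ℤₚ.+-identityˡ (F (false ∷ v)))

blacks-++ : ∀ u v → blacks (u ++ v) ≡ blacks u ℕ.+ blacks v
blacks-++ []          v = refl
blacks-++ (true ∷ u)  v = cong suc (blacks-++ u v)
blacks-++ (false ∷ u) v = blacks-++ u v

blacks-rot : ∀ w → blacks (rot w) ≡ blacks w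
blacks-rot []          = refl
blacks-rot (true ∷ w)  = trans (blacks-++ w _) (ℕₚ.+-comm (blacks w) 1)
blacks-rot (false ∷ w) = trans (blacks-++ w _) (ℕₚ.+-identityʳ (blacks w))

blacks-rotN : ∀ s w → blacks (rotN s w) ≡ blacks w
blacks-rotN zero    w = refl
blacks-rotN (suc s) w = trans (blacks-rot (rotN s w)) (blacks-rotN s w)

length-rotN : ∀ s w → length (rotN s w) ≡ length w
length-rotN zero    w = refl
length-rotN (suc s) w = trans (length-rot (rotN s w)) (length-rotN s w)
  where
  length-rot : ∀ w → length (rot w) ≡ length w
  length-rot []      = refl
  length-rot (x ∷ w) = trans (Listₚ.length-++ w) (ℕₚ.+-comm (length w) 1)

-- Splitting off the first letter of a word and splitting off the last one enumerate the same words.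
∑-words-rot : ∀ q (F : List Bool → ℤ) → ∑[ w ∈ words q ] F (rot w) ≡ ∑ₗ (words q) F
∑-words-rot zero    F = refl
∑-words-rot (suc q) F = begin
  ∑[ w ∈ words (suc q) ] F (rot w)
    ≡⟨ ∑-words-suc q (F ∘ rot) ⟩
  (∑[ w ∈ words q ] F (w ++ true ∷ [])) + (∑[ w ∈ words q ] F (w ++ false ∷ []))
    ≡⟨ ∑-+ (words q) _ _ ⟨
  ∑[ w ∈ words q ] (F (w ++ true ∷ []) + F (w ++ false ∷ []))
    ≡⟨ ∑-cong (words q) (λ w → +ʳ (F (w ++ true ∷ [])) (sym (ℤₚ.+-identityʳ (F (w ++ false ∷ []))))) ⟩
  ∑[ w ∈ words q ] (∑[ v ∈ words 1 ] F (w ++ v))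
    ≡⟨ ∑-words-+ q 1 F ⟨
  ∑ₗ (words (q ℕ.+ 1)) F
    ≡⟨ cong (λ k → ∑ₗ (words k) F) (ℕₚ.+-comm q 1) ⟩
  ∑ₗ (words (suc q)) F ∎

-- The sum of the positions of the black beads, positions being counted from the right end.
weight : List Bool → ℕ
weight []          = 0
weight (true ∷ w)  = length w ℕ.+ weight w
weight (false ∷ w) = weight w

weight-++ : ∀ u v → weight (u ++ v) ≡ weight u ℕ.+ weight v ℕ.+ blacks u ℕ.* length v
weight-++ []          v = sym (ℕₚ.+-identityʳ (weight v))
weight-++ (true ∷ u)  v = trans (cong₂ ℕ._+_ (Listₚ.length-++ u) (weight-++ u v))
  (shuffle (length u) (length v) (weight u) (weight v) (blacks u))
  where
  shuffle : ∀ a b c d e → a ℕ.+ b ℕ.+ (c ℕ.+ d ℕ.+ e ℕ.* b) ≡ a ℕ.+ c ℕ.+ d ℕ.+ suc e ℕ.* b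
  shuffle = ℕ-Solver.solve-∀
weight-++ (false ∷ u) v = weight-++ u v

-- Rotation raises the position of every bead by one, except that the leading bead falls from the
-- last position to 0. `j` is 1 exactly when that bead is black, and keeps the equation free of
-- subtraction.
weight-rot : ∀ w → ∃ λ j → weight (rot w) ℕ.+ j ℕ.* length w ≡ weight w ℕ.+ blacks w
weight-rot []          = 0 , refl
weight-rot (true ∷ w)  = 1 , trans (cong (ℕ._+ (1 ℕ.* suc (length w))) (weight-++ w (true ∷ [])))
                                   (shuffle (weight w) (blacks w) (length w))
  where
  shuffle : ∀ a b c → a ℕ.+ 0 ℕ.+ b ℕ.* 1 ℕ.+ 1 ℕ.* suc c ≡ c ℕ.+ a ℕ.+ suc b
  shuffle = ℕ-Solver.solve-∀
weight-rot (false ∷ w) = 0 , trans (cong (ℕ._+ 0) (weight-++ w (false ∷ []))) (shuffle (weight w) (blacks w))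
  where
  shuffle : ∀ a b → a ℕ.+ 0 ℕ.+ b ℕ.* 1 ℕ.+ 0 ≡ a ℕ.+ b
  shuffle = ℕ-Solver.solve-∀

∑-words-white : ∀ d (F : List Bool → ℤ) → ∑[ u ∈ words d ] ⟦ blacks u ℕ.≟ 0 ⟧ * F u ≡ F (replicate d false)
∑-words-white zero    F = trans (ℤₚ.+-identityʳ _) (ℤₚ.*-identityˡ (F []))
∑-words-white (suc d) F = begin
  ∑[ u ∈ words (suc d) ] ⟦ blacks u ℕ.≟ 0 ⟧ * F u
    ≡⟨ ∑-words-suc d (λ u → ⟦ blacks u ℕ.≟ 0 ⟧ * F u) ⟩
  (∑[ u ∈ words d ] 0ℤ * F (true ∷ u)) + (∑[ u ∈ words d ] ⟦ blacks u ℕ.≟ 0 ⟧ * F (false ∷ u))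
    ≡⟨ cong₂ _+_ (trans (∑-*ˡ (words d) 0ℤ (F ∘ (true ∷_))) (ℤₚ.*-zeroˡ (∑ₗ (words d) (F ∘ (true ∷_)))))
         (∑-words-white d (F ∘ (false ∷_))) ⟩
  0ℤ + F (replicate (suc d) false)
    ≡⟨ ℤₚ.+-identityˡ _ ⟩
  F (replicate (suc d) false) ∎

blacks≤length : ∀ w → blacks w ℕ.≤ length w
blacks≤length []          = z≤n
blacks≤length (true ∷ w)  = s≤s (blacks≤length w)
blacks≤length (false ∷ w) = ℕₚ.m≤n⇒m≤1+n (blacks≤length w)

∑-words-black : ∀ d (F : List Bool → ℤ) → ∑[ u ∈ words d ] ⟦ blacks u ℕ.≟ d ⟧ * F u ≡ F (replicate d true)
∑-words-black zero    F = trans (ℤₚ.+-identityʳ _) (ℤₚ.*-identityˡ (F []))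
∑-words-black (suc d) F = begin
  ∑[ u ∈ words (suc d) ] ⟦ blacks u ℕ.≟ suc d ⟧ * F u
    ≡⟨ ∑-words-suc d (λ u → ⟦ blacks u ℕ.≟ suc d ⟧ * F u) ⟩
  (∑[ u ∈ words d ] ⟦ suc (blacks u) ℕ.≟ suc d ⟧ * F (true ∷ u)) + (∑[ u ∈ words d ] ⟦ blacks u ℕ.≟ suc d ⟧ * F (false ∷ u))
    ≡⟨ cong₂ _+_
         (trans (∑-cong (words d) (λ u → cong (λ r → r * F (true ∷ u))
           (⟦⟧-⇔ (suc (blacks u) ℕ.≟ suc d) (blacks u ℕ.≟ d) ℕₚ.suc-injective (cong suc)))) (∑-words-black d (F ∘ (true ∷_))))
         (trans (∑-cong-∈ (words d) (λ {u} u∈ → trans (cong (λ r → r * F (false ∷ u))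
           (⟦⟧-no (blacks u ℕ.≟ suc d) (λ h → ℕₚ.1+n≰n (subst₂ ℕ._≤_ h (length-words d u∈) (blacks≤length u)))))
           (ℤₚ.*-zeroˡ (F (false ∷ u))))) (∑-zero (words d))) ⟩
  F (replicate (suc d) true) + 0ℤ
    ≡⟨ ℤₚ.+-identityʳ _ ⟩
  F (replicate (suc d) true) ∎

weight-white : ∀ d → weight (replicate d false) ≡ 0
weight-white zero    = refl
weight-white (suc d) = weight-white d

-- The positions add up to d(d - 1)/2. This is the point where oddness is decisive: for even d the
-- sum would be d/2 modulo d, and c_d(d/2) = -φ(d).
weight-black : ∀ d k → d ≡ suc (2 ℕ.* k) → weight (replicate d true) ≡ k ℕ.* d
weight-black d k refl = ℕₚ.*-cancelˡ-≡ _ _ 2 (ℕₚ.+-cancelʳ-≡ d _ _ (trans (triangle d) (square k)))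
  where
  square : ∀ k → suc (2 ℕ.* k) ℕ.* suc (2 ℕ.* k) ≡ 2 ℕ.* (k ℕ.* suc (2 ℕ.* k)) ℕ.+ suc (2 ℕ.* k)
  square = ℕ-Solver.solve-∀
  triangle : ∀ d → 2 ℕ.* weight (replicate d true) ℕ.+ d ≡ d ℕ.* d
  triangle zero    = refl
  triangle (suc d) = begin
    2 ℕ.* (length (replicate d true) ℕ.+ weight (replicate d true)) ℕ.+ suc d
      ≡⟨ cong (λ r → 2 ℕ.* (r ℕ.+ weight (replicate d true)) ℕ.+ suc d) (Listₚ.length-replicate d) ⟩
    2 ℕ.* (d ℕ.+ weight (replicate d true)) ℕ.+ suc d
      ≡⟨ step d (weight (replicate d true)) ⟩
    (2 ℕ.* weight (replicate d true) ℕ.+ d) ℕ.+ (1 ℕ.+ 2 ℕ.* d)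
      ≡⟨ cong (ℕ._+ (1 ℕ.+ 2 ℕ.* d)) (triangle d) ⟩
    d ℕ.* d ℕ.+ (1 ℕ.+ 2 ℕ.* d)
      ≡⟨ step′ d ⟩
    suc d ℕ.* suc d ∎
    where
    step : ∀ d w → 2 ℕ.* (d ℕ.+ w) ℕ.+ suc d ≡ (2 ℕ.* w ℕ.+ d) ℕ.+ (1 ℕ.+ 2 ℕ.* d)
    step = ℕ-Solver.solve-∀
    step′ : ∀ d → d ℕ.* d ℕ.+ (1 ℕ.+ 2 ℕ.* d) ≡ suc d ℕ.* suc d
    step′ = ℕ-Solver.solve-∀

ramanujan-≡ : ∀ d {s s′} i j → s ℕ.+ i ℕ.* d ≡ s′ ℕ.+ j ℕ.* d → ramanujan d s ≡ ramanujan d s′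
ramanujan-≡ d {s} {s′} i j eq = begin
  ramanujan d s               ≡⟨ ramanujan-periodic d s i ⟨
  ramanujan d (s ℕ.+ i ℕ.* d) ≡⟨ cong (ramanujan d) eq ⟩
  ramanujan d (s′ ℕ.+ j ℕ.* d) ≡⟨ ramanujan-periodic d s′ j ⟩
  ramanujan d s′              ∎

-- Rotating a block of d beads with b black ones adds b to its weight modulo d, so the average over
-- all rotations vanishes unless the block is monochromatic.
∑-block : ∀ d .{{_ : NonZero d}} → Odd d → ∀ (κ : ℕ → ℤ) s →
          ∑[ u ∈ words d ] κ (blacks u) * ramanujan d (s ℕ.+ weight u) ≡ (κ 0 + κ d) * ramanujan d s
∑-block d (k , d≡1+2k) κ s = ℤₚ.*-cancelˡ-≡ (+ d) _ _ (begin
  + d * (∑[ u ∈ words d ] κ (blacks u) * ramanujan d (s ℕ.+ weight u))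
    ≡⟨ *ʳ (+ d) (∑-cong (words d) (λ u → cong (λ r → κ (blacks u) * ramanujan d r) (ℕₚ.+-identityʳ (s ℕ.+ weight u)))) ⟨
  + d * ∑ₗ (words d) (f 0)
    ≡⟨ cong (λ r → + r * ∑ₗ (words d) (f 0)) (Listₚ.length-downFrom d) ⟨
  + length (downFrom d) * ∑ₗ (words d) (f 0)
    ≡⟨ ∑-const (downFrom d) _ ⟨
  ∑[ τ ∈ downFrom d ] ∑ₗ (words d) (f 0)
    -- The factor d has become d equal copies of the sum; in copy τ the words are rotated τ times,
    -- which adds τ times the number of black beads to the weight modulo d.
    ≡⟨ ∑-cong (downFrom d) rotate ⟩
  ∑[ τ ∈ downFrom d ] ∑ₗ (words d) (f τ)
    ≡⟨ ∑-swap (downFrom d) (words d) f ⟩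
  ∑[ u ∈ words d ] (∑[ τ ∈ downFrom d ] f τ u)
    ≡⟨ ∑-cong-∈ (words d) (λ {u} u∈ → trans (∑-*ˡ (downFrom d) (κ (blacks u)) _) (average u (length-words d u∈))) ⟩
  ∑[ u ∈ words d ] (⟦ blacks u ℕ.≟ 0 ⟧ * G u + ⟦ blacks u ℕ.≟ d ⟧ * G u)
    ≡⟨ ∑-+ (words d) (λ u → ⟦ blacks u ℕ.≟ 0 ⟧ * G u) (λ u → ⟦ blacks u ℕ.≟ d ⟧ * G u) ⟩
  (∑[ u ∈ words d ] ⟦ blacks u ℕ.≟ 0 ⟧ * G u) + (∑[ u ∈ words d ] ⟦ blacks u ℕ.≟ d ⟧ * G u)
    ≡⟨ cong₂ _+_ (∑-words-white d G) (∑-words-black d G) ⟩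
  G (replicate d false) + G (replicate d true)
    ≡⟨ cong₂ _+_ (at (replicate d false) 0 0 (blacks-white d) (cong (s ℕ.+_) (weight-white d)))
                 (at (replicate d true) d k (blacks-black d) (cong (s ℕ.+_) (weight-black d k d≡1+2k))) ⟩
  κ 0 * (+ d * ramanujan d s) + κ d * (+ d * ramanujan d s)
    ≡⟨ factor (κ 0) (κ d) (+ d) (ramanujan d s) ⟩
  + d * ((κ 0 + κ d) * ramanujan d s) ∎)
  where
  f : ℕ → List Bool → ℤ
  f τ u = κ (blacks u) * ramanujan d (s ℕ.+ weight u ℕ.+ τ ℕ.* blacks u)
  G : List Bool → ℤ
  G u = κ (blacks u) * (+ d * ramanujan d (s ℕ.+ weight u))

  factor : ∀ a b c e → a * (c * e) + b * (c * e) ≡ c * ((a + b) * e)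
  factor = solve-∀

  blacks-white : ∀ d → blacks (replicate d false) ≡ 0
  blacks-white zero    = refl
  blacks-white (suc d) = blacks-white d
  blacks-black : ∀ d → blacks (replicate d true) ≡ d
  blacks-black zero    = refl
  blacks-black (suc d) = cong suc (blacks-black d)

  at : ∀ u b j → blacks u ≡ b → s ℕ.+ weight u ≡ s ℕ.+ j ℕ.* d → G u ≡ κ b * (+ d * ramanujan d s)
  at u b j refl h = *ʳ (κ b) (*ʳ (+ d) (trans (cong (ramanujan d) h) (ramanujan-periodic d s j)))

  f-rot : ∀ τ {u} → length u ≡ d → f τ (rot u) ≡ f (suc τ) u
  f-rot τ {u} refl with weight-rot u
  ... | j , eq = cong₂ (λ a b → κ a * b) (blacks-rot u) (ramanujan-≡ (length u) j 0 (begin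
      s ℕ.+ weight (rot u) ℕ.+ τ ℕ.* blacks (rot u) ℕ.+ j ℕ.* length u
        ≡⟨ cong (λ r → s ℕ.+ weight (rot u) ℕ.+ τ ℕ.* r ℕ.+ j ℕ.* length u) (blacks-rot u) ⟩
      s ℕ.+ weight (rot u) ℕ.+ τ ℕ.* blacks u ℕ.+ j ℕ.* length u
        ≡⟨ shuffle s (weight (rot u)) (τ ℕ.* blacks u) (j ℕ.* length u) ⟩
      s ℕ.+ (weight (rot u) ℕ.+ j ℕ.* length u) ℕ.+ τ ℕ.* blacks u
        ≡⟨ cong (λ r → s ℕ.+ r ℕ.+ τ ℕ.* blacks u) eq ⟩
      s ℕ.+ (weight u ℕ.+ blacks u) ℕ.+ τ ℕ.* blacks u
        ≡⟨ shuffle′ s (weight u) (blacks u) (τ ℕ.* blacks u) (length u) ⟩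
      s ℕ.+ weight u ℕ.+ suc τ ℕ.* blacks u ℕ.+ 0 ℕ.* length u ∎))
    where
    shuffle : ∀ a b c e → a ℕ.+ b ℕ.+ c ℕ.+ e ≡ a ℕ.+ (b ℕ.+ e) ℕ.+ c
    shuffle = ℕ-Solver.solve-∀
    shuffle′ : ∀ a b c e l → a ℕ.+ (b ℕ.+ c) ℕ.+ e ≡ a ℕ.+ b ℕ.+ (c ℕ.+ e) ℕ.+ 0 ℕ.* l
    shuffle′ = ℕ-Solver.solve-∀

  rotate : ∀ τ → ∑ₗ (words d) (f 0) ≡ ∑ₗ (words d) (f τ)
  rotate zero    = refl
  rotate (suc τ) = begin
    ∑ₗ (words d) (f 0)             ≡⟨ rotate τ ⟩
    ∑ₗ (words d) (f τ)             ≡⟨ ∑-words-rot d (f τ) ⟨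
    ∑[ u ∈ words d ] f τ (rot u)   ≡⟨ ∑-cong-∈ (words d) (λ {u} u∈ → f-rot τ {u} (length-words d u∈)) ⟩
    ∑ₗ (words d) (f (suc τ))       ∎

  constant : ∀ u → d ∣ blacks u →
             ∑[ τ ∈ downFrom d ] ramanujan d (s ℕ.+ weight u ℕ.+ τ ℕ.* blacks u) ≡ + d * ramanujan d (s ℕ.+ weight u)
  constant u (divides j eq) = begin
    ∑[ τ ∈ downFrom d ] ramanujan d (s ℕ.+ weight u ℕ.+ τ ℕ.* blacks u)
      ≡⟨ ∑-cong (downFrom d) (λ τ → trans (cong (λ r → ramanujan d (s ℕ.+ weight u ℕ.+ r))
           (trans (cong (τ ℕ.*_) eq) (sym (ℕₚ.*-assoc τ j d)))) (ramanujan-periodic d _ (τ ℕ.* j))) ⟩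
    ∑[ τ ∈ downFrom d ] ramanujan d (s ℕ.+ weight u)
      ≡⟨ ∑-const (downFrom d) _ ⟩
    + length (downFrom d) * ramanujan d (s ℕ.+ weight u)
      ≡⟨ cong (λ r → + r * ramanujan d (s ℕ.+ weight u)) (Listₚ.length-downFrom d) ⟩
    + d * ramanujan d (s ℕ.+ weight u) ∎

  average : ∀ u → length u ≡ d → κ (blacks u) * (∑[ τ ∈ downFrom d ] ramanujan d (s ℕ.+ weight u ℕ.+ τ ℕ.* blacks u))
                ≡ ⟦ blacks u ℕ.≟ 0 ⟧ * G u + ⟦ blacks u ℕ.≟ d ⟧ * G u
  average u |u|≡d with blacks u ℕ.≟ 0 | blacks u ℕ.≟ d
  ... | yes b≡0 | yes b≡d = contradiction (trans (sym b≡d) b≡0) (ℕ.≢-nonZero⁻¹ d)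
  ... | yes b≡0 | no  b≢d = trans (*ʳ (κ (blacks u)) (constant u (subst (d ∣_) (sym b≡0) (d ∣0)))) (sym (1*+0* (G u)))
    where
    1*+0* : ∀ a → 1ℤ * a + 0ℤ * a ≡ a
    1*+0* = solve-∀
  ... | no  b≢0 | yes b≡d = trans (*ʳ (κ (blacks u)) (constant u (subst (d ∣_) (sym b≡d) ∣-refl))) (sym (0*+1* (G u)))
    where
    0*+1* : ∀ a → 0ℤ * a + 1ℤ * a ≡ a
    0*+1* = solve-∀
  -- Now 0 < b < d, so d ∤ b and the average runs over a nontrivial coset.
  ... | no  b≢0 | no  b≢d = begin
    κ (blacks u) * (∑[ τ ∈ downFrom d ] ramanujan d (s ℕ.+ weight u ℕ.+ τ ℕ.* blacks u))
      ≡⟨ *ʳ (κ (blacks u)) (∑-ramanujan-shift d d (blacks u) (s ℕ.+ weight u) ∣-refl (λ d∣b →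
           b≢d (ℕₚ.≤-antisym (subst (blacks u ℕ.≤_) |u|≡d (blacks≤length u)) (∣⇒≤ {{ℕ.≢-nonZero b≢0}} d∣b)))) ⟩
    κ (blacks u) * 0ℤ
      ≡⟨ ℤₚ.*-zeroʳ (κ (blacks u)) ⟩
    0ℤ
      ≡⟨ 0*+0* (G u) ⟨
    0ℤ * G u + 0ℤ * G u ∎
    where
    0*+0* : ∀ a → 0ℤ * a + 0ℤ * a ≡ 0ℤ
    0*+0* = solve-∀

-- Only words whose aligned blocks of length d are monochromatic survive.
∑-words-ramanujan : ∀ d .{{_ : NonZero d}} → Odd d → ∀ m (κ : ℕ → ℤ) s →
                    ∑[ w ∈ words (m ℕ.* d) ] κ (blacks w) * ramanujan d (s ℕ.+ weight w)
                    ≡ ramanujan d s * (∑[ v ∈ words m ] κ (blacks v ℕ.* d))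
∑-words-ramanujan d odd zero    κ s = trans (ℤₚ.+-identityʳ (κ 0 * ramanujan d (s ℕ.+ 0)))
  (trans (ℤₚ.*-comm (κ 0) (ramanujan d (s ℕ.+ 0)))
  (cong₂ (λ a b → ramanujan d a * b) (ℕₚ.+-identityʳ s) (sym (ℤₚ.+-identityʳ (κ 0)))))
∑-words-ramanujan d odd (suc m) κ s = begin
  ∑[ w ∈ words (d ℕ.+ m ℕ.* d) ] κ (blacks w) * ramanujan d (s ℕ.+ weight w)
    ≡⟨ ∑-words-+ d (m ℕ.* d) _ ⟩
  ∑[ u ∈ words d ] (∑[ w ∈ words (m ℕ.* d) ] κ (blacks (u ++ w)) * ramanujan d (s ℕ.+ weight (u ++ w)))
    -- The cross term of `weight-++` is the number of black beads of u times the length m d of w, a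
    -- multiple of d; the weights of the blocks simply add modulo d.
    ≡⟨ ∑-cong (words d) (λ u → ∑-cong-∈ (words (m ℕ.* d)) (λ {w} w∈ → cong₂ (λ a b → κ a * b) (blacks-++ u w)
         (ramanujan-≡ d 0 (blacks u ℕ.* m) (concat u w (length-words (m ℕ.* d) w∈))))) ⟩
  ∑[ u ∈ words d ] (∑[ w ∈ words (m ℕ.* d) ] κ (blacks u ℕ.+ blacks w) * ramanujan d (s ℕ.+ weight u ℕ.+ weight w))
    -- The block u is absorbed into `κ` and `s`, which is why the induction needs both to be
    -- arbitrary.
    ≡⟨ ∑-cong (words d) (λ u → trans (∑-words-ramanujan d odd m (λ b → κ (blacks u ℕ.+ b)) (s ℕ.+ weight u))
         (ℤₚ.*-comm (ramanujan d (s ℕ.+ weight u)) (K (blacks u)))) ⟩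
  ∑[ u ∈ words d ] K (blacks u) * ramanujan d (s ℕ.+ weight u)
    ≡⟨ ∑-block d odd K s ⟩
  (K 0 + K d) * ramanujan d s
    ≡⟨ ℤₚ.*-comm (K 0 + K d) (ramanujan d s) ⟩
  ramanujan d s * (K 0 + K d)
    ≡⟨ *ʳ (ramanujan d s) (ℤₚ.+-comm (K 0) (K d)) ⟩
  ramanujan d s * (K d + K 0)
    ≡⟨ *ʳ (ramanujan d s) (∑-words-suc m (λ v → κ (blacks v ℕ.* d))) ⟨
  ramanujan d s * (∑[ v ∈ words (suc m) ] κ (blacks v ℕ.* d)) ∎
  where
  K : ℕ → ℤ
  K i = ∑[ v ∈ words m ] κ (i ℕ.+ blacks v ℕ.* d)
  shuffle : ∀ a b c e m d → a ℕ.+ (b ℕ.+ c ℕ.+ e ℕ.* (m ℕ.* d)) ℕ.+ 0 ≡ a ℕ.+ b ℕ.+ c ℕ.+ e ℕ.* m ℕ.* d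
  shuffle = ℕ-Solver.solve-∀
  concat : ∀ u w → length w ≡ m ℕ.* d →
           s ℕ.+ weight (u ++ w) ℕ.+ 0 ≡ s ℕ.+ weight u ℕ.+ weight w ℕ.+ blacks u ℕ.* m ℕ.* d
  concat u w eq = trans (cong (λ r → s ℕ.+ r ℕ.+ 0) (trans (weight-++ u w) (cong (λ r → weight u ℕ.+ weight w ℕ.+ blacks u ℕ.* r) eq)))
                        (shuffle s (weight u) (weight w) (blacks u) m d)

-- Necklaces

rotN-+ : ∀ s t w → rotN (s ℕ.+ t) w ≡ rotN s (rotN t w)
rotN-+ zero    t w = refl
rotN-+ (suc s) t w = cong rot (rotN-+ s t w)

rotN-rot : ∀ s w → rotN s (rot w) ≡ rot (rotN s w)
rotN-rot s w = trans (sym (rotN-+ s 1 w)) (cong (λ t → rotN t w) (ℕₚ.+-comm s 1))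

rotN-++ : ∀ u v → rotN (length u) (u ++ v) ≡ v ++ u
rotN-++ []      v = sym (Listₚ.++-identityʳ v)
rotN-++ (x ∷ u) v = begin
  rot (rotN (length u) (x ∷ u ++ v))     ≡⟨ rotN-rot (length u) (x ∷ u ++ v) ⟨
  rotN (length u) ((u ++ v) ++ x ∷ [])   ≡⟨ cong (rotN (length u)) (Listₚ.++-assoc u v _) ⟩
  rotN (length u) (u ++ v ++ x ∷ [])     ≡⟨ rotN-++ u (v ++ x ∷ []) ⟩
  (v ++ x ∷ []) ++ u                     ≡⟨ Listₚ.++-assoc v _ u ⟩
  v ++ x ∷ u                             ∎

rotN-length : ∀ w → rotN (length w) w ≡ w
rotN-length w = trans (cong (rotN (length w)) (sym (Listₚ.++-identityʳ w))) (rotN-++ w [])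

rotN-multiple : ∀ {w} s k → rotN s w ≡ w → rotN (k ℕ.* s) w ≡ w
rotN-multiple         s zero    h = refl
rotN-multiple {w} s (suc k) h = trans (rotN-+ s (k ℕ.* s) w) (trans (cong (rotN s) (rotN-multiple s k h)) h)

rotN-gcd : ∀ {w} a b → rotN a w ≡ w → rotN b w ≡ w → rotN (gcd a b) w ≡ w
rotN-gcd {w} a b ha hb with Bézout.identity (gcd-GCD a b)
... | Bézout.+- x y eq = begin
  rotN (gcd a b) w                       ≡⟨ cong (rotN (gcd a b)) (rotN-multiple b y hb) ⟨
  rotN (gcd a b) (rotN (y ℕ.* b) w)      ≡⟨ rotN-+ (gcd a b) (y ℕ.* b) w ⟨
  rotN (gcd a b ℕ.+ y ℕ.* b) w           ≡⟨ cong (λ s → rotN s w) eq ⟩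
  rotN (x ℕ.* a) w                       ≡⟨ rotN-multiple a x ha ⟩
  w                                      ∎
... | Bézout.-+ x y eq = begin
  rotN (gcd a b) w                       ≡⟨ cong (rotN (gcd a b)) (rotN-multiple a x ha) ⟨
  rotN (gcd a b) (rotN (x ℕ.* a) w)      ≡⟨ rotN-+ (gcd a b) (x ℕ.* a) w ⟨
  rotN (gcd a b ℕ.+ x ℕ.* a) w           ≡⟨ cong (λ s → rotN s w) eq ⟩
  rotN (y ℕ.* b) w                       ≡⟨ rotN-multiple b y hb ⟩
  w                                      ∎

rotN-∣ : ∀ {w s t} → s ∣ t → rotN s w ≡ w → rotN t w ≡ w
rotN-∣ {s = s} (divides k refl) = rotN-multiple s k

++-injective : ∀ (u u′ : List Bool) {v v′} → length u ≡ length u′ → u ++ v ≡ u′ ++ v′ → u ≡ u′ × v ≡ v′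
++-injective []      []        _  eq = refl , eq
++-injective (x ∷ u) (x′ ∷ u′) |≡| eq
  with ++-injective u u′ (ℕₚ.suc-injective |≡|) (Listₚ.∷-injectiveʳ eq)
... | u≡u′ , v≡v′ = cong₂ _∷_ (Listₚ.∷-injectiveˡ eq) u≡u′ , v≡v′

-- A word v of length k m with v ++ u = u ++ v begins with u, and what follows commutes with u
-- again. Hence v is the k-fold power of u and one term survives; `b` collects the black beads of
-- the copies already removed.
∑-words-commuting : ∀ m (u : List Bool) → length u ≡ m → ∀ k (κ : ℕ → ℤ) b →
  ∑[ v ∈ words (k ℕ.* m) ] ⟦ (v ++ u) ≟ʷ (u ++ v) ⟧ * κ (b ℕ.+ blacks v) ≡ κ (b ℕ.+ k ℕ.* blacks u)
∑-words-commuting m u |u|≡m zero    κ b =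
  trans (ℤₚ.+-identityʳ _) (trans (cong (λ r → r * κ (b ℕ.+ 0)) (⟦⟧-yes (u ≟ʷ (u ++ [])) (sym (Listₚ.++-identityʳ u))))
                                  (ℤₚ.*-identityˡ (κ (b ℕ.+ 0))))
∑-words-commuting m u |u|≡m (suc k) κ b = begin
  ∑[ v ∈ words (m ℕ.+ k ℕ.* m) ] ⟦ (v ++ u) ≟ʷ (u ++ v) ⟧ * κ (b ℕ.+ blacks v)
    ≡⟨ ∑-words-+ m (k ℕ.* m) _ ⟩
  ∑[ v ∈ words m ] (∑[ w ∈ words (k ℕ.* m) ] ⟦ ((v ++ w) ++ u) ≟ʷ (u ++ v ++ w) ⟧ * κ (b ℕ.+ blacks (v ++ w)))
    ≡⟨ ∑-cong-∈ (words m) (λ {v} v∈ → trans (∑-cong (words (k ℕ.* m)) (split v (length-words m v∈)))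
         (∑-*ˡ (words (k ℕ.* m)) ⟦ v ≟ʷ u ⟧ (term v))) ⟩
  ∑[ v ∈ words m ] ⟦ v ≟ʷ u ⟧ * (∑ₗ (words (k ℕ.* m)) (term v))
    ≡⟨ ∑-words-δ m u (λ v → ∑ₗ (words (k ℕ.* m)) (term v)) |u|≡m ⟩
  ∑[ w ∈ words (k ℕ.* m) ] ⟦ (w ++ u) ≟ʷ (u ++ w) ⟧ * κ (b ℕ.+ blacks u ℕ.+ blacks w)
    ≡⟨ ∑-words-commuting m u |u|≡m k κ (b ℕ.+ blacks u) ⟩
  κ (b ℕ.+ blacks u ℕ.+ k ℕ.* blacks u)
    ≡⟨ cong κ (ℕₚ.+-assoc b (blacks u) (k ℕ.* blacks u)) ⟩
  κ (b ℕ.+ suc k ℕ.* blacks u) ∎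
  where
  term : List Bool → List Bool → ℤ
  term v w = ⟦ (w ++ u) ≟ʷ (u ++ w) ⟧ * κ (b ℕ.+ blacks v ℕ.+ blacks w)
  split : ∀ v → length v ≡ m → ∀ w →
          ⟦ ((v ++ w) ++ u) ≟ʷ (u ++ v ++ w) ⟧ * κ (b ℕ.+ blacks (v ++ w)) ≡ ⟦ v ≟ʷ u ⟧ * term v w
  split v |v|≡m w = trans (cong₂ _*_
      (⟦⟧-× (v ≟ʷ u) ((w ++ u) ≟ʷ (u ++ w)) (((v ++ w) ++ u) ≟ʷ (u ++ v ++ w)) to from)
      (cong κ (trans (cong (b ℕ.+_) (blacks-++ v w)) (sym (ℕₚ.+-assoc b (blacks v) (blacks w))))))
    (ℤₚ.*-assoc ⟦ v ≟ʷ u ⟧ ⟦ (w ++ u) ≟ʷ (u ++ w) ⟧ _)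
    where
    to : (v ++ w) ++ u ≡ u ++ v ++ w → v ≡ u × w ++ u ≡ u ++ w
    to eq with ++-injective v u (trans |v|≡m (sym |u|≡m)) (trans (sym (Listₚ.++-assoc v w u)) eq)
    ... | refl , eq′ = refl , eq′
    from : v ≡ u → w ++ u ≡ u ++ w → (v ++ w) ++ u ≡ u ++ v ++ w
    from refl eq = trans (Listₚ.++-assoc v w u) (cong (v ++_) eq)

-- Cut w into u of length m and the rest v. Rotation by m exchanges the two pieces, so w is fixed
-- precisely when v commutes with u, that is, when w is the d-fold power of u.
∑-words-fixed : ∀ d .{{_ : NonZero d}} m (κ : ℕ → ℤ) →
                ∑[ w ∈ words (d ℕ.* m) ] κ (blacks w) * ⟦ rotN m w ≟ʷ w ⟧ ≡ ∑[ u ∈ words m ] κ (blacks u ℕ.* d)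
∑-words-fixed (suc k) m κ = begin
  ∑[ w ∈ words (m ℕ.+ k ℕ.* m) ] κ (blacks w) * ⟦ rotN m w ≟ʷ w ⟧
    ≡⟨ ∑-words-+ m (k ℕ.* m) _ ⟩
  ∑[ u ∈ words m ] (∑[ v ∈ words (k ℕ.* m) ] κ (blacks (u ++ v)) * ⟦ rotN m (u ++ v) ≟ʷ (u ++ v) ⟧)
    ≡⟨ ∑-cong-∈ (words m) (λ {u} u∈ → fixed u (length-words m u∈)) ⟩
  ∑[ u ∈ words m ] κ (blacks u ℕ.* suc k) ∎
  where
  fixed : ∀ u → length u ≡ m →
          ∑[ v ∈ words (k ℕ.* m) ] κ (blacks (u ++ v)) * ⟦ rotN m (u ++ v) ≟ʷ (u ++ v) ⟧ ≡ κ (blacks u ℕ.* suc k)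
  fixed u refl = begin
    ∑[ v ∈ words (k ℕ.* m) ] κ (blacks (u ++ v)) * ⟦ rotN m (u ++ v) ≟ʷ (u ++ v) ⟧
      ≡⟨ ∑-cong (words (k ℕ.* m)) (λ v → trans (ℤₚ.*-comm (κ (blacks (u ++ v))) _)
           (cong₂ (λ a b → ⟦ a ≟ʷ (u ++ v) ⟧ * κ b) (rotN-++ u v) (blacks-++ u v))) ⟩
    ∑[ v ∈ words (k ℕ.* m) ] ⟦ (v ++ u) ≟ʷ (u ++ v) ⟧ * κ (blacks u ℕ.+ blacks v)
      ≡⟨ ∑-words-commuting m u refl k κ (blacks u) ⟩
    κ (blacks u ℕ.+ k ℕ.* blacks u)
      ≡⟨ cong κ (ℕₚ.*-comm (suc k) (blacks u)) ⟩
    κ (blacks u ℕ.* suc k) ∎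

∑-allFin-suc : ∀ k (f : Fin (suc k) → ℤ) → ∑ₗ (allFin (suc k)) f ≡ f zero + ∑ₗ (allFin k) (f ∘ suc)
∑-allFin-suc k f = +ʳ (f zero) (trans (cong (λ is → ∑ₗ is f) (sym (Listₚ.map-tabulate id suc))) (∑-map suc (allFin k) f))

∑-allFin-δ : ∀ k (i : Fin k) (f : Fin k → ℤ) → (∀ j → j ≢ i → f j ≡ 0ℤ) → ∑ₗ (allFin k) f ≡ f i
∑-allFin-δ (suc k) zero    f h = begin
  ∑ₗ (allFin (suc k)) f              ≡⟨ ∑-allFin-suc k f ⟩
  f zero + ∑ₗ (allFin k) (f ∘ suc)   ≡⟨ +ʳ (f zero) (trans (∑-cong (allFin k) (λ j → h (suc j) λ ())) (∑-zero (allFin k))) ⟩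
  f zero + 0ℤ                        ≡⟨ ℤₚ.+-identityʳ (f zero) ⟩
  f zero                             ∎
∑-allFin-δ (suc k) (suc i) f h = begin
  ∑ₗ (allFin (suc k)) f              ≡⟨ ∑-allFin-suc k f ⟩
  f zero + ∑ₗ (allFin k) (f ∘ suc)   ≡⟨ cong₂ _+_ (h zero λ ()) (∑-allFin-δ k i (f ∘ suc) (λ j j≢i → h (suc j) λ { refl → j≢i refl })) ⟩
  0ℤ + f (suc i)                     ≡⟨ ℤₚ.+-identityˡ (f (suc i)) ⟩
  f (suc i)                          ∎

-- Both sides count pairs of a representative and a rotation s < q. Every pair yields one word, and
-- a word in the class of `g i₀` is reached as often as it is fixed, since the rotations taking
-- `g i₀` to it form a coset of its stabiliser. Orbit sizes and divisions are avoided.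
burnside : ∀ n q k → IsNecklaceCount n q k →
           + q * + k ≡ ∑[ s ∈ downFrom q ] (∑[ w ∈ words q ] ⟦ blacks w ℕ.≟ n ⟧ * ⟦ rotN s w ≟ʷ w ⟧)
burnside n q k (g , in-class , cover , distinct) = sym (begin
  ∑[ s ∈ downFrom q ] (∑[ w ∈ words q ] ⟦ blacks w ℕ.≟ n ⟧ * ⟦ rotN s w ≟ʷ w ⟧)
    ≡⟨ ∑-swap (downFrom q) (words q) _ ⟩
  ∑[ w ∈ words q ] (∑[ s ∈ downFrom q ] ⟦ blacks w ℕ.≟ n ⟧ * ⟦ rotN s w ≟ʷ w ⟧)
    ≡⟨ ∑-cong-∈ (words q) (λ {w} w∈ → hit w (length-words q w∈)) ⟩
  ∑[ w ∈ words q ] (∑[ i ∈ allFin k ] (∑[ s ∈ downFrom q ] ⟦ w ≟ʷ rotN s (g i) ⟧))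
    ≡⟨ ∑-swap (words q) (allFin k) _ ⟩
  ∑[ i ∈ allFin k ] (∑[ w ∈ words q ] (∑[ s ∈ downFrom q ] ⟦ w ≟ʷ rotN s (g i) ⟧))
    ≡⟨ ∑-cong (allFin k) (λ i → trans (∑-swap (words q) (downFrom q) (λ w s → ⟦ w ≟ʷ rotN s (g i) ⟧))
         (∑-cong (downFrom q) (λ s → one s i))) ⟩
  ∑[ i ∈ allFin k ] (∑[ s ∈ downFrom q ] 1ℤ)
    ≡⟨ ∑-const (allFin k) (∑[ s ∈ downFrom q ] 1ℤ) ⟩
  + length (allFin k) * (∑[ s ∈ downFrom q ] 1ℤ)
    ≡⟨ cong₂ (λ a b → + a * b) (Listₚ.length-tabulate {n = k} id) (trans (∑-const (downFrom q) 1ℤ)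
         (trans (ℤₚ.*-identityʳ (+ length (downFrom q))) (cong +_ (Listₚ.length-downFrom q)))) ⟩
  + k * + q
    ≡⟨ ℤₚ.*-comm (+ k) (+ q) ⟩
  + q * + k ∎)
  where
  one : ∀ s i → ∑[ w ∈ words q ] ⟦ w ≟ʷ rotN s (g i) ⟧ ≡ 1ℤ
  one s i = trans (∑-cong (words q) (λ w → sym (ℤₚ.*-identityʳ ⟦ w ≟ʷ rotN s (g i) ⟧)))
    (∑-words-δ q (rotN s (g i)) (λ _ → 1ℤ) (trans (length-rotN s (g i)) (proj₁ (in-class i))))
  hit : ∀ w → length w ≡ q → ∑[ s ∈ downFrom q ] ⟦ blacks w ℕ.≟ n ⟧ * ⟦ rotN s w ≟ʷ w ⟧
                           ≡ ∑[ i ∈ allFin k ] (∑[ s ∈ downFrom q ] ⟦ w ≟ʷ rotN s (g i) ⟧)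
  hit w |w|≡q with blacks w ℕ.≟ n
  ... | no b≢n = trans (trans (∑-*ˡ (downFrom q) 0ℤ (λ s → ⟦ rotN s w ≟ʷ w ⟧)) (ℤₚ.*-zeroˡ (∑[ s ∈ downFrom q ] ⟦ rotN s w ≟ʷ w ⟧)))
    (sym (trans (∑-cong (allFin k) (λ i → trans (∑-cong (downFrom q) (λ s → ⟦⟧-no (w ≟ʷ rotN s (g i)) λ h →
      b≢n (trans (cong blacks h) (trans (blacks-rotN s (g i)) (proj₂ (in-class i))))))
      (∑-zero (downFrom q)))) (∑-zero (allFin k))))
  ... | yes b≡n with cover w (|w|≡q , b≡n)
  ... | i₀ , s₀ , gi₀≡ = sym (begin
    ∑[ i ∈ allFin k ] (∑[ s ∈ downFrom q ] ⟦ w ≟ʷ rotN s (g i) ⟧)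
      ≡⟨ ∑-allFin-δ k i₀ _ (λ i i≢i₀ → trans (∑-cong (downFrom q) (λ s → ⟦⟧-no (w ≟ʷ rotN s (g i)) λ h →
           i≢i₀ (distinct i i₀ (s₀ ℕ.+ s , trans gi₀≡ (trans (cong (rotN s₀) h) (sym (rotN-+ s₀ s (g i))))))))
           (∑-zero (downFrom q))) ⟩
    ∑[ s ∈ downFrom q ] ⟦ w ≟ʷ rotN s (g i₀) ⟧
      ≡⟨ ∑-cong (downFrom q) (λ s → ⟦⟧-⇔ (w ≟ʷ rotN s (g i₀)) (rotN (s ℕ.+ s₀) w ≟ʷ w)
           (λ h → trans (trans (rotN-+ s s₀ w) (cong (rotN s) (sym gi₀≡))) (sym h))
           (λ h → sym (trans (cong (rotN s) gi₀≡) (trans (sym (rotN-+ s s₀ w)) h)))) ⟩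
    ∑[ s ∈ downFrom q ] ⟦ rotN (s ℕ.+ s₀) w ≟ʷ w ⟧
      -- The offset `s₀`, which leads from w back to its representative, disappears because rotation
      -- by q is the identity on w.
      ≡⟨ ∑-shift q (λ s → ⟦ rotN s w ≟ʷ w ⟧) (λ s → cong (λ v → ⟦ v ≟ʷ w ⟧) (trans (rotN-+ s q w)
           (cong (rotN s) (trans (cong (λ r → rotN r w) (sym |w|≡q)) (rotN-length w))))) s₀ ⟩
    ∑[ s ∈ downFrom q ] ⟦ rotN s w ≟ʷ w ⟧
      ≡⟨ ∑-cong (downFrom q) (λ s → ℤₚ.*-identityˡ ⟦ rotN s w ≟ʷ w ⟧) ⟨
    ∑[ s ∈ downFrom q ] 1ℤ * ⟦ rotN s w ≟ʷ w ⟧ ∎)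

necklaces-by-weight : ∀ n .{{_ : NonZero n}} q .{{_ : NonZero q}} k → Odd n → n ∣ q → IsNecklaceCount n q k →
  ∑[ w ∈ words q ] ⟦ blacks w ℕ.≟ n ⟧ * (+ n * ⟦ n ∣? weight w ⟧) ≡ + q * + k
necklaces-by-weight n q k odd n∣q isCount = begin
  ∑[ w ∈ words q ] ⟦ blacks w ℕ.≟ n ⟧ * (+ n * ⟦ n ∣? weight w ⟧)
    ≡⟨ ∑-cong (words q) (λ w → trans (*ʳ ⟦ blacks w ℕ.≟ n ⟧ (sym (∑-ramanujan n (∣⇒≤ n∣q) (weight w))))
         (sym (∑-*ˡ D ⟦ blacks w ℕ.≟ n ⟧ (λ d → ⟦ d ∣? n ⟧ * ramanujan d (weight w))))) ⟩
  ∑[ w ∈ words q ] (∑[ d ∈ D ] ⟦ blacks w ℕ.≟ n ⟧ * (⟦ d ∣? n ⟧ * ramanujan d (weight w)))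
    ≡⟨ ∑-swap (words q) D _ ⟩
  ∑[ d ∈ D ] (∑[ w ∈ words q ] ⟦ blacks w ℕ.≟ n ⟧ * (⟦ d ∣? n ⟧ * ramanujan d (weight w)))
    ≡⟨ ∑-cong D by-divisor ⟩
  ∑[ d ∈ D ] ⟦ d ∣? q ⟧ * (ramanujan d 0 * Ψ d)
    ≡⟨ ∑-gcd q Φ Ψ Ψ≡Φ ⟨
  ∑[ s ∈ downFrom q ] Φ (gcd s q)
    -- A rotation by s fixes the same words of length q as a rotation by gcd s q.
    ≡⟨ ∑-cong (downFrom q) (λ s → ∑-cong-∈ (words q) (λ {w} w∈ → *ʳ ⟦ blacks w ℕ.≟ n ⟧
         (⟦⟧-⇔ (rotN (gcd s q) w ≟ʷ w) (rotN s w ≟ʷ w) (rotN-∣ (gcd[m,n]∣m s q))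
           (λ h → rotN-gcd s q h (trans (cong (λ r → rotN r w) (sym (length-words q w∈))) (rotN-length w)))))) ⟩
  ∑[ s ∈ downFrom q ] Φ s
    ≡⟨ burnside n q k isCount ⟨
  + q * + k ∎
  where
  D = downFrom (suc q)
  -- The condition is multiplied out instead of using n / d: `V d m` is C(m, n/d) for d ∣ n and 0
  -- otherwise, so the divisors of q that do not divide n drop out of Burnside's sum.
  V : ℕ → ℕ → ℤ
  V d m = ∑[ u ∈ words m ] ⟦ blacks u ℕ.* d ℕ.≟ n ⟧
  Ψ : ℕ → ℤ
  Ψ zero      = 0ℤ
  Ψ d@(suc _) = V d (q ℕ./ d)
  Φ : ℕ → ℤ
  Φ m = ∑[ w ∈ words q ] ⟦ blacks w ℕ.≟ n ⟧ * ⟦ rotN m w ≟ʷ w ⟧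

  Ψ≡V : ∀ d m → d ℕ.* m ≡ q → Ψ d ≡ V d m
  Ψ≡V zero      m eq = contradiction (sym eq) (ℕ.≢-nonZero⁻¹ q)
  Ψ≡V d@(suc _) m eq = cong (V d) (trans (cong (ℕ._/ d) (trans (sym eq) (ℕₚ.*-comm d m))) (ℕ.m*n/n≡m m d))

  Ψ≡Φ : ∀ d m → d ℕ.* m ≡ q → Ψ d ≡ Φ m
  Ψ≡Φ zero      m eq = contradiction (sym eq) (ℕ.≢-nonZero⁻¹ q)
  Ψ≡Φ d@(suc _) m eq = trans (Ψ≡V d m eq) (trans (sym (∑-words-fixed d m (λ b → ⟦ b ℕ.≟ n ⟧)))
    (cong (λ r → ∑[ w ∈ words r ] ⟦ blacks w ℕ.≟ n ⟧ * ⟦ rotN m w ≟ʷ w ⟧) eq))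

  odd-divisor : ∀ {d} → d ∣ n → Odd d
  odd-divisor {d} (divides j n≡j*d) = odd-or-even d (proj₁ odd) (trans (sym (proj₂ odd)) n≡j*d)
    where
    halves : ∀ d → (∃ λ h → d ≡ 2 ℕ.* h) ⊎ Odd d
    halves zero = inj₁ (0 , refl)
    halves (suc d) with halves d
    ... | inj₁ (h , refl) = inj₂ (h , refl)
    ... | inj₂ (h , refl) = inj₁ (suc h , sym (ℕₚ.*-suc 2 h))
    odd-or-even : ∀ d h → suc (2 ℕ.* h) ≡ j ℕ.* d → Odd d
    odd-or-even d h eq with halves d
    ... | inj₂ o          = o
    ... | inj₁ (e , refl) = contradiction (trans (double j e) (sym eq)) (ℕₚ.even≢odd (j ℕ.* e) h)
      where
      double : ∀ j e → 2 ℕ.* (j ℕ.* e) ≡ j ℕ.* (2 ℕ.* e)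
      double = ℕ-Solver.solve-∀

  0-middle : ∀ a b → a * (0ℤ * b) ≡ 0ℤ
  0-middle = solve-∀

  by-divisor : ∀ d → ∑[ w ∈ words q ] ⟦ blacks w ℕ.≟ n ⟧ * (⟦ d ∣? n ⟧ * ramanujan d (weight w))
                   ≡ ⟦ d ∣? q ⟧ * (ramanujan d 0 * Ψ d)
  by-divisor d with d ∣? n | d ∣? q
  ... | yes d∣n | no d∤q = contradiction (∣-trans d∣n n∣q) d∤q
  ... | no d∤n | no _ = trans (∑-cong (words q) (λ w → 0-middle ⟦ blacks w ℕ.≟ n ⟧ (ramanujan d (weight w))))
      (trans (∑-zero (words q)) (sym (ℤₚ.*-zeroˡ (ramanujan d 0 * Ψ d))))
  ... | no d∤n | yes (divides m q≡m*d) = begin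
      ∑[ w ∈ words q ] ⟦ blacks w ℕ.≟ n ⟧ * (0ℤ * ramanujan d (weight w))
        ≡⟨ ∑-cong (words q) (λ w → 0-middle ⟦ blacks w ℕ.≟ n ⟧ (ramanujan d (weight w))) ⟩
      ∑ₗ (words q) (λ _ → 0ℤ)
        ≡⟨ ∑-zero (words q) ⟩
      0ℤ
        ≡⟨ 1*-*0 (ramanujan d 0) ⟨
      1ℤ * (ramanujan d 0 * 0ℤ)
        ≡⟨ cong (λ r → 1ℤ * (ramanujan d 0 * r)) (trans (Ψ≡V d m (trans (ℕₚ.*-comm d m) (sym q≡m*d)))
             (trans (∑-cong (words m) (λ u → ⟦⟧-no (blacks u ℕ.* d ℕ.≟ n) λ h → d∤n (divides (blacks u) (sym h))))
                    (∑-zero (words m)))) ⟨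
      1ℤ * (ramanujan d 0 * Ψ d) ∎
    where
    1*-*0 : ∀ a → 1ℤ * (a * 0ℤ) ≡ 0ℤ
    1*-*0 = solve-∀
  ... | yes d∣n | yes (divides m q≡m*d) = begin
      ∑[ w ∈ words q ] ⟦ blacks w ℕ.≟ n ⟧ * (1ℤ * ramanujan d (weight w))
        ≡⟨ ∑-cong (words q) (λ w → *ʳ ⟦ blacks w ℕ.≟ n ⟧ (ℤₚ.*-identityˡ (ramanujan d (weight w)))) ⟩
      ∑[ w ∈ words q ] ⟦ blacks w ℕ.≟ n ⟧ * ramanujan d (0 ℕ.+ weight w)
        ≡⟨ cong (λ r → ∑[ w ∈ words r ] ⟦ blacks w ℕ.≟ n ⟧ * ramanujan d (0 ℕ.+ weight w)) q≡m*d ⟩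
      ∑[ w ∈ words (m ℕ.* d) ] ⟦ blacks w ℕ.≟ n ⟧ * ramanujan d (0 ℕ.+ weight w)
        ≡⟨ ∑-words-ramanujan d {{d≢0}} (odd-divisor d∣n) m (λ b → ⟦ b ℕ.≟ n ⟧) 0 ⟩
      ramanujan d 0 * V d m
        ≡⟨ *ʳ (ramanujan d 0) (Ψ≡V d m (trans (ℕₚ.*-comm d m) (sym q≡m*d))) ⟨
      ramanujan d 0 * Ψ d
        ≡⟨ ℤₚ.*-identityˡ (ramanujan d 0 * Ψ d) ⟨
      1ℤ * (ramanujan d 0 * Ψ d) ∎
    where
    d≢0 : NonZero d
    d≢0 = ℕ.≢-nonZero λ { refl → ℕ.≢-nonZero⁻¹ n (0∣⇒≡0 d∣n) }

-- Injective tuples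

∏ : List X → (X → ℤ) → ℤ
∏ []       f = 1ℤ
∏ (x ∷ xs) f = f x * ∏ xs f

∏-cong-∈ : (xs : List X) {f g : X → ℤ} → (∀ {x} → x ∈ xs → f x ≡ g x) → ∏ xs f ≡ ∏ xs g
∏-cong-∈ []       h = refl
∏-cong-∈ (x ∷ xs) h = cong₂ _*_ (h (here refl)) (∏-cong-∈ xs (h ∘ there))

∏-++ : (xs ys : List X) (f : X → ℤ) → ∏ (xs ++ ys) f ≡ ∏ xs f * ∏ ys f
∏-++ []       ys f = sym (ℤₚ.*-identityˡ _)
∏-++ (x ∷ xs) ys f = trans (*ʳ (f x) (∏-++ xs ys f)) (sym (ℤₚ.*-assoc (f x) _ _))

∏-map : (g : X → Y) (xs : List X) (f : Y → ℤ) → ∏ (map g xs) f ≡ ∏ xs (f ∘ g)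
∏-map g []       f = refl
∏-map g (x ∷ xs) f = *ʳ (f (g x)) (∏-map g xs f)

∏-allFin-suc : ∀ k (f : Fin (suc k) → ℤ) → ∏ (allFin (suc k)) f ≡ f zero * ∏ (allFin k) (f ∘ suc)
∏-allFin-suc k f = *ʳ (f zero) (trans (cong (λ is → ∏ is f) (sym (Listₚ.map-tabulate id suc))) (∏-map suc (allFin k) f))

-- Expanding the product takes 1 or -δ x from each factor, and the sublist records where -δ x was
-- taken.
∑-subs : (xs : List X) (δ : X → ℤ) →
         ∑[ B ∈ subs xs ] (- 1ℤ) ^ length B * ∏ B δ ≡ ∏ xs (λ x → 1ℤ - δ x)
∑-subs []       δ = refl
∑-subs (x ∷ xs) δ = begin
  ∑ₗ (subs xs ++ map (x ∷_) (subs xs)) term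
    ≡⟨ ∑-++ (subs xs) _ term ⟩
  ∑ₗ (subs xs) term + ∑ₗ (map (x ∷_) (subs xs)) term
    ≡⟨ +ʳ (∑ₗ (subs xs) term) (∑-map (x ∷_) (subs xs) term) ⟩
  ∑ₗ (subs xs) term + (∑[ B ∈ subs xs ] (- 1ℤ) ^ suc (length B) * (δ x * ∏ B δ))
    ≡⟨ +ʳ (∑ₗ (subs xs) term) (trans (∑-cong (subs xs) (λ B → pull ((- 1ℤ) ^ length B) (δ x) (∏ B δ)))
                                     (∑-*ˡ (subs xs) (- δ x) term)) ⟩
  ∑ₗ (subs xs) term + - δ x * ∑ₗ (subs xs) term
    ≡⟨ factor (∑ₗ (subs xs) term) (δ x) ⟩
  (1ℤ - δ x) * ∑ₗ (subs xs) term
    ≡⟨ *ʳ (1ℤ - δ x) (∑-subs xs δ) ⟩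
  (1ℤ - δ x) * ∏ xs (λ x → 1ℤ - δ x) ∎
  where
  term = λ B → (- 1ℤ) ^ length B * ∏ B δ
  pull : ∀ a b c → - 1ℤ * a * (b * c) ≡ - b * (a * c)
  pull = solve-∀
  factor : ∀ a b → a + - b * a ≡ (1ℤ - b) * a
  factor = solve-∀

tuples : List ℕ → ∀ n → List (Fin n → ℕ)
tuples U zero    = Vec.[] ∷ []
tuples U (suc n) = concatMap (λ a → map (a Vec.∷_) (tuples U n)) U

∑-tuples-suc : ∀ U n (F : (Fin (suc n) → ℕ) → ℤ) →
               ∑ₗ (tuples U (suc n)) F ≡ ∑[ a ∈ U ] (∑[ x ∈ tuples U n ] F (a Vec.∷ x))
∑-tuples-suc U n F = trans (∑-concatMap (λ a → map (a Vec.∷_) (tuples U n)) U F)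
                           (∑-cong U (λ a → ∑-map (a Vec.∷_) (tuples U n) F))

tuples-All : ∀ {P : ℕ → Set} {U} n → All P U → All (λ x → ∀ i → P (x i)) (tuples U n)
tuples-All         zero    ps = (λ ()) ∷ []
tuples-All {P} {U} (suc n) ps = Allₚ.concat⁺ (Allₚ.map⁺ (All.map (λ p → Allₚ.map⁺ (All.map (cons p) (tuples-All n ps))) ps))
  where
  cons : ∀ {a x} → P a → (∀ i → P (x i)) → ∀ i → P ((a Vec.∷ x) i)
  cons p ps zero    = p
  cons p ps (suc i) = ps i

edges : ∀ n → List (Fin n × Fin n)
edges n = concatMap (λ i → concatMap (λ j → if toℕ i <ᵇ toℕ j then (i , j) ∷ [] else []) (allFin n)) (allFin n)

concatMap-singleton : (f : X → Y) (xs : List X) → concatMap (λ x → f x ∷ []) xs ≡ map f xs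
concatMap-singleton f []       = refl
concatMap-singleton f (x ∷ xs) = cong (f x ∷_) (concatMap-singleton f xs)

edges-suc : ∀ n → edges (suc n) ≡ map (λ j → zero , suc j) (allFin n) ++ map (Product.map suc suc) (edges n)
edges-suc n = cong₂ _++_ row₀ rows
  where
  row : ∀ m → Fin m → List (Fin m × Fin m)
  row m i = concatMap (λ j → if toℕ i <ᵇ toℕ j then (i , j) ∷ [] else []) (allFin m)
  skip : ∀ m (f : Fin (suc m) → List Y) → concatMap f (tabulate suc) ≡ concatMap (f ∘ suc) (allFin m)
  skip m f = trans (cong (concatMap f) (sym (Listₚ.map-tabulate id suc))) (Listₚ.concatMap-map f suc (allFin m))
  row₀ : row (suc n) zero ≡ map (λ j → zero , suc j) (allFin n)
  row₀ = trans (skip n _) (concatMap-singleton (λ j → zero , suc j) (allFin n))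
  push : ∀ (i j : Fin n) → (if toℕ i <ᵇ toℕ j then (Fin.suc i , Fin.suc j) ∷ [] else [])
                          ≡ map (Product.map suc suc) (if toℕ i <ᵇ toℕ j then (i , j) ∷ [] else [])
  push i j with toℕ i <ᵇ toℕ j
  ... | true  = refl
  ... | false = refl
  rows : concatMap (row (suc n)) (tabulate suc) ≡ map (Product.map suc suc) (edges n)
  rows = begin
    concatMap (row (suc n)) (tabulate suc)
      ≡⟨ skip n (row (suc n)) ⟩
    concatMap (row (suc n) ∘ suc) (allFin n)
      ≡⟨ Listₚ.concatMap-cong (λ i → trans (skip n _) (trans (Listₚ.concatMap-cong (push i) (allFin n))
           (sym (Listₚ.map-concatMap (Product.map suc suc) _ (allFin n))))) (allFin n) ⟩
    concatMap (map (Product.map suc suc) ∘ row n) (allFin n)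
      ≡⟨ Listₚ.map-concatMap (Product.map suc suc) (row n) (allFin n) ⟨
    map (Product.map suc suc) (edges n) ∎

A≡roots : ∀ n → A n ≡ map (uncurry root) (edges n)
A≡roots n = sym (trans (Listₚ.map-concatMap (uncurry root) _ (allFin n)) (Listₚ.concatMap-cong (λ i →
    trans (Listₚ.map-concatMap (uncurry root) _ (allFin n)) (Listₚ.concatMap-cong (push i) (allFin n))) (allFin n)))
  where
  push : ∀ i j → map (uncurry root) (if toℕ i <ᵇ toℕ j then (i , j) ∷ [] else [])
               ≡ (if toℕ i <ᵇ toℕ j then root i j ∷ [] else [])
  push i j with toℕ i <ᵇ toℕ j
  ... | true  = refl
  ... | false = refl

-- The indicator of injective x, written as a product over the edges of the complete graph so that
-- `∑-subs` expands it over subgraphs.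
injectivity : ∀ n → (Fin n → ℕ) → ℤ
injectivity n x = ∏ (edges n) (λ (i , j) → 1ℤ - ⟦ x i ℕ.≟ x j ⟧)

avoids : ∀ n → ℕ → (Fin n → ℕ) → ℤ
avoids n a x = ∏ (allFin n) (λ j → 1ℤ - ⟦ a ℕ.≟ x j ⟧)

injectivity-∷ : ∀ n a x → injectivity (suc n) (a Vec.∷ x) ≡ avoids n a x * injectivity n x
injectivity-∷ n a x = trans (cong (λ E → ∏ E δ) (edges-suc n))
  (trans (∏-++ (map (λ j → zero , suc j) (allFin n)) _ δ) (cong₂ _*_ (∏-map _ (allFin n) δ) (∏-map _ (edges n) δ)))
  where
  δ : Fin (suc n) × Fin (suc n) → ℤ
  δ (i , j) = 1ℤ - ⟦ (a Vec.∷ x) i ℕ.≟ (a Vec.∷ x) j ⟧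

infixl 6 _∖_
_∖_ : List ℕ → ℕ → List ℕ
U ∖ a = filter (λ b → ¬? (a ℕ.≟ b)) U

∑-∖ : ∀ U a (H : ℕ → ℤ) → ∑[ b ∈ U ] (1ℤ - ⟦ a ℕ.≟ b ⟧) * H b ≡ ∑ₗ (U ∖ a) H
∑-∖ []      a H = refl
∑-∖ (b ∷ U) a H = by-cases (a ℕ.≟ b) refl
  where
  by-cases : (a≟b : Dec (a ≡ b)) → a≟b ≡ (a ℕ.≟ b) →
             (1ℤ - ⟦ a ℕ.≟ b ⟧) * H b + (∑[ b ∈ U ] (1ℤ - ⟦ a ℕ.≟ b ⟧) * H b) ≡ ∑ₗ ((b ∷ U) ∖ a) H
  by-cases (yes a≡b) eq = trans
    (cong₂ (λ t r → (1ℤ - ⟦ t ⟧) * H b + r) (sym eq) (∑-∖ U a H))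
    (trans (cong (λ r → r + ∑ₗ (U ∖ a) H) (ℤₚ.*-zeroˡ (H b))) (trans (ℤₚ.+-identityˡ (∑ₗ (U ∖ a) H))
      (cong (λ V → ∑ₗ V H) (sym (Listₚ.filter-reject (λ b → ¬? (a ℕ.≟ b)) (λ h → h a≡b))))))
  by-cases (no a≢b) eq = trans
    (cong₂ (λ t r → (1ℤ - ⟦ t ⟧) * H b + r) (sym eq) (∑-∖ U a H))
    (trans (cong (λ r → r + ∑ₗ (U ∖ a) H) (ℤₚ.*-identityˡ (H b)))
      (cong (λ V → ∑ₗ V H) (sym (Listₚ.filter-accept (λ b → ¬? (a ℕ.≟ b)) a≢b))))

-- Removes the first entry of an injective tuple from the alphabet of the others, so that distinct
-- entries can be counted by recursion on n.
∑-avoids : ∀ U a n (G : (Fin n → ℕ) → ℤ) → ∑[ x ∈ tuples U n ] avoids n a x * G x ≡ ∑ₗ (tuples (U ∖ a) n) G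
∑-avoids U a zero    G = cong (λ r → r + 0ℤ) (ℤₚ.*-identityˡ (G Vec.[]))
∑-avoids U a (suc n) G = begin
  ∑[ x ∈ tuples U (suc n) ] avoids (suc n) a x * G x
    ≡⟨ ∑-tuples-suc U n (λ x → avoids (suc n) a x * G x) ⟩
  ∑[ b ∈ U ] (∑[ x ∈ tuples U n ] avoids (suc n) a (b Vec.∷ x) * G (b Vec.∷ x))
    ≡⟨ ∑-cong U (λ b → trans (∑-cong (tuples U n) (λ x → trans
         (cong (λ r → r * G (b Vec.∷ x)) (∏-allFin-suc n (λ j → 1ℤ - ⟦ a ℕ.≟ (b Vec.∷ x) j ⟧)))
         (ℤₚ.*-assoc (1ℤ - ⟦ a ℕ.≟ b ⟧) (avoids n a x) (G (b Vec.∷ x)))))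
         (trans (∑-*ˡ (tuples U n) (1ℤ - ⟦ a ℕ.≟ b ⟧) (λ x → avoids n a x * G (b Vec.∷ x)))
                (*ʳ (1ℤ - ⟦ a ℕ.≟ b ⟧) (∑-avoids U a n (λ x → G (b Vec.∷ x)))))) ⟩
  ∑[ b ∈ U ] (1ℤ - ⟦ a ℕ.≟ b ⟧) * (∑[ x ∈ tuples (U ∖ a) n ] G (b Vec.∷ x))
    ≡⟨ ∑-∖ U a (λ b → ∑[ x ∈ tuples (U ∖ a) n ] G (b Vec.∷ x)) ⟩
  ∑[ b ∈ U ∖ a ] (∑[ x ∈ tuples (U ∖ a) n ] G (b Vec.∷ x))
    ≡⟨ ∑-tuples-suc (U ∖ a) n G ⟨
  ∑ₗ (tuples (U ∖ a) (suc n)) G ∎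

-- The sum of f (∑ S) over the n-element subsets S of U.
∑-subsets : ℕ → List ℕ → (ℕ → ℤ) → ℤ
∑-subsets zero    U       f = f 0
∑-subsets (suc n) []      f = 0ℤ
∑-subsets (suc n) (u ∷ U) f = ∑-subsets (suc n) U f + ∑-subsets n U (λ s → f (u ℕ.+ s))

∑-subsets-cong : ∀ n U {f g : ℕ → ℤ} → (∀ s → f s ≡ g s) → ∑-subsets n U f ≡ ∑-subsets n U g
∑-subsets-cong zero    U       h = h 0
∑-subsets-cong (suc n) []      h = refl
∑-subsets-cong (suc n) (u ∷ U) h = cong₂ _+_ (∑-subsets-cong (suc n) U h) (∑-subsets-cong n U (λ s → h (u ℕ.+ s)))

∖-head : ∀ u {U} → All (u ≢_) U → (u ∷ U) ∖ u ≡ U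
∖-head u {U} u∉U = trans (Listₚ.filter-reject (λ b → ¬? (u ℕ.≟ b)) (λ h → h refl)) (Listₚ.filter-all (λ b → ¬? (u ℕ.≟ b)) u∉U)

-- Choosing an element and then n others produces each (n + 1)-element subset once for every choice
-- of its distinguished element. Iterated, this yields the factor n!.
∑-subsets-∖ : ∀ n U → Unique U → ∀ f →
              ∑[ a ∈ U ] ∑-subsets n (U ∖ a) (λ s → f (a ℕ.+ s)) ≡ + suc n * ∑-subsets (suc n) U f
∑-subsets-∖ n       []      _  f = sym (ℤₚ.*-zeroʳ (+ suc n))
∑-subsets-∖ zero    (u ∷ U) (_ ∷ uniq) f =
  trans (+ʳ (f (u ℕ.+ 0)) (trans (∑-subsets-∖ 0 U uniq f) (ℤₚ.*-identityˡ (∑-subsets 1 U f))))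
    (trans (ℤₚ.+-comm (f (u ℕ.+ 0)) (∑-subsets 1 U f)) (sym (ℤₚ.*-identityˡ (∑-subsets 1 (u ∷ U) f))))
∑-subsets-∖ (suc n) (u ∷ U) (u∉U ∷ uniq) f = begin
  ∑-subsets (suc n) ((u ∷ U) ∖ u) (f ∘ (u ℕ.+_)) + (∑[ a ∈ U ] ∑-subsets (suc n) ((u ∷ U) ∖ a) (f ∘ (a ℕ.+_)))
    ≡⟨ cong₂ (λ V r → ∑-subsets (suc n) V (f ∘ (u ℕ.+_)) + r) (∖-head u u∉U) (∑-cong-∈ U (λ {a} a∈ → trans
         (cong (λ V → ∑-subsets (suc n) V (f ∘ (a ℕ.+_)))
               (Listₚ.filter-accept (λ b → ¬? (a ℕ.≟ b)) (λ a≡u → All.lookup u∉U a∈ (sym a≡u))))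
         (+ʳ (∑-subsets (suc n) (U ∖ a) (f ∘ (a ℕ.+_))) (∑-subsets-cong n (U ∖ a) (λ s → cong f (swapˡ a u s)))))) ⟩
  ∑-subsets (suc n) U f′ + (∑[ a ∈ U ] (∑-subsets (suc n) (U ∖ a) (f ∘ (a ℕ.+_)) + ∑-subsets n (U ∖ a) (f′ ∘ (a ℕ.+_))))
    ≡⟨ +ʳ (∑-subsets (suc n) U f′) (trans (∑-+ U _ _) (cong₂ _+_ (∑-subsets-∖ (suc n) U uniq f) (∑-subsets-∖ n U uniq f′))) ⟩
  ∑-subsets (suc n) U f′ + (+ suc (suc n) * ∑-subsets (suc (suc n)) U f + + suc n * ∑-subsets (suc n) U f′)
    ≡⟨ collect (∑-subsets (suc n) U f′) (∑-subsets (suc (suc n)) U f) (+ suc n) ⟩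
  + suc (suc n) * (∑-subsets (suc (suc n)) U f + ∑-subsets (suc n) U f′) ∎
  where
  f′ : ℕ → ℤ
  f′ s = f (u ℕ.+ s)
  swapˡ : ∀ a b c → a ℕ.+ (b ℕ.+ c) ≡ b ℕ.+ (a ℕ.+ c)
  swapˡ = ℕ-Solver.solve-∀
  collect : ∀ a b c → a + ((1ℤ + c) * b + c * a) ≡ (1ℤ + c) * (b + a)
  collect = solve-∀

∑-injective-tuples : ∀ n U → Unique U → ∀ f →
                     ∑[ x ∈ tuples U n ] injectivity n x * f (sum x) ≡ + (n !) * ∑-subsets n U f
∑-injective-tuples zero    U uniq f = ℤₚ.+-identityʳ _
∑-injective-tuples (suc n) U uniq f = begin
  ∑[ x ∈ tuples U (suc n) ] injectivity (suc n) x * f (sum x)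
    ≡⟨ ∑-tuples-suc U n (λ x → injectivity (suc n) x * f (sum x)) ⟩
  ∑[ a ∈ U ] (∑[ x ∈ tuples U n ] injectivity (suc n) (a Vec.∷ x) * f (a ℕ.+ sum x))
    ≡⟨ ∑-cong U (λ a → trans (∑-cong (tuples U n) (λ x → trans (cong (λ r → r * f (a ℕ.+ sum x)) (injectivity-∷ n a x))
         (ℤₚ.*-assoc (avoids n a x) (injectivity n x) (f (a ℕ.+ sum x)))))
         (∑-avoids U a n (λ x → injectivity n x * f (a ℕ.+ sum x)))) ⟩
  ∑[ a ∈ U ] (∑[ x ∈ tuples (U ∖ a) n ] injectivity n x * f (a ℕ.+ sum x))
    ≡⟨ ∑-cong U (λ a → ∑-injective-tuples n (U ∖ a) (Uniqueₚ.filter⁺ _ uniq) (λ s → f (a ℕ.+ s))) ⟩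
  ∑[ a ∈ U ] + (n !) * ∑-subsets n (U ∖ a) (λ s → f (a ℕ.+ s))
    ≡⟨ ∑-*ˡ U (+ (n !)) (λ a → ∑-subsets n (U ∖ a) (λ s → f (a ℕ.+ s))) ⟩
  + (n !) * (∑[ a ∈ U ] ∑-subsets n (U ∖ a) (λ s → f (a ℕ.+ s)))
    ≡⟨ *ʳ (+ (n !)) (∑-subsets-∖ n U uniq f) ⟩
  + (n !) * (+ suc n * ∑-subsets (suc n) U f)
    ≡⟨ ℤₚ.*-assoc (+ (n !)) (+ suc n) _ ⟨
  + (n !) * + suc n * ∑-subsets (suc n) U f
    ≡⟨ cong (λ r → r * ∑-subsets (suc n) U f) (trans (ℤₚ.*-comm (+ (n !)) (+ suc n)) (sym (ℤₚ.pos-* (suc n) (n !)))) ⟩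
  + (suc n !) * ∑-subsets (suc n) U f ∎

-- A word is the indicator of its set of black positions. Counting from the right gives the leading
-- bead of a word of length q + 1 the position q, the head of `downFrom (suc q)`, so both recursions
-- peel off the same element.
∑-words-subsets : ∀ n q f → ∑[ w ∈ words q ] ⟦ blacks w ℕ.≟ n ⟧ * f (weight w) ≡ ∑-subsets n (downFrom q) f
∑-words-subsets zero    zero    f = trans (ℤₚ.+-identityʳ _) (ℤₚ.*-identityˡ (f 0))
∑-words-subsets (suc n) zero    f = trans (ℤₚ.+-identityʳ _) (ℤₚ.*-zeroˡ (f 0))
∑-words-subsets zero    (suc q) f = begin
  ∑[ w ∈ words (suc q) ] ⟦ blacks w ℕ.≟ 0 ⟧ * f (weight w)
    ≡⟨ ∑-words-white (suc q) (f ∘ weight) ⟩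
  f (weight (replicate (suc q) false))
    ≡⟨ cong f (weight-white (suc q)) ⟩
  f 0 ∎
∑-words-subsets (suc n) (suc q) f = begin
  ∑[ w ∈ words (suc q) ] ⟦ blacks w ℕ.≟ suc n ⟧ * f (weight w)
    ≡⟨ ∑-words-suc q (λ w → ⟦ blacks w ℕ.≟ suc n ⟧ * f (weight w)) ⟩
  (∑[ w ∈ words q ] ⟦ suc (blacks w) ℕ.≟ suc n ⟧ * f (length w ℕ.+ weight w)) +
  (∑[ w ∈ words q ] ⟦ blacks w ℕ.≟ suc n ⟧ * f (weight w))
    ≡⟨ cong₂ _+_ (trans (∑-cong-∈ (words q) (λ {w} w∈ → cong₂ (λ a b → a * f (b ℕ.+ weight w))
                   (⟦⟧-⇔ (suc (blacks w) ℕ.≟ suc n) (blacks w ℕ.≟ n) ℕₚ.suc-injective (cong suc)) (length-words q w∈)))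
                   (∑-words-subsets n q (λ s → f (q ℕ.+ s))))
                 (∑-words-subsets (suc n) q f) ⟩
  ∑-subsets n (downFrom q) (λ s → f (q ℕ.+ s)) + ∑-subsets (suc n) (downFrom q) f
    ≡⟨ ℤₚ.+-comm (∑-subsets n (downFrom q) (λ s → f (q ℕ.+ s))) _ ⟩
  ∑-subsets (suc n) (downFrom (suc q)) f ∎

-- Colourings constant on the components of a graph

_⊕_ : (Fin n → ℕ) → (Fin n → ℕ) → (Fin n → ℕ)
(x ⊕ t) i = x i ℕ.+ t i

module _ (Q : ℕ) .{{_ : NonZero Q}} where

  infix 4 _≡ₘ_
  _≡ₘ_ : ℕ → ℕ → Set
  a ≡ₘ b = a ℕ.% Q ≡ b ℕ.% Q

  +-≡ₘ : ∀ {a b c d} → a ≡ₘ b → c ≡ₘ d → a ℕ.+ c ≡ₘ b ℕ.+ d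
  +-≡ₘ {a} {b} {c} {d} p q = trans (ℕ.%-distribˡ-+ a c Q)
    (trans (cong₂ (λ u v → (u ℕ.+ v) ℕ.% Q) p q) (sym (ℕ.%-distribˡ-+ b d Q)))

  +-cancel-≡ₘ : ∀ {a b} τ → a ℕ.+ τ ≡ₘ b ℕ.+ τ → a ≡ₘ b
  +-cancel-≡ₘ {a} {b} τ h = trans (sym (drop a)) (trans (+-≡ₘ {a ℕ.+ τ} {b ℕ.+ τ} h refl) (drop b))
    where
    expand : ∀ a τ p → a ℕ.+ τ ℕ.+ τ ℕ.* p ≡ a ℕ.+ τ ℕ.* suc p
    expand = ℕ-Solver.solve-∀
    drop : ∀ a → a ℕ.+ τ ℕ.+ τ ℕ.* ℕ.pred Q ≡ₘ a
    drop a = trans (cong (ℕ._% Q) (trans (expand a τ (ℕ.pred Q)) (cong (λ r → a ℕ.+ τ ℕ.* r) (ℕₚ.suc-pred Q))))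
                   (ℕ.[m+kn]%n≡m%n a τ Q)

  ∑-≡ₘ : ∀ a b → ∑[ τ ∈ downFrom Q ] ⟦ (a ℕ.+ τ) ℕ.% Q ℕ.≟ b ℕ.% Q ⟧ ≡ 1ℤ
  ∑-≡ₘ a b = trans (∑-cong (downFrom Q) (λ τ → ⟦⟧-⇔ ((a ℕ.+ τ) ℕ.% Q ℕ.≟ b ℕ.% Q) (Q ∣? (τ ℕ.+ (a ℕ.+ b ℕ.* ℕ.pred Q))) (to τ) (from τ)))
                   (∑-residue Q (a ℕ.+ b ℕ.* ℕ.pred Q))
    where
    -- A natural number congruent to -b modulo Q.
    c = b ℕ.* ℕ.pred Q
    shuffle : ∀ τ a c → a ℕ.+ τ ℕ.+ c ≡ τ ℕ.+ (a ℕ.+ c)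
    shuffle = ℕ-Solver.solve-∀
    b+c : b ℕ.+ c ≡ b ℕ.* Q
    b+c = trans (sym (ℕₚ.*-suc b (ℕ.pred Q))) (cong (b ℕ.*_) (ℕₚ.suc-pred Q))
    b+c% : (b ℕ.+ c) ℕ.% Q ≡ 0
    b+c% = trans (cong (ℕ._% Q) b+c) (ℕ.m*n%n≡0 b Q)
    to : ∀ τ → a ℕ.+ τ ≡ₘ b → Q ∣ τ ℕ.+ (a ℕ.+ c)
    to τ h = m%n≡0⇒n∣m _ Q (trans (cong (ℕ._% Q) (sym (shuffle τ a c))) (trans (+-≡ₘ {a ℕ.+ τ} {b} h refl) b+c%))
    from : ∀ τ → Q ∣ τ ℕ.+ (a ℕ.+ c) → a ℕ.+ τ ≡ₘ b
    from τ h = +-cancel-≡ₘ c (trans (cong (ℕ._% Q) (shuffle τ a c)) (trans (n∣m⇒m%n≡0 _ Q h) (sym b+c%)))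

  Periodic : ((Fin n → ℕ) → ℤ) → Set
  Periodic F = ∀ x y → (∀ i → x i ≡ₘ y i) → F x ≡ F y

  colourings : ∀ n → List (Fin n → ℕ)
  colourings = tuples (downFrom Q)

  -- A translated colouring may leave the range of representatives below Q, so F has to depend on
  -- residues only; then each coordinate is a shift over a full period.
  ∑-colourings-shift : ∀ (t : Fin n → ℕ) F → Periodic F → ∑[ x ∈ colourings n ] F (x ⊕ t) ≡ ∑ₗ (colourings n) F
  ∑-colourings-shift {zero}  t F per = cong (λ r → r + 0ℤ) (per _ _ (λ ()))
  ∑-colourings-shift {suc n} t F per = begin
    ∑[ x ∈ colourings (suc n) ] F (x ⊕ t)
      ≡⟨ ∑-tuples-suc (downFrom Q) n (λ x → F (x ⊕ t)) ⟩
    ∑[ a ∈ downFrom Q ] (∑[ x ∈ colourings n ] F ((a Vec.∷ x) ⊕ t))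
      ≡⟨ ∑-cong (downFrom Q) (λ a → ∑-cong (colourings n) (λ x → per ((a Vec.∷ x) ⊕ t) ((a ℕ.+ t zero) Vec.∷ (x ⊕ (t ∘ suc)))
           λ { zero → refl ; (suc i) → refl })) ⟩
    ∑[ a ∈ downFrom Q ] (∑[ x ∈ colourings n ] F ((a ℕ.+ t zero) Vec.∷ (x ⊕ (t ∘ suc))))
      ≡⟨ ∑-cong (downFrom Q) (λ a → ∑-colourings-shift (t ∘ suc) (λ x → F ((a ℕ.+ t zero) Vec.∷ x))
           (λ x y h → per _ _ λ { zero → refl ; (suc i) → h i })) ⟩
    ∑[ a ∈ downFrom Q ] (∑[ x ∈ colourings n ] F ((a ℕ.+ t zero) Vec.∷ x))
      ≡⟨ ∑-shift Q (λ a → ∑[ x ∈ colourings n ] F (a Vec.∷ x))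
           (λ a → ∑-cong (colourings n) (λ x → per _ _ λ { zero → ℕ.[m+n]%n≡m%n a Q ; (suc i) → refl })) (t zero) ⟩
    ∑[ a ∈ downFrom Q ] (∑[ x ∈ colourings n ] F (a Vec.∷ x))
      ≡⟨ ∑-tuples-suc (downFrom Q) n F ⟨
    ∑ₗ (colourings (suc n)) F ∎

  residue : (Fin n → ℕ) → Fin n → ℕ
  residue x i = x i ℕ.% Q

  constant? : ∀ (E : List (Edge n)) (x : Fin n → ℕ) → Dec (Constant (residue x) E)
  constant? E x = All.all? (λ (i , j) → residue x i ℕ.≟ residue x j) E

  constant-⊕ : ∀ (E : List (Edge n)) t → Constant t E → ∀ x → ⟦ constant? E (x ⊕ t) ⟧ ≡ ⟦ constant? E x ⟧
  constant-⊕ E t ht x = ⟦⟧-⇔ (constant? E (x ⊕ t)) (constant? E x)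
    (λ h → All.zipWith (λ { {i , j} (p , q) → +-cancel-≡ₘ (t i) (trans p (cong (λ r → (x j ℕ.+ r) ℕ.% Q) (sym q))) }) (h , ht))
    (λ h → All.zipWith (λ { {i , j} (p , q) → +-≡ₘ {x i} {x j} p (cong (ℕ._% Q) q) }) (h , ht))

  constant-periodic : ∀ (E : List (Edge n)) → Periodic (λ x → ⟦ constant? E x ⟧)
  constant-periodic E x y h = ⟦⟧-⇔ (constant? E x) (constant? E y)
    (All.map (λ { {i , j} p → trans (sym (h i)) (trans p (h j)) }))
    (All.map (λ { {i , j} p → trans (h i) (trans p (sym (h j))) }))

  -- This is Q to the number of components of E, and it stands in for that number: `rank-count`
  -- links it directly to the rank.
  count : List (Edge n) → ℤ
  count {n} E = ∑[ x ∈ colourings n ] ⟦ constant? E x ⟧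

  -- The translates by τ t sweep out every value of x i - w x exactly once.
  count-sweep : ∀ (E : List (Edge n)) t → Constant t E → ∀ i → t i ≡ 1 → (w : (Fin n → ℕ) → ℕ) →
                (∀ τ x → w (x ⊕ (λ l → τ ℕ.* t l)) ≡ w x) → (∀ x y → (∀ l → x l ≡ₘ y l) → w x ≡ₘ w y) →
                count E ≡ + Q * (∑[ x ∈ colourings n ] ⟦ constant? E x ⟧ * ⟦ x i ℕ.% Q ℕ.≟ w x ℕ.% Q ⟧)
  count-sweep {n} E t ht i ti≡1 w w-inv w-per = begin
    ∑[ x ∈ colourings n ] ⟦ constant? E x ⟧
      ≡⟨ ∑-cong (colourings n) (λ x → trans (sym (ℤₚ.*-identityʳ ⟦ constant? E x ⟧))
           (trans (*ʳ ⟦ constant? E x ⟧ (sym (∑-≡ₘ (x i) (w x)))) (sym (∑-*ˡ (downFrom Q) ⟦ constant? E x ⟧ _)))) ⟩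
    ∑[ x ∈ colourings n ] (∑[ τ ∈ downFrom Q ] ⟦ constant? E x ⟧ * ⟦ (x i ℕ.+ τ) ℕ.% Q ℕ.≟ w x ℕ.% Q ⟧)
      ≡⟨ ∑-swap (colourings n) (downFrom Q) _ ⟩
    ∑[ τ ∈ downFrom Q ] (∑[ x ∈ colourings n ] ⟦ constant? E x ⟧ * ⟦ (x i ℕ.+ τ) ℕ.% Q ℕ.≟ w x ℕ.% Q ⟧)
      ≡⟨ ∑-cong (downFrom Q) (λ τ → ∑-cong (colourings n) (shifted τ)) ⟨
    ∑[ τ ∈ downFrom Q ] (∑[ x ∈ colourings n ] F (x ⊕ (λ l → τ ℕ.* t l)))
      ≡⟨ ∑-cong (downFrom Q) (λ τ → ∑-colourings-shift (λ l → τ ℕ.* t l) F F-periodic) ⟩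
    ∑[ τ ∈ downFrom Q ] (∑ₗ (colourings n) F)
      ≡⟨ ∑-const (downFrom Q) _ ⟩
    + length (downFrom Q) * ∑ₗ (colourings n) F
      ≡⟨ cong (λ r → + r * ∑ₗ (colourings n) F) (Listₚ.length-downFrom Q) ⟩
    + Q * ∑ₗ (colourings n) F ∎
    where
    F : (Fin n → ℕ) → ℤ
    F x = ⟦ constant? E x ⟧ * ⟦ x i ℕ.% Q ℕ.≟ w x ℕ.% Q ⟧
    F-periodic : Periodic F
    F-periodic x y h = cong₂ _*_ (constant-periodic E x y h)
      (⟦⟧-⇔ (x i ℕ.% Q ℕ.≟ w x ℕ.% Q) (y i ℕ.% Q ℕ.≟ w y ℕ.% Q)
        (λ p → trans (sym (h i)) (trans p (w-per x y h))) (λ p → trans (h i) (trans p (sym (w-per x y h)))))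
    shifted : ∀ τ x → F (x ⊕ (λ l → τ ℕ.* t l)) ≡ ⟦ constant? E x ⟧ * ⟦ (x i ℕ.+ τ) ℕ.% Q ℕ.≟ w x ℕ.% Q ⟧
    shifted τ x = cong₂ _*_ (constant-⊕ E _ (All.map (cong (τ ℕ.*_)) ht) x)
      (cong₂ (λ a b → ⟦ a ℕ.% Q ℕ.≟ b ℕ.% Q ⟧)
        (cong (x i ℕ.+_) (trans (cong (τ ℕ.*_) ti≡1) (ℕₚ.*-identityʳ τ))) (w-inv τ x))

  -- Translation along the component of i sweeps x i through all residues while x j stays put, so
  -- exactly one colouring in Q satisfies x i = x j.
  count-forest : ∀ (E : List (Edge n)) i j → rep E i ≢ rep E j → count E ≡ + Q * count ((i , j) ∷ E)
  count-forest {n} E i j i≁j = trans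
    (count-sweep E t (All.map (cong (λ r → ⟦ r Finₚ.≟ rep E i ⟧ₙ)) (rep-constant E)) i ti≡1 (λ x → x j)
      (λ τ x → trans (cong (λ r → x j ℕ.+ τ ℕ.* r) tj≡0) (trans (cong (x j ℕ.+_) (ℕₚ.*-zeroʳ τ)) (ℕₚ.+-identityʳ (x j))))
      (λ x y h → h j))
    (*ʳ (+ Q) (∑-cong (colourings n) (λ x → sym (trans
      (⟦⟧-× (residue x i ℕ.≟ residue x j) (constant? E x) (constant? ((i , j) ∷ E) x) (λ { (p ∷ h) → p , h }) _∷_)
      (ℤₚ.*-comm ⟦ residue x i ℕ.≟ residue x j ⟧ ⟦ constant? E x ⟧)))))
    where
    t : Fin n → ℕ
    t l = ⟦ rep E l Finₚ.≟ rep E i ⟧ₙ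
    ti≡1 : t i ≡ 1
    ti≡1 with rep E i Finₚ.≟ rep E i
    ... | yes _ = refl
    ... | no ¬p = contradiction refl ¬p
    tj≡0 : t j ≡ 0
    tj≡0 with rep E j Finₚ.≟ rep E i
    ... | yes p = contradiction (sym p) i≁j
    ... | no _  = refl

  count-[] : count {n} [] ≡ (+ Q) ^ n
  count-[] {zero}  = refl
  count-[] {suc n} = begin
    count {suc n} []
      ≡⟨ ∑-tuples-suc (downFrom Q) n (λ x → ⟦ constant? [] x ⟧) ⟩
    ∑[ a ∈ downFrom Q ] count {n} []
      ≡⟨ ∑-const (downFrom Q) (count {n} []) ⟩
    + length (downFrom Q) * count {n} []
      ≡⟨ cong₂ (λ a b → + a * b) (Listₚ.length-downFrom Q) (count-[] {n}) ⟩
    + Q * (+ Q) ^ n ∎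

  -- Translating all vertices together, one colouring in Q has value 0 at vertex 0. This factor Q is
  -- what later keeps the rank below the number of vertices.
  count-divisible : ∀ (E : List (Edge (suc n))) → ∃ λ c → count E ≡ + Q * c
  count-divisible E = _ , count-sweep E (λ _ → 1) (All.universal (λ _ → refl) E) zero refl (λ _ → 0) (λ _ _ → refl) (λ _ _ _ → refl)

-- Ramanujan sums averaged over colourings

module _ (q : ℕ) .{{_ : NonZero q}} where

  ramanujan-sum-≡ : ∀ {d} .{{_ : NonZero d}} (x y : Fin n → ℕ) → (∀ i → x i ℕ.% d ≡ y i ℕ.% d) →
                    ramanujan d (sum x) ≡ ramanujan d (sum y)
  ramanujan-sum-≡ {d = d} x y h = trans (reduce (sum x)) (trans (cong (ramanujan d) (sum-≡ x y h)) (sym (reduce (sum y))))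
    where
    reduce : ∀ s → ramanujan d s ≡ ramanujan d (s ℕ.% d)
    reduce s = trans (cong (ramanujan d) (ℕ.m≡m%n+[m/n]*n s d)) (ramanujan-periodic d (s ℕ.% d) (s ℕ./ d))
    sum-≡ : ∀ {n} (x y : Fin n → ℕ) → (∀ i → x i ℕ.% d ≡ y i ℕ.% d) → sum x ℕ.% d ≡ sum y ℕ.% d
    sum-≡ {zero}  x y h = refl
    sum-≡ {suc n} x y h = +-≡ₘ d {x zero} {y zero} (h zero) (sum-≡ (x ∘ suc) (y ∘ suc) (h ∘ suc))

  %-∣ : ∀ {d} .{{_ : NonZero d}} → d ∣ q → ∀ {a b} → a ℕ.% q ≡ b ℕ.% q → a ℕ.% d ≡ b ℕ.% d
  %-∣ {d} d∣q {a} {b} h = trans (sym (ℕ.m∣n⇒o%n%m≡o%m d q a d∣q)) (trans (cong (ℕ._% d) h) (ℕ.m∣n⇒o%n%m≡o%m d q b d∣q))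

  -- If d divides every component size, the sum of a constant colouring is 0 modulo d. Otherwise
  -- some component `k` has a size that d does not divide; translating along it moves the sum
  -- through a nontrivial coset, and the average vanishes.
  ∑-colourings-ramanujan : ∀ (E : List (Edge n)) d .{{_ : NonZero d}} → d ∣ q →
    ∑[ x ∈ colourings q n ] ⟦ constant? q E x ⟧ * ramanujan d (sum x)
    ≡ ⟦ d ∣? multiplicity E ⟧ * ramanujan d 0 * count q E
  ∑-colourings-ramanujan {n} E d d∣q with d ∣? multiplicity E
  ... | yes d∣m = begin
    ∑[ x ∈ colourings q n ] ⟦ constant? q E x ⟧ * ramanujan d (sum x)
      ≡⟨ ∑-cong (colourings q n) (λ x → trans (⟦⟧-*-cong (constant? q E x) (λ h → at-0 x h))
           (ℤₚ.*-comm ⟦ constant? q E x ⟧ (ramanujan d 0))) ⟩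
    ∑[ x ∈ colourings q n ] ramanujan d 0 * ⟦ constant? q E x ⟧
      ≡⟨ ∑-*ˡ (colourings q n) (ramanujan d 0) (λ x → ⟦ constant? q E x ⟧) ⟩
    ramanujan d 0 * count q E
      ≡⟨ cong (λ r → r * count q E) (ℤₚ.*-identityˡ (ramanujan d 0)) ⟨
    1ℤ * ramanujan d 0 * count q E ∎
    where
    at-0 : ∀ x → Constant (residue q x) E → ramanujan d (sum x) ≡ ramanujan d 0
    -- Only the residues of x are constant on the edges, so divisibility is obtained for their sum;
    -- since d ∣ q, that sum agrees with the sum of x modulo d.
    at-0 x h with ∣-trans d∣m (multiplicity-∣ E (residue q x) h)
    ... | divides j eq = trans (ramanujan-sum-≡ x (residue q x) (λ i → sym (ℕ.m∣n⇒o%n%m≡o%m d q (x i) d∣q)))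
                               (trans (cong (ramanujan d) eq) (ramanujan-periodic d 0 j))
  ... | no  d∤m = trans (ℤₚ.*-cancelˡ-≡ (+ d) _ 0ℤ (trans average (sym (ℤₚ.*-zeroʳ (+ d)))))
                        (sym (trans (cong (λ r → r * count q E) (ℤₚ.*-zeroˡ (ramanujan d 0))) (ℤₚ.*-zeroˡ (count q E))))
    where
    bad : ∃ λ k → ¬ d ∣ size E k
    bad = Finₚ.¬∀⟶∃¬ n (λ k → d ∣ size E k) (λ k → d ∣? size E k) (λ h → d∤m (gcds-greatest (size E) h))
    k = proj₁ bad
    t : Fin n → ℕ
    t l = ⟦ rep E l Finₚ.≟ k ⟧ₙ
    t-constant : Constant t E
    t-constant = All.map (cong (λ r → ⟦ r Finₚ.≟ k ⟧ₙ)) (rep-constant E)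
    F : (Fin n → ℕ) → ℤ
    F x = ⟦ constant? q E x ⟧ * ramanujan d (sum x)
    F-periodic : Periodic q F
    F-periodic x y h = cong₂ _*_ (constant-periodic q E x y h) (ramanujan-sum-≡ x y (λ i → %-∣ d∣q (h i)))
    shifted : ∀ τ x → F (x ⊕ (λ l → τ ℕ.* t l)) ≡ ⟦ constant? q E x ⟧ * ramanujan d (sum x ℕ.+ τ ℕ.* size E k)
    shifted τ x = cong₂ _*_ (constant-⊕ q E _ (All.map (cong (τ ℕ.*_)) t-constant) x)
      (cong (ramanujan d) (trans (∑-distrib-+ x (λ l → τ ℕ.* t l)) (cong (sum x ℕ.+_) (sym (*-distribˡ-sum τ t)))))
    average : + d * ∑ₗ (colourings q n) F ≡ 0ℤ
    average = begin
      + d * ∑ₗ (colourings q n) F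
        ≡⟨ cong (λ r → + r * ∑ₗ (colourings q n) F) (Listₚ.length-downFrom d) ⟨
      + length (downFrom d) * ∑ₗ (colourings q n) F
        ≡⟨ ∑-const (downFrom d) _ ⟨
      ∑[ τ ∈ downFrom d ] ∑ₗ (colourings q n) F
        ≡⟨ ∑-cong (downFrom d) (λ τ → trans (sym (∑-colourings-shift q (λ l → τ ℕ.* t l) F F-periodic))
             (∑-cong (colourings q n) (shifted τ))) ⟩
      ∑[ τ ∈ downFrom d ] (∑[ x ∈ colourings q n ] ⟦ constant? q E x ⟧ * ramanujan d (sum x ℕ.+ τ ℕ.* size E k))
        ≡⟨ ∑-swap (downFrom d) (colourings q n) _ ⟩
      ∑[ x ∈ colourings q n ] (∑[ τ ∈ downFrom d ] ⟦ constant? q E x ⟧ * ramanujan d (sum x ℕ.+ τ ℕ.* size E k))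
        ≡⟨ ∑-cong (colourings q n) (λ x → trans (∑-*ˡ (downFrom d) ⟦ constant? q E x ⟧ _)
             (trans (*ʳ ⟦ constant? q E x ⟧ (∑-ramanujan-shift d d (size E k) (sum x) ∣-refl (proj₂ bad)))
                    (ℤₚ.*-zeroʳ ⟦ constant? q E x ⟧))) ⟩
      ∑ₗ (colourings q n) (λ _ → 0ℤ)
        ≡⟨ ∑-zero (colourings q n) ⟩
      0ℤ ∎

  -- Evaluated through n [n ∣ s] = ∑_{d ∣ n} c_d(s).
  ∑-colourings-∣ : ∀ (E : List (Edge n)) .{{_ : NonZero n}} → n ∣ q →
    ∑[ x ∈ colourings q n ] ⟦ constant? q E x ⟧ * (+ n * ⟦ n ∣? sum x ⟧) ≡ + multiplicity E * count q E
  ∑-colourings-∣ {n} E n∣q = begin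
    ∑[ x ∈ colourings q n ] ⟦ constant? q E x ⟧ * (+ n * ⟦ n ∣? sum x ⟧)
      ≡⟨ ∑-cong (colourings q n) (λ x → trans (*ʳ ⟦ constant? q E x ⟧ (sym (∑-ramanujan n (∣⇒≤ n∣q) (sum x))))
           (sym (∑-*ˡ D ⟦ constant? q E x ⟧ (λ d → ⟦ d ∣? n ⟧ * ramanujan d (sum x))))) ⟩
    ∑[ x ∈ colourings q n ] (∑[ d ∈ D ] ⟦ constant? q E x ⟧ * (⟦ d ∣? n ⟧ * ramanujan d (sum x)))
      ≡⟨ ∑-swap (colourings q n) D _ ⟩
    ∑[ d ∈ D ] (∑[ x ∈ colourings q n ] ⟦ constant? q E x ⟧ * (⟦ d ∣? n ⟧ * ramanujan d (sum x)))
      ≡⟨ ∑-cong D by-divisor ⟩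
    ∑[ d ∈ D ] ⟦ d ∣? multiplicity E ⟧ * ramanujan d 0 * count q E
      ≡⟨ ∑-*ʳ D (count q E) (λ d → ⟦ d ∣? multiplicity E ⟧ * ramanujan d 0) ⟩
    (∑[ d ∈ D ] ⟦ d ∣? multiplicity E ⟧ * ramanujan d 0) * count q E
      ≡⟨ cong (λ r → r * count q E) (∑-ramanujan (multiplicity E) (∣⇒≤ (∣-trans (multiplicity-∣-n E) n∣q)) 0) ⟩
    + multiplicity E * ⟦ multiplicity E ∣? 0 ⟧ * count q E
      ≡⟨ cong (λ r → + multiplicity E * r * count q E) (⟦⟧-yes (multiplicity E ∣? 0) (multiplicity E ∣0)) ⟩
    + multiplicity E * 1ℤ * count q E
      ≡⟨ cong (λ r → r * count q E) (ℤₚ.*-identityʳ (+ multiplicity E)) ⟩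
    + multiplicity E * count q E ∎
    where
    D = downFrom (suc q)
    instance
      m≢0 : NonZero (multiplicity E)
      m≢0 = ℕ.≢-nonZero λ m≡0 → ℕ.≢-nonZero⁻¹ n (0∣⇒≡0 (subst (_∣ n) m≡0 (multiplicity-∣-n E)))
    pull : ∀ a b c → a * (b * c) ≡ b * (a * c)
    pull = solve-∀
    by-divisor : ∀ d → ∑[ x ∈ colourings q n ] ⟦ constant? q E x ⟧ * (⟦ d ∣? n ⟧ * ramanujan d (sum x))
                     ≡ ⟦ d ∣? multiplicity E ⟧ * ramanujan d 0 * count q E
    by-divisor d = trans
      (trans (∑-cong (colourings q n) (λ x → pull ⟦ constant? q E x ⟧ ⟦ d ∣? n ⟧ (ramanujan d (sum x))))
             (∑-*ˡ (colourings q n) ⟦ d ∣? n ⟧ (λ x → ⟦ constant? q E x ⟧ * ramanujan d (sum x))))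
      (by-cases (d ∣? n))
      where
      by-cases : (d∣?n : Dec (d ∣ n)) → ⟦ d∣?n ⟧ * (∑[ x ∈ colourings q n ] ⟦ constant? q E x ⟧ * ramanujan d (sum x))
                                      ≡ ⟦ d ∣? multiplicity E ⟧ * ramanujan d 0 * count q E
      by-cases (yes d∣n) = trans (ℤₚ.*-identityˡ _)
        (∑-colourings-ramanujan E d {{ℕ.≢-nonZero λ { refl → ℕ.≢-nonZero⁻¹ n (0∣⇒≡0 d∣n) }}} (∣-trans d∣n n∣q))
      by-cases (no d∤n) = sym (trans (cong (λ r → r * ramanujan d 0 * count q E)
          (⟦⟧-no (d ∣? multiplicity E) (λ h → d∤n (∣-trans h (multiplicity-∣-n E)))))
        (0*0* (ramanujan d 0) (count q E) (∑[ x ∈ colourings q n ] ⟦ constant? q E x ⟧ * ramanujan d (sum x))))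
        where
        0*0* : ∀ a b c → 0ℤ * a * b ≡ 0ℤ * c
        0*0* = solve-∀

-- Ranks through numbers of colourings

subs-map : (f : X → Y) (xs : List X) → subs (map f xs) ≡ map (map f) (subs xs)
subs-map f []       = refl
subs-map f (x ∷ xs) = trans (cong₂ _++_ (subs-map f xs) (trans (cong (map (f x ∷_)) (subs-map f xs))
    (trans (sym (Listₚ.map-∘ (subs xs))) (Listₚ.map-∘ (subs xs)))))
  (sym (Listₚ.map-++ (map f) (subs xs) _))

subs-All : ∀ {P : X → Set} xs {ys} → ys ∈ subs xs → All P xs → All P ys
subs-All []       (here refl) []       = []
subs-All (x ∷ xs) ys∈         (p ∷ ps) with ∈-++⁻ (subs xs) ys∈
... | inj₁ ys∈′ = subs-All xs ys∈′ ps
... | inj₂ ys∈′ with ∈-map⁻ (x ∷_) ys∈′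
... | zs , zs∈ , refl = p ∷ subs-All xs zs∈ ps

subs-length : ∀ (xs : List X) {ys} → ys ∈ subs xs → length ys ℕ.≤ length xs
subs-length []       (here refl) = z≤n
subs-length (x ∷ xs) ys∈ with ∈-++⁻ (subs xs) ys∈
... | inj₁ ys∈′ = ℕₚ.m≤n⇒m≤1+n (subs-length xs ys∈′)
... | inj₂ ys∈′ with ∈-map⁻ (x ∷_) ys∈′
... | zs , zs∈ , refl = s≤s (subs-length xs zs∈)

-- By `LinIndep-head` each new edge of an independent list joins two different components, so it
-- divides the number of colourings by Q.
forest-count : ∀ Q .{{_ : NonZero Q}} (S : List (Edge n)) → LinIndep (roots S) → count Q S * (+ Q) ^ length S ≡ (+ Q) ^ n
forest-count {n} Q []            indep = trans (ℤₚ.*-identityʳ (count Q {n} [])) (count-[] Q {n})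
forest-count {n} Q ((i , j) ∷ S) indep = begin
  count Q ((i , j) ∷ S) * (+ Q * (+ Q) ^ length S)
    ≡⟨ shuffle (count Q ((i , j) ∷ S)) (+ Q) ((+ Q) ^ length S) ⟩
  (+ Q * count Q ((i , j) ∷ S)) * (+ Q) ^ length S
    ≡⟨ cong (_* (+ Q) ^ length S) (count-forest Q S i j (λ eq →
         LinIndep-head (root i j) (roots S) indep (same-component⇒span S i j eq))) ⟨
  count Q S * (+ Q) ^ length S
    ≡⟨ forest-count Q S (LinIndep-tail (root i j) (roots S) indep) ⟩
  (+ Q) ^ n ∎
  where
  shuffle : ∀ a b c → a * (b * c) ≡ (b * a) * c
  shuffle = solve-∀

-- The rank comes with an independent sublist S′ spanning E. An edge in its span stays within one
-- component of S′, so E and S′ have the same constant colourings, and those of S′ are known.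
rank-count : ∀ (E : List (Edge n)) {r} → IsRank (roots E) r →
             r ℕ.≤ length E × (∀ Q .{{_ : NonZero Q}} → count Q E * (+ Q) ^ r ≡ (+ Q) ^ n)
rank-count {n} E (S , S∈ , refl , indep , spans) with ∈-map⁻ roots (subst (S ∈_) (subs-map (uncurry root) E) S∈)
... | S′ , S′∈ , refl = subst (ℕ._≤ length E) (sym |S|≡) (subs-length E S′∈) ,
  λ Q → trans (cong₂ (λ c l → c * (+ Q) ^ l) (∑-cong (colourings Q n) (λ x → ⟦⟧-⇔ (constant? Q E x) (constant? Q S′ x)
      (subs-All E S′∈) (λ h → All.map (λ {(i , j)} r∈ → extend (residue Q x) h i j r∈) (Allₚ.map⁻ spans)))) |S|≡)
    (forest-count Q S′ indep)
  where
  |S|≡ : length (roots S′) ≡ length S′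
  |S|≡ = Listₚ.length-map (uncurry root) S′
  extend : ∀ (f : Fin n → ℕ) → Constant f S′ → ∀ i j → InSpan (roots S′) (root i j) → f i ≡ f j
  extend f h i j r∈ = trans (constant-rep f S′ h i) (trans (cong f (span⇒same-component S′ i j r∈)) (sym (constant-rep f S′ h j)))

-- The characteristic polynomial

pos-^ : ∀ m k → + (m ℕ.^ k) ≡ (+ m) ^ k
pos-^ m zero    = refl
pos-^ m (suc k) = trans (ℤₚ.pos-* m (m ℕ.^ k)) (*ʳ (+ m) (pos-^ m k))

∑-mono-≤ : (xs : List X) {f g : X → ℤ} → (∀ x → f x ℤ.≤ g x) → ∑ₗ xs f ℤ.≤ ∑ₗ xs g
∑-mono-≤ []       h = ℤₚ.≤-refl
∑-mono-≤ (x ∷ xs) h = ℤₚ.+-mono-≤ (h x) (∑-mono-≤ xs h)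

⟦⟧-mono-≤ : {P Q : Set} (p? : Dec P) (q? : Dec Q) → (P → Q) → ⟦ p? ⟧ ℤ.≤ ⟦ q? ⟧
⟦⟧-mono-≤ (yes p) (yes q) f = ℤₚ.≤-refl
⟦⟧-mono-≤ (yes p) (no ¬q) f = contradiction (f p) ¬q
⟦⟧-mono-≤ (no _)  (yes _) f = ℤ.+≤+ z≤n
⟦⟧-mono-≤ (no _)  (no _)  f = ℤₚ.≤-refl

count-≥0 : ∀ Q .{{_ : NonZero Q}} (E : List (Edge n)) → + ∣ count Q E ∣ ≡ count Q E
count-≥0 {n} Q E = ℤₚ.0≤i⇒+∣i∣≡i (subst (ℤ._≤ count Q E) (∑-zero (colourings Q n))
  (∑-mono-≤ (colourings Q n) (λ x → ⟦⟧-mono-≤ {P = ⊥} (no λ ()) (constant? Q E x) λ ())))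

∣count∣ : ∀ (E : List (Edge n)) {r} → IsRank (roots E) r → ∣ count 2 E ∣ ℕ.* 2 ℕ.^ r ≡ 2 ℕ.^ n
∣count∣ {n} E {r} isRank = ℤₚ.+-injective (begin
  + (∣ count 2 E ∣ ℕ.* 2 ℕ.^ r)   ≡⟨ ℤₚ.pos-* ∣ count 2 E ∣ (2 ℕ.^ r) ⟩
  + ∣ count 2 E ∣ * + (2 ℕ.^ r)   ≡⟨ cong₂ _*_ (count-≥0 2 E) (pos-^ 2 r) ⟩
  count 2 E * (+ 2) ^ r           ≡⟨ proj₂ (rank-count E isRank) 2 ⟩
  (+ 2) ^ n                       ≡⟨ pos-^ 2 n ⟨
  + (2 ℕ.^ n)                     ∎)

-- For Q = 2 the count is 2c with c nonzero, so |c| 2^(r+1) = 2^(n+1) bounds r.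
rank-< : ∀ (E : List (Edge (suc n))) {r} → IsRank (roots E) r → r ℕ.≤ n
rank-< {n} E {r} isRank with count-divisible 2 E
... | c , count≡ = ℕₚ.≮⇒≥ λ n<r → ℕₚ.<⇒≢
    (ℕₚ.<-≤-trans (ℕₚ.^-monoʳ-< 2 ℕₚ.≤-refl (s≤s n<r)) (ℕₚ.m≤n*m (2 ℕ.^ suc r) ∣ c ∣ {{c≢0}})) (sym main)
  where
  main : ∣ c ∣ ℕ.* 2 ℕ.^ suc r ≡ 2 ℕ.^ suc n
  main = begin
    ∣ c ∣ ℕ.* (2 ℕ.* 2 ℕ.^ r)    ≡⟨ ℕₚ.*-assoc ∣ c ∣ 2 (2 ℕ.^ r) ⟨
    ∣ c ∣ ℕ.* 2 ℕ.* 2 ℕ.^ r      ≡⟨ cong (ℕ._* 2 ℕ.^ r) (trans (ℕₚ.*-comm ∣ c ∣ 2) (sym (trans (cong ∣_∣ count≡) (ℤₚ.abs-* (+ 2) c)))) ⟩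
    ∣ count 2 E ∣ ℕ.* 2 ℕ.^ r    ≡⟨ ∣count∣ E isRank ⟩
    2 ℕ.^ suc n                  ∎
  c≢0 : NonZero ∣ c ∣
  c≢0 = ℕ.≢-nonZero λ c≡0 → ℕ.≢-nonZero⁻¹ (2 ℕ.^ suc n) {{ℕₚ.m^n≢0 2 (suc n)}} (trans (sym main) (cong (ℕ._* 2 ℕ.^ suc r) c≡0))

-- More edges leave fewer constant colourings, and for Q = 2 the count times 2 to the rank is the
-- fixed number 2^n.
rank-mono : ∀ (E F : List (Edge n)) {r s} → (∀ {P : Edge n → Set} → All P F → All P E) →
            IsRank (roots E) r → IsRank (roots F) s → r ℕ.≤ s
rank-mono {n} E F {r} {s} E⊆F isRank-E isRank-F = ℕₚ.≮⇒≥ λ s<r → ℕₚ.<⇒≢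
  (ℕₚ.<-≤-trans (ℕₚ.*-monoʳ-< ∣ count 2 F ∣ {{F≢0}} (ℕₚ.^-monoʳ-< 2 ℕₚ.≤-refl s<r)) (ℕₚ.*-monoˡ-≤ (2 ℕ.^ r) F≤E))
  (trans (∣count∣ F isRank-F) (sym (∣count∣ E isRank-E)))
  where
  F≢0 : NonZero ∣ count 2 F ∣
  F≢0 = ℕ.≢-nonZero λ F≡0 → ℕ.≢-nonZero⁻¹ (2 ℕ.^ n) {{ℕₚ.m^n≢0 2 n}}
    (trans (sym (∣count∣ F isRank-F)) (cong (ℕ._* 2 ℕ.^ s) F≡0))
  F≤E : ∣ count 2 F ∣ ℕ.≤ ∣ count 2 E ∣
  F≤E = ℤₚ.drop‿+≤+ (subst₂ ℤ._≤_ (sym (count-≥0 2 F)) (sym (count-≥0 2 E))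
    (∑-mono-≤ (colourings 2 n) (λ x → ⟦⟧-mono-≤ (constant? 2 F x) (constant? 2 E x) E⊆F)))

subs-self : (xs : List X) → xs ∈ subs xs
subs-self []       = here refl
subs-self (x ∷ xs) = ∈-++⁺ʳ (subs xs) (∈-map⁺ (x ∷_) (subs-self xs))

^-* : ∀ x y k → (x * y) ^ k ≡ x ^ k * y ^ k
^-* x y zero    = refl
^-* x y (suc k) = trans (*ʳ (x * y) (^-* x y k)) (interchange x y (x ^ k) (y ^ k))
  where
  interchange : ∀ a b c d → a * b * (c * d) ≡ a * c * (b * d)
  interchange = solve-∀

sign² : ∀ k → (- 1ℤ) ^ k * (- 1ℤ) ^ k ≡ 1ℤ
sign² zero    = refl
sign² (suc k) = trans (square ((- 1ℤ) ^ k)) (sign² k)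
  where
  square : ∀ a → - 1ℤ * a * (- 1ℤ * a) ≡ a * a
  square = solve-∀

-- At x = 1 - q, y = 0 the bases x - 1 and y - 1 are -q and -1. The signs with exponents rL, rL - rB
-- and l - rB combine to (-1)^l, the powers of q to N - rB; the three inequalities make the
-- truncated differences exact.
χ-term : ∀ (q m : ℤ) {rB rL N l} → rB ℕ.≤ rL → rL ℕ.≤ N → rB ℕ.≤ l →
         (- 1ℤ) ^ rL * q ^ (N ∸ rL) * (m * ((1ℤ - q) - 1ℤ) ^ (rL ∸ rB) * (0ℤ - 1ℤ) ^ (l ∸ rB))
         ≡ (- 1ℤ) ^ l * (m * q ^ (N ∸ rB))
χ-term q m {rB} {rL} {N} {l} rB≤rL rL≤N rB≤l = begin
  (- 1ℤ) ^ rL * q ^ c * (m * ((1ℤ - q) - 1ℤ) ^ b * (- 1ℤ) ^ d)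
    ≡⟨ cong₂ (λ i x → (- 1ℤ) ^ i * q ^ c * (m * x * (- 1ℤ) ^ d)) (sym (ℕₚ.m+[n∸m]≡n rB≤rL))
         (trans (cong (_^ b) (minus q)) (^-* (- 1ℤ) q b)) ⟩
  (- 1ℤ) ^ (rB ℕ.+ b) * q ^ c * (m * ((- 1ℤ) ^ b * q ^ b) * (- 1ℤ) ^ d)
    ≡⟨ cong (λ x → x * q ^ c * (m * ((- 1ℤ) ^ b * q ^ b) * (- 1ℤ) ^ d)) (ℤₚ.^-distribˡ-+-* (- 1ℤ) rB b) ⟩
  (- 1ℤ) ^ rB * (- 1ℤ) ^ b * q ^ c * (m * ((- 1ℤ) ^ b * q ^ b) * (- 1ℤ) ^ d)
    ≡⟨ shuffle ((- 1ℤ) ^ rB) ((- 1ℤ) ^ b) (q ^ c) m (q ^ b) ((- 1ℤ) ^ d) ⟩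
  (- 1ℤ) ^ b * (- 1ℤ) ^ b * ((- 1ℤ) ^ rB * (- 1ℤ) ^ d * (m * (q ^ b * q ^ c)))
    ≡⟨ trans (cong (_* ((- 1ℤ) ^ rB * (- 1ℤ) ^ d * (m * (q ^ b * q ^ c)))) (sign² b)) (ℤₚ.*-identityˡ _) ⟩
  (- 1ℤ) ^ rB * (- 1ℤ) ^ d * (m * (q ^ b * q ^ c))
    ≡⟨ cong₂ (λ x y → x * (m * y)) (ℤₚ.^-distribˡ-+-* (- 1ℤ) rB d) (ℤₚ.^-distribˡ-+-* q b c) ⟨
  (- 1ℤ) ^ (rB ℕ.+ d) * (m * q ^ (b ℕ.+ c))
    ≡⟨ cong₂ (λ i j → (- 1ℤ) ^ i * (m * q ^ j)) (ℕₚ.m+[n∸m]≡n rB≤l) b+c ⟩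
  (- 1ℤ) ^ l * (m * q ^ (N ∸ rB)) ∎
  where
  b = rL ∸ rB
  c = N ∸ rL
  d = l ∸ rB
  minus : ∀ q → (1ℤ - q) - 1ℤ ≡ - 1ℤ * q
  minus = solve-∀
  shuffle : ∀ a b c m e d → a * b * c * (m * (b * e) * d) ≡ b * b * (a * d * (m * (e * c)))
  shuffle = solve-∀
  b+c : b ℕ.+ c ≡ N ∸ rB
  b+c = trans (sym (ℕₚ.m+n∸m≡n rB (b ℕ.+ c))) (cong (_∸ rB) (trans (sym (ℕₚ.+-assoc rB b c))
    (trans (cong (ℕ._+ c) (ℕₚ.m+[n∸m]≡n rB≤rL)) (ℕₚ.m+[n∸m]≡n rL≤N))))

-- Here n is the rank of the weight lattice, one less than the number of vertices; the extra factor
-- q makes up for this.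
rank-power : ∀ q .{{_ : NonZero q}} (E : List (Edge (suc n))) {r} → IsRank (roots E) r → + q * (+ q) ^ (n ∸ r) ≡ count q E
rank-power {n} q E {r} isRank = ℤₚ.*-cancelʳ-≡ _ _ ((+ q) ^ r) {{q^r≢0}} (begin
  + q * (+ q) ^ (n ∸ r) * (+ q) ^ r   ≡⟨ ℤₚ.*-assoc (+ q) _ _ ⟩
  + q * ((+ q) ^ (n ∸ r) * (+ q) ^ r) ≡⟨ *ʳ (+ q) (ℤₚ.^-distribˡ-+-* (+ q) (n ∸ r) r) ⟨
  + q * (+ q) ^ (n ∸ r ℕ.+ r)         ≡⟨ cong (λ i → (+ q) ^ suc i) (ℕₚ.m∸n+n≡m (rank-< E isRank)) ⟩
  (+ q) ^ suc n                       ≡⟨ proj₂ (rank-count E isRank) q ⟨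
  count q E * (+ q) ^ r               ∎)
  where
  q^r≢0 : ℤ.NonZero ((+ q) ^ r)
  q^r≢0 = subst ℤ.NonZero (pos-^ q r) (ℕₚ.m^n≢0 q r)

∏-constant : ∀ Q .{{_ : NonZero Q}} (E : List (Edge n)) x →
             ⟦ constant? Q E x ⟧ ≡ ∏ E (λ (i , j) → ⟦ residue Q x i ℕ.≟ residue Q x j ⟧)
∏-constant Q []            x = refl
∏-constant Q ((i , j) ∷ E) x = trans
  (⟦⟧-× (residue Q x i ℕ.≟ residue Q x j) (constant? Q E x) (constant? Q ((i , j) ∷ E) x) (λ { (p ∷ h) → p , h }) _∷_)
  (*ʳ ⟦ residue Q x i ℕ.≟ residue Q x j ⟧ (∏-constant Q E x))

inclusion-exclusion : ∀ q .{{_ : NonZero q}} (f : ℕ → ℤ) →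
  ∑[ E ∈ subs (edges n) ] (- 1ℤ) ^ length E * (∑[ x ∈ colourings q n ] ⟦ constant? q E x ⟧ * f (sum x))
  ≡ ∑[ x ∈ colourings q n ] injectivity n x * f (sum x)
inclusion-exclusion {n} q f = begin
  ∑[ E ∈ subs (edges n) ] (- 1ℤ) ^ length E * (∑[ x ∈ colourings q n ] ⟦ constant? q E x ⟧ * f (sum x))
    ≡⟨ ∑-cong (subs (edges n)) (λ E → trans (sym (∑-*ˡ (colourings q n) ((- 1ℤ) ^ length E) _))
         (∑-cong (colourings q n) (λ x → sym (ℤₚ.*-assoc ((- 1ℤ) ^ length E) ⟦ constant? q E x ⟧ (f (sum x)))))) ⟩
  ∑[ E ∈ subs (edges n) ] (∑[ x ∈ colourings q n ] (- 1ℤ) ^ length E * ⟦ constant? q E x ⟧ * f (sum x))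
    ≡⟨ ∑-swap (subs (edges n)) (colourings q n) _ ⟩
  ∑[ x ∈ colourings q n ] (∑[ E ∈ subs (edges n) ] (- 1ℤ) ^ length E * ⟦ constant? q E x ⟧ * f (sum x))
    ≡⟨ ∑-cong-∈ (colourings q n) (λ {x} x∈ → trans (∑-*ʳ (subs (edges n)) (f (sum x)) _)
         (cong (_* f (sum x)) (signed x (All.lookup below-q x∈)))) ⟩
  ∑[ x ∈ colourings q n ] injectivity n x * f (sum x) ∎
  where
  below-q : All (λ x → ∀ i → x i ℕ.< q) (colourings q n)
  below-q = tuples-All n (All.tabulate ∈-downFrom⁻)
  signed : ∀ x → (∀ i → x i ℕ.< q) → ∑[ E ∈ subs (edges n) ] (- 1ℤ) ^ length E * ⟦ constant? q E x ⟧ ≡ injectivity n x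
  signed x x<q = begin
    ∑[ E ∈ subs (edges n) ] (- 1ℤ) ^ length E * ⟦ constant? q E x ⟧
      ≡⟨ ∑-cong (subs (edges n)) (λ E → *ʳ ((- 1ℤ) ^ length E) (∏-constant q E x)) ⟩
    ∑[ E ∈ subs (edges n) ] (- 1ℤ) ^ length E * ∏ E (λ (i , j) → ⟦ residue q x i ℕ.≟ residue q x j ⟧)
      ≡⟨ ∑-subs (edges n) (λ (i , j) → ⟦ residue q x i ℕ.≟ residue q x j ⟧) ⟩
    ∏ (edges n) (λ (i , j) → 1ℤ - ⟦ residue q x i ℕ.≟ residue q x j ⟧)
      -- Colours lie below q, so they coincide with their residues and equality modulo q is
      -- equality.
      ≡⟨ ∏-cong-∈ (edges n) (λ {(i , j)} _ → cong₂ (λ a b → 1ℤ - ⟦ a ℕ.≟ b ⟧) (ℕ.m<n⇒m%n≡m (x<q i)) (ℕ.m<n⇒m%n≡m (x<q j))) ⟩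
    injectivity n x ∎

theorem1p14 : (n q : ℕ) → n ≥ 1 → q ≥ 1 → Odd n → n ∣ q →
    (r m : List (Vecℚ n) → ℕ) →
    (∀ B → B ∈ subs (A n) → IsRank B (r B)) →
    (∀ B → B ∈ subs (A n) → IsIndexW n B (m B)) →
    (k : ℕ) → IsNecklaceCount n q k →
    χ r m (n ∸ 1) (A n) (+ q) ≡ + (n !) * + k
theorem1p14 n@(suc n-1) q@(suc _) _ _ odd n∣q r m isRank isIndex k isCount = ℤₚ.*-cancelˡ-≡ (+ q) _ _ (begin
  -- The lattice has rank n - 1, so each power of q falls one factor short of a number of
  -- colourings. The equation is proved after multiplication by q, which is nonzero.
  + q * χ r m n-1 (A n) (+ q)
    ≡⟨ *ʳ (+ q) (∑-*ˡ (subs (A n)) (sign-power) term) ⟨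
  + q * (∑[ B ∈ subs (A n) ] sign-power * term B)
    ≡⟨ ∑-*ˡ (subs (A n)) (+ q) (λ B → sign-power * term B) ⟨
  ∑[ B ∈ subs (A n) ] + q * (sign-power * term B)
    ≡⟨ cong (λ Bs → ∑[ B ∈ Bs ] + q * (sign-power * term B)) subs-A ⟩
  ∑[ B ∈ map roots (subs (edges n)) ] + q * (sign-power * term B)
    ≡⟨ ∑-map roots (subs (edges n)) (λ B → + q * (sign-power * term B)) ⟩
  ∑[ E ∈ subs (edges n) ] + q * (sign-power * term (roots E))
    ≡⟨ ∑-cong-∈ (subs (edges n)) (λ {E} E∈ → by-subset E E∈) ⟩
  ∑[ E ∈ subs (edges n) ] (- 1ℤ) ^ length E * (∑[ x ∈ colourings q n ] ⟦ constant? q E x ⟧ * (+ n * ⟦ n ∣? sum x ⟧))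
    ≡⟨ inclusion-exclusion {n} q (λ s → + n * ⟦ n ∣? s ⟧) ⟩
  ∑[ x ∈ colourings q n ] injectivity n x * (+ n * ⟦ n ∣? sum x ⟧)
    ≡⟨ ∑-injective-tuples n (downFrom q) (Uniqueₚ.downFrom⁺ q) (λ s → + n * ⟦ n ∣? s ⟧) ⟩
  + (n !) * ∑-subsets n (downFrom q) (λ s → + n * ⟦ n ∣? s ⟧)
    ≡⟨ *ʳ (+ (n !)) (∑-words-subsets n q (λ s → + n * ⟦ n ∣? s ⟧)) ⟨
  + (n !) * (∑[ w ∈ words q ] ⟦ blacks w ℕ.≟ n ⟧ * (+ n * ⟦ n ∣? weight w ⟧))
    ≡⟨ *ʳ (+ (n !)) (necklaces-by-weight n q k odd n∣q isCount) ⟩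
  + (n !) * (+ q * + k)
    ≡⟨ pull (+ (n !)) (+ q) (+ k) ⟩
  + q * (+ (n !) * + k) ∎)
  where
  pull : ∀ a b c → a * (b * c) ≡ b * (a * c)
  pull = solve-∀
  subs-A : subs (A n) ≡ map roots (subs (edges n))
  subs-A = trans (cong subs (A≡roots n)) (subs-map (uncurry root) (edges n))
  roots∈ : ∀ {E} → E ∈ subs (edges n) → roots E ∈ subs (A n)
  roots∈ {E} E∈ = subst (roots E ∈_) (sym subs-A) (∈-map⁺ roots E∈)
  sign-power : ℤ
  sign-power = (- 1ℤ) ^ r (A n) * (+ q) ^ (n-1 ∸ r (A n))
  term : List (Vecℚ n) → ℤ
  term B = + m B * ((1ℤ - + q) - 1ℤ) ^ (r (A n) ∸ r B) * (0ℤ - 1ℤ) ^ (length B ∸ r B)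
  isRank-A : IsRank (roots (edges n)) (r (A n))
  isRank-A = subst (λ B → IsRank B (r (A n))) (A≡roots n) (isRank (A n) (subs-self (A n)))
  by-subset : ∀ E → E ∈ subs (edges n) → + q * (sign-power * term (roots E)) ≡
    (- 1ℤ) ^ length E * (∑[ x ∈ colourings q n ] ⟦ constant? q E x ⟧ * (+ n * ⟦ n ∣? sum x ⟧))
  by-subset E E∈ = begin
    + q * (sign-power * term B)
      ≡⟨ *ʳ (+ q) (χ-term (+ q) (+ m B) (rank-mono E (edges n) (subs-All (edges n) E∈) isRank-E isRank-A)
           (rank-< (edges n) isRank-A) (subst (r B ℕ.≤_) (sym |B|≡|E|) (proj₁ (rank-count E isRank-E)))) ⟩
    + q * ((- 1ℤ) ^ length B * (+ m B * (+ q) ^ (n-1 ∸ r B)))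
      ≡⟨ shuffle (+ q) ((- 1ℤ) ^ length B) (+ m B) ((+ q) ^ (n-1 ∸ r B)) ⟩
    (- 1ℤ) ^ length B * (+ m B * (+ q * (+ q) ^ (n-1 ∸ r B)))
      -- Here the assumed index and rank become invariants of the graph: the gcd of the component
      -- sizes and the number of constant colourings.
      ≡⟨ cong₂ (λ l c → (- 1ℤ) ^ l * c) |B|≡|E| (cong₂ (λ g c → + g * c)
           (index-unique n E (isIndex B (roots∈ E∈))) (rank-power q E isRank-E)) ⟩
    (- 1ℤ) ^ length E * (+ multiplicity E * count q E)
      ≡⟨ *ʳ ((- 1ℤ) ^ length E) (∑-colourings-∣ q E n∣q) ⟨
    (- 1ℤ) ^ length E * (∑[ x ∈ colourings q n ] ⟦ constant? q E x ⟧ * (+ n * ⟦ n ∣? sum x ⟧)) ∎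
    where
    B = roots E
    |B|≡|E| = Listₚ.length-map (uncurry root) E
    isRank-E : IsRank B (r B)
    isRank-E = isRank B (roots∈ E∈)
    shuffle : ∀ a b c d → a * (b * (c * d)) ≡ b * (c * (a * d))
    shuffle = solve-∀
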